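{- Let $W$ be a finite Coxeter group and $c$ a Coxeter element of $W$. The set of $c$-sortable elements of $W$ is a sublattice of the weak order on $W$, i.e. it is closed under the meet and join operations of the weak order.
   Context: A Coxeter system $(W,S)$ has $S=\{s_1,\dots,s_n\}$ and presentation $W=\langle S\mid s_i^2=1,\ (s_is_j)^{m(i,j)}=1\rangle$; here $W$ is finite. $\ell(w)$ is the length of a reduced word for $w$. The (right) weak order sets $u\le w$ iff a reduced word for $u$ is a prefix of a reduced word for $w$; for finite $W$ it is a lattice. A Coxeter element is a product $c=s_1\cdots s_n$ of all elements of $S$, each once. Sorting words: fix a reduced word $s_1\cdots s_n$ for $c$; the $(s_1,\dots,s_n)$-sorting word of $w$ is built greedily by testing letters in the cyclic order $s_1,\dots,s_n,s_1,\dots$ (continuing from the letter after the last tested), appending a tested letter $a$ and replacing the current element $w'$ (initially $w$) by $aw'$ whenever $\ell(aw')<\ell(w')$, until $w'=1$. Each full cycle through $(s_1,\dots,s_n)$ is a pass; $w$ is $c$-sortable if the sets of letters appended in successive passes are weakly decreasing under inclusion (this depends only on $c$). -}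

module Defs where

open import Algebra.Bundles using (Group)
open import Data.Fin.Base using (Fin)
import Data.Fin.Properties as Fin
open import Data.List.Base using (List; []; _∷_; _++_; foldr; length; allFin; concat; replicate)
open import Data.List.Relation.Binary.Permutation.Propositional using (_↭_)
open import Data.List.Relation.Binary.Subset.Propositional using (_⊆_)
open import Data.Nat.Base using (ℕ; zero; suc; _≤_; _<_)
open import Data.Nat.Induction using (<-wellFounded)
open import Data.Nat.Properties using (anyUpTo?; _<?_; ≮⇒≥)
open import Data.Product.Base using (∃-syntax; ∃₂; _×_; _,_; proj₁; proj₂)
open import Function.Base using (case_of_)
open import Function.Bundles using (Inverse; _⇔_)
open import Function.Properties.Inverse using (Inverse⇒Injection)
open import Induction.WellFounded using (Acc; acc)
open import Level using (Level; _⊔_)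
open import Relation.Binary.Construct.Closure.Equivalence using (EqClosure)
open import Relation.Binary.Definitions using (Decidable)
open import Relation.Binary.PropositionalEquality as ≡ using (_≡_; _≢_)
open import Relation.Nullary.Decidable using (Dec; yes; no; map′; via-injection)

-- The entry 0 stands for ∞: its relator is the empty word, i.e. no relation.
record CoxeterMatrix (n : ℕ) : Set where
  field
    m         : Fin n → Fin n → ℕ
    symmetric : ∀ i j → m i j ≡ m j i
    diagonal  : ∀ i → m i i ≡ 1
    off-diag  : ∀ i j → i ≢ j → m i j ≢ 1

module Presentation {n : ℕ} (M : CoxeterMatrix n) where
  open CoxeterMatrix M

  Word : Set
  Word = List (Fin n)

  data Relator : Word → Set where
    square : ∀ i → Relator (i ∷ i ∷ [])
    power  : ∀ i j → Relator (concat (replicate (m i j) (i ∷ j ∷ [])))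

  data Deletes : Word → Word → Set where
    delete : ∀ u {r} v → Relator r → Deletes (u ++ r ++ v) (u ++ v)

  -- Equality in ⟨ S ∣ sᵢ² = 1 , (sᵢ sⱼ)^m(i,j) = 1 ⟩.  As the generators are
  -- involutions, every element is represented by a word without inverses.
  infix 4 _∼_
  _∼_ : Word → Word → Set
  _∼_ = EqClosure Deletes

record CoxeterSystem {g e : Level} (W : Group g e) : Set (g ⊔ e) where
  open Group W using (Carrier; _≈_; _∙_; ε)
  field
    rank   : ℕ
    matrix : CoxeterMatrix rank
    s      : Fin rank → Carrier

  open CoxeterMatrix matrix public
  open Presentation matrix public

  ⟦_⟧ : Word → Carrier
  ⟦_⟧ = foldr (λ i w → s i ∙ w) ε

  field
    generates : ∀ w → ∃[ a ] ⟦ a ⟧ ≈ w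
    presents  : ∀ a b → (⟦ a ⟧ ≈ ⟦ b ⟧) ⇔ (a ∼ b)

Finite : {g e : Level} → Group g e → Set (g ⊔ e)
Finite W = ∃[ N ] Inverse (Group.setoid W) (≡.setoid (Fin N))

module Coxeter {g e : Level} {W : Group g e} (C : CoxeterSystem W) where
  open Group W using (Carrier; _≈_; _∙_; ε; _⁻¹)
  open CoxeterSystem C

  infix 4 _IsReducedWordOf_ _≤ᵂ_

  _IsReducedWordOf_ : Word → Carrier → Set e
  a IsReducedWordOf w = ⟦ a ⟧ ≈ w × (∀ b → ⟦ b ⟧ ≈ w → length a ≤ length b)

  _≤ᵂ_ : Carrier → Carrier → Set e
  u ≤ᵂ w = ∃₂ λ a b → a IsReducedWordOf u × (a ++ b) IsReducedWordOf w

  -- A Coxeter element together with the word s₁⋯sₙ for it that is fixed to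
  -- define sorting words; the enumeration of S is arbitrary.
  record CoxeterElement : Set (g ⊔ e) where
    field
      element     : Carrier
      word        : Word
      enumeratesS : word ↭ allFin rank
      product     : ⟦ word ⟧ ≈ element

  module Sorting (finite : Finite W) where
    open Group W using (refl; sym; trans; assoc; ∙-congˡ; ∙-congʳ; identityˡ; inverseˡ; inverseʳ)

    _≈?_ : Decidable _≈_
    _≈?_ = via-injection (Inverse⇒Injection (proj₂ finite)) Fin._≟_

    HasWord : Carrier → ℕ → Set e
    HasWord w k = ∃[ a ] ⟦ a ⟧ ≈ w × length a ≡ k

    hasWord? : ∀ w k → Dec (HasWord w k)
    hasWord? w zero =
      map′ (λ ε≈w → [] , ε≈w , ≡.refl) (λ { ([] , ε≈w , _) → ε≈w }) (ε ≈? w)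
    hasWord? w (suc k) =
      map′ (λ { (i , a , a≈ , ≡.refl) → i ∷ a
               , trans (∙-congˡ a≈) (cancel (inverseʳ (s i))) , ≡.refl })
           (λ { (i ∷ a , ia≈w , ≡.refl) → i , a
               , trans (sym (cancel (inverseˡ (s i)))) (∙-congˡ ia≈w) , ≡.refl })
           (Fin.any? (λ i → hasWord? (s i ⁻¹ ∙ w) k))
      where
      cancel : ∀ {x y z} → x ∙ y ≈ ε → x ∙ (y ∙ z) ≈ z
      cancel xy≈ε = trans (sym (assoc _ _ _)) (trans (∙-congʳ xy≈ε) (identityˡ _))

    shorten : ∀ {w} a → ⟦ a ⟧ ≈ w → Acc _<_ (length a) → ∃[ b ] b IsReducedWordOf w
    shorten {w} a a≈w (acc rs) = case anyUpTo? (hasWord? w) (length a) of λ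
      { (yes (_ , b<a , b , b≈w , ≡.refl)) → shorten b b≈w (rs b<a)
      ; (no none) → a , a≈w , λ b b≈w → ≮⇒≥ λ b<a → none (length b , b<a , b , b≈w , ≡.refl)
      }

    reducedWord : ∀ w → ∃[ a ] a IsReducedWordOf w
    reducedWord w = let a , a≈w = generates w in shorten a a≈w (<-wellFounded (length a))

    ℓ : Carrier → ℕ
    ℓ w = length (proj₁ (reducedWord w))

    -- Test the given letters in order: the letters appended and the element left.
    pass : Word → Carrier → Word × Carrier
    pass []      w = [] , w
    pass (i ∷ a) w with ℓ (s i ∙ w) <? ℓ w
    ... | yes _ = let b , w′ = pass a (s i ∙ w) in i ∷ b , w′
    ... | no  _ = pass a w

    module _ (c : CoxeterElement) where
      open CoxeterElement c using (word)

      remaining : ℕ → Carrier → Carrier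
      remaining zero    w = w
      remaining (suc k) w = proj₂ (pass word (remaining k w))

      -- Passes are indexed from 0 and never stop; once the element left is the
      -- identity nothing is appended, so the surplus passes are empty.
      passLetters : ℕ → Carrier → Word
      passLetters k w = proj₁ (pass word (remaining k w))

      Sortable : Carrier → Set
      Sortable w = ∀ k → passLetters (suc k) w ⊆ passLetters k w

{-# OPTIONS --safe #-}

-- The parity with which a reflection t occurs among the reflections of a word depends only on
-- the element w of the word; the t of odd parity are the inversions of w, and the weak order is
-- inclusion of inversion sets.  Joins exist because they exist for two covers of an element, and
-- w ↦ w w₀ is an antiautomorphism, so the weak order is a lattice.
--
-- Let Θ be the lattice congruence generated by contracting, for each letter i before j in c, the
-- side of the interval [1 , sᵢ ∨ sⱼ] that starts at sⱼ, from sⱼ to the coatom sᵢ(sᵢ ∨ sⱼ).  Let s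
-- be the first letter of c and write J = S ∖ {s}.  The join of the sᵢ with i ∈ J is w₀(J), and the
-- join of the elements s(s ∨ sᵢ) is s w₀, since multiplied by s it lies above all simple
-- reflections.  Thus w₀(J) is congruent to s w₀, so an element not above s is congruent to its
-- factor in W_J.  Dually s is congruent to w₀(J)w₀ for the word with s moved to the end.
-- Since s(s ∨ x) = (s ∨ x) ∧ s w₀ for x not above s, multiplication by s takes Θ on the elements
-- above s to the congruence of the rotated word.  It follows that the minimal elements of the
-- classes of Θ satisfy the recursion defining the c-sortable elements.  The minimal elements of
-- the classes of a lattice congruence are closed under joins; the meet is treated by the recursion,
-- using that the factor of a minimal element in W_J is again minimal.
--
-- That distinct letters give distinct elements of W requires a representation; the geometric
-- one is replaced by an integral one in which 2cos(π/m) becomes the sum of two translations,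
-- acting on odd functions of period 2m.
module Submission where

open import Defs
open import Algebra.Bundles using (Group)
open import Algebra.Core using (Op₂)
import Algebra.Properties.Group as GroupProperties
open import Data.Bool.Base using (Bool; true; false; not; _xor_; if_then_else_)
open import Data.Bool.Properties using (xor-assoc; xor-comm; xor-same; xor-identityʳ; ¬-not) renaming (_≟_ to _≟ᵇ_)
open import Data.Empty using () renaming (⊥ to Empty)
open import Data.Fin.Base using (Fin; zero; suc)
import Data.Fin.Properties as Fin
open import Data.List.Base using (List; []; _∷_; _++_; _∷ʳ_; length; foldr; concat; replicate; allFin)
import Data.List.Membership.DecPropositional as DecMembership
open import Data.List.Membership.Propositional using (_∈_; _∉_)
open import Data.List.Membership.Propositional.Properties using (∈-allFin; ∈-++⁺ˡ; ∈-++⁺ʳ; ∈-++⁻)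
open import Data.List.Properties using (++-identityʳ; ++-assoc; length-++; foldr-++)
open import Data.List.Relation.Binary.Permutation.Propositional using (_↭_; ↭-sym; ↭-trans; ↭⇒↭ₛ)
open import Data.List.Relation.Binary.Permutation.Propositional.Properties using (∷↭∷ʳ; ∈-resp-↭)
import Data.List.Relation.Binary.Permutation.Setoid.Properties as Permutation
open import Data.List.Relation.Binary.Subset.Propositional using (_⊆_)
open import Data.List.Relation.Unary.All using (All; []; _∷_; lookup)
open import Data.List.Relation.Unary.All.Properties using (++⁺)
open import Data.List.Relation.Unary.AllPairs using (_∷_)
open import Data.List.Relation.Unary.Any using (here; there)
open import Data.List.Relation.Unary.Unique.Propositional.Properties using (allFin⁺)
open import Data.Nat.Base as ℕ using (ℕ; zero; suc; _<_; s≤s)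
open import Data.Nat.Induction using (<-wellFounded)
import Data.Nat.Properties as ℕ
open import Data.Product.Base using (_×_; _,_; proj₁; proj₂; ∃-syntax; ∃₂)
open import Data.Sum.Base using (_⊎_; inj₁; inj₂; [_,_]′)
open import Data.Unit.Base using (⊤; tt)
open import Function.Base using (_∘_; flip)
open import Function.Bundles using (mk⇔; Equivalence; Inverse)
open import Induction.WellFounded using (Acc; acc)
open import Level using (Level; _⊔_; 0ℓ) renaming (suc to lsuc)
import Relation.Binary.Construct.Closure.Equivalence as EqClosure
open import Relation.Binary.Core using (Rel)
open import Relation.Binary.Lattice.Bundles using (Lattice)
import Relation.Binary.Lattice.Properties.JoinSemilattice as JoinProperties
import Relation.Binary.Lattice.Properties.MeetSemilattice as MeetProperties
open import Relation.Binary.Lattice.Structures using (IsLattice)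
open import Relation.Binary.PropositionalEquality as ≡ using (_≡_; _≢_; _≗_; module ≡-Reasoning)
import Relation.Binary.Reasoning.Setoid as SetoidReasoning
open import Relation.Nullary.Decidable using (Dec; yes; no; does; does-⇔; dec-true; dec-false; decidable-stable; map′; _×-dec_; _⊎-dec_; ¬?)
open import Relation.Nullary.Negation using (¬_; contradiction)

bounded : ∀ n (f : Fin n → ℕ) → ∃[ b ] ∀ i → f i ℕ.≤ b
bounded zero    f = 0 , λ ()
bounded (suc n) f = let b , f≤ = bounded n (f ∘ Fin.suc) in
  f Fin.zero ℕ.⊔ b , λ { Fin.zero → ℕ.m≤m⊔n _ b ; (Fin.suc i) → ℕ.≤-trans (f≤ i) (ℕ.m≤n⊔m _ b) }

-- Odd periodic functions on the integers and a discrete wave equation.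

module ReflectionRepresentation where
  open import Data.Integer.Base using (ℤ; +_; -[1+_]; _+_; -_; _-_; _*_)
  open import Data.Integer.Divisibility.Signed using (_∣_; divides; _∣?_; ∣⇒∣ᵤ; ∣m⇒∣-m; ∣m∣n⇒∣m+n; ∣m+n∣n⇒∣m; ∣-refl)
  import Data.Integer.Properties as ℤ
  open import Data.Integer.Solver using (module +-*-Solver)
  import Data.Nat.Divisibility as ℕ
  open +-*-Solver using (solve; con; _:=_; _:+_; _:-_; :-_; _:*_)

  Odd : (ℤ → ℤ) → Set
  Odd f = ∀ x → f (- x) ≡ - f x

  Periodic : ℤ → (ℤ → ℤ) → Set
  Periodic p f = ∀ x → f (x + p) ≡ f x

  double : ℕ → ℤ
  double zero    = + 0
  double (suc a) = + 2 + double a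

  sumℤ : (ℕ → ℤ) → ℕ → ℤ
  sumℤ f zero    = + 0
  sumℤ f (suc m) = f 0 + sumℤ (f ∘ suc) m

  sumℤ-cong : ∀ {f g} → (∀ j → f j ≡ g j) → ∀ m → sumℤ f m ≡ sumℤ g m
  sumℤ-cong f≡g zero    = ≡.refl
  sumℤ-cong f≡g (suc m) = ≡.cong₂ _+_ (f≡g 0) (sumℤ-cong (f≡g ∘ suc) m)

  sumℤ-+ : ∀ f g m → sumℤ (λ j → f j + g j) m ≡ sumℤ f m + sumℤ g m
  sumℤ-+ f g zero    = ≡.refl
  sumℤ-+ f g (suc m) = ≡.trans (≡.cong (λ y → f 0 + g 0 + y) (sumℤ-+ (f ∘ suc) (g ∘ suc) m))
    (solve 4 (λ a b c d → a :+ b :+ (c :+ d) := a :+ c :+ (b :+ d)) ≡.refl (f 0) (g 0) _ _)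

  sumℤ-neg : ∀ f m → sumℤ (λ j → - f j) m ≡ - sumℤ f m
  sumℤ-neg f zero    = ≡.refl
  sumℤ-neg f (suc m) = ≡.trans (≡.cong (λ y → - f 0 + y) (sumℤ-neg (f ∘ suc) m)) (≡.sym (ℤ.neg-distrib-+ (f 0) _))

  sumℤ-last : ∀ f m → sumℤ f (suc m) ≡ sumℤ f m + f m
  sumℤ-last f zero    = ℤ.+-comm (f 0) (+ 0)
  sumℤ-last f (suc m) = ≡.trans (≡.cong (λ y → f 0 + y) (sumℤ-last (f ∘ suc) m)) (≡.sym (ℤ.+-assoc (f 0) _ _))

  +0 : ∀ x → x + + 0 ≡ x
  +0 = ℤ.+-identityʳ

  step-assoc : ∀ x a → x + (+ 2 + double a) ≡ x + + 2 + double a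
  step-assoc x a = ≡.sym (ℤ.+-assoc x (+ 2) (double a))

  periodic-double : ∀ {f} → Periodic (+ 2) f → ∀ a → Periodic (double a) f
  periodic-double {f} p zero    x = ≡.cong f (+0 x)
  periodic-double {f} p (suc a) x = ≡.trans (≡.cong f (step-assoc x a)) (≡.trans (periodic-double p a _) (p x))

  self-negative : ∀ x → x ≡ - x → x ≡ + 0
  self-negative (+ zero)  _ = ≡.refl
  self-negative (+ suc n) ()
  self-negative -[1+ n ]  ()

  -- Since x and - x differ by an even number, f x equals f (- x) = - f x.
  odd-periodic : ∀ {f} → Odd f → Periodic (+ 2) f → ∀ x → f x ≡ + 0
  odd-periodic {f} odd p = vanish
    where
    neg-double : ∀ a → - (+ a) + double a ≡ + a
    neg-double zero    = ≡.refl
    neg-double (suc a) = ≡.trans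
      (solve 2 (λ x y → :- (con (+ 1) :+ x) :+ (con (+ 2) :+ y) := con (+ 1) :+ (:- x :+ y)) ≡.refl (+ a) (double a))
      (≡.cong (λ y → + 1 + y) (neg-double a))
    vanish⁺ : ∀ a → f (+ a) ≡ + 0
    vanish⁺ a = self-negative _ (≡.trans (≡.cong f (≡.sym (neg-double a)))
      (≡.trans (periodic-double p a (- (+ a))) (odd (+ a))))
    vanish : ∀ x → f x ≡ + 0
    vanish (+ a)    = vanish⁺ a
    vanish -[1+ a ] = ≡.trans (odd (+ suc a)) (≡.cong -_ (vanish⁺ (suc a)))

  module _ {m : ℕ} {g : ℤ → ℤ} (odd : Odd g) (periodic : Periodic (double m) g) where
    private
      Z : ℤ → ℤ
      Z x = sumℤ (λ j → g (x + double j)) m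

      shift : ∀ x j → g (x + + 2 + double j) ≡ g (x + double (suc j))
      shift x j = ≡.cong g (≡.sym (step-assoc x j))

      Z-periodic : Periodic (+ 2) Z
      Z-periodic x = begin
        Z (x + + 2)                                   ≡⟨ sumℤ-cong (shift x) m ⟩
        tail                                          ≡⟨ solve 2 (λ y t → t := y :+ t :- y) ≡.refl (g (x + + 0)) tail ⟩
        g (x + + 0) + tail - g (x + + 0)              ≡⟨ ≡.cong (_- g (x + + 0)) (sumℤ-last (λ j → g (x + double j)) m) ⟩
        Z x + g (x + double m) - g (x + + 0)          ≡⟨ ≡.cong₂ (λ y z → Z x + y - z) (periodic x) (≡.cong g (+0 x)) ⟩
        Z x + g x - g x                               ≡⟨ solve 2 (λ z y → z :+ y :- y := z) ≡.refl (Z x) (g x) ⟩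
        Z x                                           ∎
        where
        open ≡-Reasoning
        tail = sumℤ (λ j → g (x + double (suc j))) m

      -- The substitution j ↦ k - 1 - j; it lets `Z-odd` compare the sum at - x with the sum at x.
      reverse : ∀ k x → sumℤ (λ j → g (x - double j)) k ≡ sumℤ (λ j → g (x - double k + + 2 + double j)) k
      reverse zero    x = ≡.refl
      reverse (suc k) x = begin
        sumℤ (λ j → g (x - double j)) (suc k)                       ≡⟨ sumℤ-last (λ j → g (x - double j)) k ⟩
        sumℤ (λ j → g (x - double j)) k + g (x - double k)          ≡⟨ ≡.cong (_+ g (x - double k)) (reverse k x) ⟩
        sumℤ (λ j → g (x - double k + + 2 + double j)) k + g (x - double k)
          ≡⟨ ℤ.+-comm _ (g (x - double k)) ⟩
        g (x - double k) + sumℤ (λ j → g (x - double k + + 2 + double j)) k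
          ≡⟨ ≡.cong₂ _+_
               (≡.cong g (solve 2 (λ x d → x :- d := x :- (con (+ 2) :+ d) :+ con (+ 2) :+ con (+ 0)) ≡.refl x (double k)))
               (sumℤ-cong (λ j → ≡.cong g (solve 3 (λ x d e → x :- d :+ con (+ 2) :+ e := x :- (con (+ 2) :+ d) :+ con (+ 2) :+ (con (+ 2) :+ e)) ≡.refl x (double k) (double j))) k) ⟩
        sumℤ (λ j → g (x - double (suc k) + + 2 + double j)) (suc k) ∎
        where open ≡-Reasoning

      Z-odd : Odd Z
      Z-odd x = begin
        Z (- x)                                ≡⟨ sumℤ-cong (λ j → ≡.trans
                                                    (≡.cong g (solve 2 (λ x d → :- x :+ d := :- (x :- d)) ≡.refl x (double j)))
                                                    (odd (x - double j))) m ⟩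
        sumℤ (λ j → - g (x - double j)) m      ≡⟨ sumℤ-neg (λ j → g (x - double j)) m ⟩
        - sumℤ (λ j → g (x - double j)) m      ≡⟨ ≡.cong -_ (reverse m x) ⟩
        - Z (x - double m + + 2)               ≡⟨ ≡.cong -_ (Z-periodic (x - double m)) ⟩
        - Z (x - double m)                     ≡⟨ ≡.cong -_ (periodic-double Z-periodic m (x - double m)) ⟨
        - Z (x - double m + double m)          ≡⟨ ≡.cong (λ y → - Z y) (solve 2 (λ x d → x :- d :+ d := x) ≡.refl x (double m)) ⟩
        - Z x                                  ∎
        where open ≡-Reasoning

    -- The sum over a full period is odd and unchanged by x ↦ x + 2, so `odd-periodic` applies.
    period-sum : ∀ x → sumℤ (λ j → g (x + double j)) m ≡ + 0
    period-sum = odd-periodic Z-odd Z-periodic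

  -- A discrete wave equation with forcing terms; along characteristics the solution changes
  -- only by sums of the forcing terms, and over a full period these sums vanish.
  module WaveEquation {m : ℕ} (X Y : ℕ → ℤ → ℤ) (F G : ℤ → ℤ)
    (X-odd : ∀ a → Odd (X a)) (Y-odd : ∀ a → Odd (Y a)) (F-odd : Odd F) (G-odd : Odd G)
    (X-periodic : Periodic (double m) (X 0)) (Y-periodic : Periodic (double m) (Y 0))
    (F-periodic : Periodic (double m) F) (G-periodic : Periodic (double m) G)
    (Y-step : ∀ a x → Y (suc a) x ≡ - Y a x + (X a (x - + 1) + X a (x + + 1) + G x))
    (X-step : ∀ a x → X (suc a) x ≡ - X a x + (Y (suc a) (x - + 1) + Y (suc a) (x + + 1) + F x)) where
    private
      -- The quantity transported along a characteristic: each step shifts it by 2 and adds the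
      -- forcing `h`, so m steps shift it by a full period and add a sum that vanishes.
      P : ℕ → ℤ → ℤ
      P a x = X a x - Y a (x - + 1)

      h : ℤ → ℤ
      h x = F x + G (x + + 1)

      P-step : ∀ a x → P (suc a) x ≡ P a (x + + 2) + h x
      P-step a x = begin
        X (suc a) x - y₋                                  ≡⟨ ≡.cong (_- y₋) (X-step a x) ⟩
        - X a x + (y₋ + Y (suc a) (x + + 1) + F x) - y₋   ≡⟨ ≡.cong (λ y → - X a x + (y₋ + y + F x) - y₋) (Y-step a (x + + 1)) ⟩
        - X a x + (y₋ + (- Y a (x + + 1) + (X a (x + + 1 - + 1) + X a (x + + 1 + + 1) + G (x + + 1))) + F x) - y₋
          ≡⟨ ≡.cong₂ (λ u v → - X a x + (y₋ + (- Y a (x + + 1) + (u + v + G (x + + 1))) + F x) - y₋)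
               (≡.cong (X a) (solve 1 (λ x → x :+ con (+ 1) :- con (+ 1) := x) ≡.refl x))
               (≡.cong (X a) (solve 1 (λ x → x :+ con (+ 1) :+ con (+ 1) := x :+ con (+ 2)) ≡.refl x)) ⟩
        - X a x + (y₋ + (- Y a (x + + 1) + (X a x + X a (x + + 2) + G (x + + 1))) + F x) - y₋
          ≡⟨ solve 6 (λ p q r s t u → :- p :+ (q :+ (:- r :+ (p :+ s :+ t)) :+ u) :- q := s :- r :+ (u :+ t)) ≡.refl
               (X a x) y₋ (Y a (x + + 1)) (X a (x + + 2)) (G (x + + 1)) (F x) ⟩
        X a (x + + 2) - Y a (x + + 1) + h x
          ≡⟨ ≡.cong (λ y → X a (x + + 2) - Y a y + h x) (solve 1 (λ x → x :+ con (+ 1) := x :+ con (+ 2) :- con (+ 1)) ≡.refl x) ⟩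
        P a (x + + 2) + h x                               ∎
        where
        open ≡-Reasoning
        y₋ = Y (suc a) (x - + 1)

      P-sum : ∀ a x → P a x ≡ P 0 (x + double a) + sumℤ (λ j → h (x + double j)) a
      P-sum zero    x = ≡.trans (≡.cong (P 0) (≡.sym (+0 x))) (≡.sym (+0 _))
      P-sum (suc a) x = begin
        P (suc a) x                                                       ≡⟨ P-step a x ⟩
        P a (x + + 2) + h x                                               ≡⟨ ≡.cong (_+ h x) (P-sum a (x + + 2)) ⟩
        P 0 (x + + 2 + double a) + sumℤ (λ j → h (x + + 2 + double j)) a + h x
          ≡⟨ ≡.cong₂ (λ p q → P 0 p + q + h x) (≡.sym (step-assoc x a)) (sumℤ-cong (λ j → ≡.cong h (≡.sym (step-assoc x j))) a) ⟩
        P 0 (x + double (suc a)) + tail + h x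
          ≡⟨ solve 3 (λ p q r → p :+ q :+ r := p :+ (r :+ q)) ≡.refl (P 0 (x + double (suc a))) tail (h x) ⟩
        P 0 (x + double (suc a)) + (h x + tail)                           ≡⟨ ≡.cong (λ y → P 0 (x + double (suc a)) + (h y + tail)) (≡.sym (+0 x)) ⟩
        P 0 (x + double (suc a)) + sumℤ (λ j → h (x + double j)) (suc a)  ∎
        where
        open ≡-Reasoning
        tail = sumℤ (λ j → h (x + double (suc j))) a

      h-sum : ∀ x → sumℤ (λ j → h (x + double j)) m ≡ + 0
      h-sum x = ≡.trans (sumℤ-+ (λ j → F (x + double j)) (λ j → G (x + double j + + 1)) m) (≡.cong₂ _+_
        (period-sum {m} F-odd F-periodic x)
        (≡.trans (sumℤ-cong (λ j → ≡.cong G (solve 2 (λ x d → x :+ d :+ con (+ 1) := x :+ con (+ 1) :+ d) ≡.refl x (double j))) m)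
                 (period-sum {m} G-odd G-periodic (x + + 1))))

      P-period : ∀ x → P m x ≡ P 0 x
      P-period x = ≡.trans (P-sum m x) (≡.trans (≡.cong₂ _+_
        (≡.cong₂ _-_ (X-periodic x) (≡.trans (≡.cong (Y 0) (solve 2 (λ x d → x :+ d :- con (+ 1) := x :- con (+ 1) :+ d) ≡.refl x (double m))) (Y-periodic (x - + 1))))
        (h-sum x)) (+0 _))

      ΔX ΔY : ℤ → ℤ
      ΔX x = X m x - X 0 x
      ΔY x = Y m x - Y 0 x

      Δ-odd : ∀ {f g : ℤ → ℤ} → Odd f → Odd g → Odd (λ x → f x - g x)
      Δ-odd {f} {g} of og x = ≡.trans (≡.cong₂ _-_ (of x) (og x))
        (solve 2 (λ a b → :- a :- :- b := :- (a :- b)) ≡.refl (f x) (g x))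

      ΔX-odd : Odd ΔX
      ΔX-odd = Δ-odd (X-odd m) (X-odd 0)

      ΔY-odd : Odd ΔY
      ΔY-odd = Δ-odd (Y-odd m) (Y-odd 0)

      ΔX≡ : ∀ x → ΔX x ≡ ΔY (x - + 1)
      ΔX≡ x = begin
        ΔX x    ≡⟨ solve 4 (λ a b c d → a :- b := (a :- c) :- (b :- d) :+ (c :- d)) ≡.refl (X m x) (X 0 x) (Y m (x - + 1)) (Y 0 (x - + 1)) ⟩
        P m x - P 0 x + ΔY (x - + 1)  ≡⟨ ≡.cong (λ p → p - P 0 x + ΔY (x - + 1)) (P-period x) ⟩
        P 0 x - P 0 x + ΔY (x - + 1)  ≡⟨ solve 2 (λ p y → p :- p :+ y := y) ≡.refl (P 0 x) (ΔY (x - + 1)) ⟩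
        ΔY (x - + 1) ∎
        where open ≡-Reasoning

      -- Reading `ΔX≡` at x + 1 and at - (x + 1), and using oddness, identifies `ΔX` at x + 1 with
      -- `ΔY` at x and also with `ΔY` at x + 2.
      ΔY-periodic : Periodic (+ 2) ΔY
      ΔY-periodic x = begin
        ΔY (x + + 2)            ≡⟨ ℤ.neg-involutive _ ⟨
        - - ΔY (x + + 2)        ≡⟨ ≡.cong -_ (ΔY-odd (x + + 2)) ⟨
        - ΔY (- (x + + 2))      ≡⟨ ≡.cong (λ y → - ΔY y) (solve 1 (λ x → :- (x :+ con (+ 2)) := :- (x :+ con (+ 1)) :- con (+ 1)) ≡.refl x) ⟩
        - ΔY (- (x + + 1) - + 1) ≡⟨ ≡.cong -_ (ΔX≡ (- (x + + 1))) ⟨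
        - ΔX (- (x + + 1))      ≡⟨ ≡.cong -_ (ΔX-odd (x + + 1)) ⟩
        - - ΔX (x + + 1)        ≡⟨ ℤ.neg-involutive _ ⟩
        ΔX (x + + 1)            ≡⟨ ΔX≡ (x + + 1) ⟩
        ΔY (x + + 1 - + 1)      ≡⟨ ≡.cong ΔY (solve 1 (λ x → x :+ con (+ 1) :- con (+ 1) := x) ≡.refl x) ⟩
        ΔY x                    ∎
        where open ≡-Reasoning

      ΔY≡0 : ∀ x → ΔY x ≡ + 0
      ΔY≡0 = odd-periodic ΔY-odd ΔY-periodic

    Y-returns : ∀ x → Y m x ≡ Y 0 x
    Y-returns x = ℤ.i-j≡0⇒i≡j _ _ (ΔY≡0 x)

    X-returns : ∀ x → X m x ≡ X 0 x
    X-returns x = ℤ.i-j≡0⇒i≡j _ _ (≡.trans (ΔX≡ x) (ΔY≡0 (x - + 1)))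

  -- Finite sums and functions of several integer coordinates.

  ΣFin : ∀ {n} → (Fin n → ℤ) → ℤ
  ΣFin {zero}  f = + 0
  ΣFin {suc n} f = f Fin.zero + ΣFin (f ∘ Fin.suc)

  ΣFin-cong : ∀ {n} {f g : Fin n → ℤ} → (∀ i → f i ≡ g i) → ΣFin f ≡ ΣFin g
  ΣFin-cong {zero}  f≡g = ≡.refl
  ΣFin-cong {suc n} f≡g = ≡.cong₂ _+_ (f≡g Fin.zero) (ΣFin-cong (f≡g ∘ Fin.suc))

  ΣFin-0 : ∀ {n} {f : Fin n → ℤ} → (∀ i → f i ≡ + 0) → ΣFin f ≡ + 0
  ΣFin-0 {zero}  f≡0 = ≡.refl
  ΣFin-0 {suc n} f≡0 = ≡.cong₂ _+_ (f≡0 Fin.zero) (ΣFin-0 (f≡0 ∘ Fin.suc))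

  ΣFin-update : ∀ {n} {f g : Fin n → ℤ} l → (∀ i → i ≢ l → f i ≡ g i) → ΣFin f - f l ≡ ΣFin g - g l
  ΣFin-update {suc n} {f} {g} Fin.zero f≡g = ≡.trans
    (solve 2 (λ a b → a :+ b :- a := b) ≡.refl (f Fin.zero) (ΣFin (f ∘ Fin.suc)))
    (≡.trans (ΣFin-cong (λ i → f≡g (Fin.suc i) λ ()))
    (solve 2 (λ a b → b := a :+ b :- a) ≡.refl (g Fin.zero) (ΣFin (g ∘ Fin.suc))))
  ΣFin-update {suc n} {f} {g} (Fin.suc l) f≡g = ≡.trans
    (solve 3 (λ a b c → a :+ b :- c := a :+ (b :- c)) ≡.refl (f Fin.zero) (ΣFin (f ∘ Fin.suc)) (f (Fin.suc l)))
    (≡.trans (≡.cong₂ _+_ (f≡g Fin.zero λ ()) (ΣFin-update l λ i i≢l → f≡g (Fin.suc i) (i≢l ∘ Fin.suc-injective)))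
    (solve 3 (λ a b c → a :+ (b :- c) := a :+ b :- c) ≡.refl (g Fin.zero) (ΣFin (g ∘ Fin.suc)) (g (Fin.suc l))))

  -- One integer coordinate for each possible matrix entry r; it serves all pairs of letters with
  -- that entry at once.
  Coordinates : Set
  Coordinates = ℕ → ℤ

  set : ℕ → ℤ → Coordinates → Coordinates
  set r x c q = if does (q ℕ.≟ r) then x else c q

  set-same : ∀ r x c → set r x c r ≡ x
  set-same r x c rewrite dec-true (r ℕ.≟ r) ≡.refl = ≡.refl

  set-other : ∀ {r q} x c → q ≢ r → set r x c q ≡ c q
  set-other {r} {q} x c q≢r rewrite dec-false (q ℕ.≟ r) q≢r = ≡.refl

  set-elim : ∀ {r x c q} (P : ℤ → Set) → (q ≡ r → P x) → (q ≢ r → P (c q)) → P (set r x c q)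
  set-elim {r} {x} {c} {q} P eq neq = go (q ℕ.≟ r)
    where
    go : Dec (q ≡ r) → P (set r x c q)
    go (yes ≡.refl) = ≡.subst P (≡.sym (set-same r x c)) (eq ≡.refl)
    go (no q≢r)     = ≡.subst P (≡.sym (set-other x c q≢r)) (neq q≢r)

  set-set : ∀ r x y c → set r y (set r x c) ≗ set r y c
  set-set r x y c q = set-elim {r} {y} {set r x c} {q} (_≡ set r y c q)
    (λ { ≡.refl → ≡.sym (set-same r y c) })
    (λ q≢r → ≡.trans (set-other x c q≢r) (≡.sym (set-other y c q≢r)))

  set-cong : ∀ r x {c c′} → c ≗ c′ → set r x c ≗ set r x c′
  set-cong r x c≗ q with does (q ℕ.≟ r)
  ... | true  = ≡.refl
  ... | false = c≗ q

  set-self : ∀ r c → set r (c r) c ≗ c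
  set-self r c q = set-elim {r} {c r} {c} {q} (_≡ c q) (λ { ≡.refl → ≡.refl }) (λ _ → ≡.refl)

  set-comm : ∀ {r q} x y c → q ≢ r → set r x (set q y c) ≗ set q y (set r x c)
  set-comm {r} {q} x y c q≢r p = set-elim {r} {x} {set q y c} {p} (_≡ set q y (set r x c) p)
    (λ { ≡.refl → ≡.sym (≡.trans (set-other y (set r x c) (q≢r ∘ ≡.sym)) (set-same r x c)) })
    (λ p≢r → set-elim {q} {y} {c} {p} (_≡ set q y (set r x c) p)
      (λ { ≡.refl → ≡.sym (set-same q y (set r x c)) })
      (λ p≢q → ≡.sym (≡.trans (set-other y (set r x c) p≢q) (set-other x c p≢r))))

  -- The period in the coordinate r. The entry 0 stands for ∞, and period 0 is no condition. The
  -- entry 1 does not occur between distinct letters; as an odd function of period 2 vanishes, its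
  -- coordinate also gets period 0.
  modulus : ℕ → ℤ
  modulus 1 = + 0
  modulus r = double r

  modulus≡double : ∀ {r} → r ≢ 1 → modulus r ≡ double r
  modulus≡double {0}           _   = ≡.refl
  modulus≡double {1}           r≢1 = contradiction ≡.refl r≢1
  modulus≡double {suc (suc r)} _   = ≡.refl

  module Wavelet where
    indicator : ∀ {P : Set} → Dec P → ℤ
    indicator P? = if does P? then + 1 else + 0

    indicator-⇔ : ∀ {P Q : Set} (P? : Dec P) (Q? : Dec Q) → (P → Q) → (Q → P) → indicator P? ≡ indicator Q?
    indicator-⇔ P? Q? f g = ≡.cong (if_then + 1 else + 0) (does-⇔ (mk⇔ f g) P? Q?)

    -- The indicator of the class of 1 minus that of the class of - 1. The classes differ because
    -- `modulus r` does not divide 2, so the value at 1 is 1.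
    wavelet : ℕ → ℤ → ℤ
    wavelet r q = indicator (modulus r ∣? q - + 1) - indicator (modulus r ∣? q + + 1)

    wavelet-odd : ∀ r → Odd (wavelet r)
    wavelet-odd r x = ≡.trans
      (≡.cong₂ _-_
        (indicator-⇔ (modulus r ∣? - x - + 1) (modulus r ∣? x + + 1)
          (≡.subst (modulus r ∣_) eq₁ ∘ ∣m⇒∣-m) (≡.subst (modulus r ∣_) (≡.sym eq₂) ∘ ∣m⇒∣-m))
        (indicator-⇔ (modulus r ∣? - x + + 1) (modulus r ∣? x - + 1)
          (≡.subst (modulus r ∣_) eq₃ ∘ ∣m⇒∣-m) (≡.subst (modulus r ∣_) (≡.sym eq₄) ∘ ∣m⇒∣-m)))
      (solve 2 (λ a b → a :- b := :- (b :- a)) ≡.refl (indicator (modulus r ∣? x + + 1)) (indicator (modulus r ∣? x - + 1)))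
      where
      eq₁ : - (- x - + 1) ≡ x + + 1
      eq₁ = solve 1 (λ x → :- (:- x :- con (+ 1)) := x :+ con (+ 1)) ≡.refl x
      eq₂ : - x - + 1 ≡ - (x + + 1)
      eq₂ = solve 1 (λ x → :- x :- con (+ 1) := :- (x :+ con (+ 1))) ≡.refl x
      eq₃ : - (- x + + 1) ≡ x - + 1
      eq₃ = solve 1 (λ x → :- (:- x :+ con (+ 1)) := x :- con (+ 1)) ≡.refl x
      eq₄ : - x + + 1 ≡ - (x - + 1)
      eq₄ = solve 1 (λ x → :- x :+ con (+ 1) := :- (x :- con (+ 1))) ≡.refl x

    wavelet-periodic : ∀ r → Periodic (modulus r) (wavelet r)
    wavelet-periodic r x = ≡.cong₂ _-_
      (indicator-⇔ (p ∣? x + p - + 1) (p ∣? x - + 1)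
        (λ d → ∣m+n∣n⇒∣m (≡.subst (p ∣_) eq₁ d) ∣-refl) (λ d → ≡.subst (p ∣_) (≡.sym eq₁) (∣m∣n⇒∣m+n d ∣-refl)))
      (indicator-⇔ (p ∣? x + p + + 1) (p ∣? x + + 1)
        (λ d → ∣m+n∣n⇒∣m (≡.subst (p ∣_) eq₂ d) ∣-refl) (λ d → ≡.subst (p ∣_) (≡.sym eq₂) (∣m∣n⇒∣m+n d ∣-refl)))
      where
      p = modulus r
      eq₁ : x + p - + 1 ≡ x - + 1 + p
      eq₁ = solve 2 (λ x p → x :+ p :- con (+ 1) := x :- con (+ 1) :+ p) ≡.refl x p
      eq₂ : x + p + + 1 ≡ x + + 1 + p
      eq₂ = solve 2 (λ x p → x :+ p :+ con (+ 1) := x :+ con (+ 1) :+ p) ≡.refl x p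

    modulus∤2 : ∀ r → ¬ modulus r ∣ + 2
    modulus∤2 0 d = contradiction (ℕ.0∣⇒≡0 (∣⇒∣ᵤ d)) λ ()
    modulus∤2 1 d = contradiction (ℕ.0∣⇒≡0 (∣⇒∣ᵤ d)) λ ()
    modulus∤2 (suc (suc r)) d = 4+k≰2 (ℕ.∣⇒≤ (∣⇒∣ᵤ (≡.subst (λ x → + 2 + (+ 2 + x) ∣ + 2) (proj₂ (double≥0 r)) d)))
      where
      double≥0 : ∀ a → ∃[ k ] double a ≡ + k
      double≥0 zero    = 0 , ≡.refl
      double≥0 (suc a) = let k , eq = double≥0 a in 2 ℕ.+ k , ≡.cong (λ y → + 2 + y) eq
      4+k≰2 : ∀ {k} → ¬ 4 ℕ.+ k ℕ.≤ 2
      4+k≰2 (s≤s (s≤s ()))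

    wavelet-1 : ∀ r → wavelet r (+ 1) ≡ + 1
    wavelet-1 r = ≡.cong₂ (λ a b → (if a then + 1 else + 0) - (if b then + 1 else + 0))
      (dec-true (modulus r ∣? + 0) (divides (+ 0) ≡.refl))
      (dec-false (modulus r ∣? + 2) (modulus∤2 r))

    -- Supplies the test vector of `essential`: odd and periodic in every coordinate below R, yet
    -- nonzero.
    product : ℕ → Coordinates → ℤ
    product zero    c = + 1
    product (suc r) c = wavelet r (c r) * product r c

    product-cong : ∀ R {c c′} → (∀ q → q < R → c q ≡ c′ q) → product R c ≡ product R c′
    product-cong zero    _  = ≡.refl
    product-cong (suc r) c≗ = ≡.cong₂ _*_ (≡.cong (wavelet r) (c≗ r ℕ.≤-refl)) (product-cong r λ q q<r → c≗ q (ℕ.m<n⇒m<1+n q<r))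

    -- Covers oddness, with κ = - 1, and periodicity, with κ = 1: only the factor of the coordinate
    -- r is affected.
    product-scale : ∀ R {r} → r < R → ∀ κ {x y} → wavelet r y ≡ κ * wavelet r x →
                    ∀ c → product R (set r y c) ≡ κ * product R (set r x c)
    product-scale (suc R) {r} (s≤s r≤R) κ {x} {y} eq c with ℕ.m≤n⇒m<n∨m≡n r≤R
    ... | inj₁ r<R = ≡.trans (≡.cong₂ (λ a b → wavelet R a * b)
            (≡.trans (set-other y c R≢r) (≡.sym (set-other x c R≢r))) (product-scale R r<R κ eq c))
          (solve 3 (λ a b c → a :* (b :* c) := b :* (a :* c)) ≡.refl (wavelet R (set r x c R)) κ (product R (set r x c)))
      where
      R≢r : R ≢ r
      R≢r = ℕ.<⇒≢ r<R ∘ ≡.sym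
    ... | inj₂ ≡.refl = ≡.trans (≡.cong₂ _*_
            (≡.trans (≡.cong (wavelet R) (set-same R y c)) (≡.trans eq (≡.cong (λ z → κ * wavelet R z) (≡.sym (set-same R x c)))))
            (product-cong R λ q q<R → ≡.trans (set-other y c (ℕ.<⇒≢ q<R)) (≡.sym (set-other x c (ℕ.<⇒≢ q<R)))))
          (ℤ.*-assoc κ (wavelet R (set R x c R)) (product R (set R x c)))

    product-1 : ∀ R → product R (λ _ → + 1) ≡ + 1
    product-1 zero    = ≡.refl
    product-1 (suc R) = ≡.cong₂ _*_ (wavelet-1 R) (product-1 R)

  open Wavelet

  -- Functions that are odd, with period 2r, in the coordinate r.  On them the sum of the two
  -- translations in the coordinate r is an integral substitute for multiplication by 2cos(π/r).
  module Waves (R : ℕ) where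
    record Good (f : Coordinates → ℤ) : Set where
      field
        ext      : ∀ {c c′} → c ≗ c′ → f c ≡ f c′
        odd      : ∀ {r} → r < R → ∀ c → Odd (λ x → f (set r x c))
        periodic : ∀ {r} → r < R → ∀ c → Periodic (modulus r) (λ x → f (set r x c))
    open Good public

    Good-0 : Good (λ _ → + 0)
    Good-0 = record { ext = λ _ → ≡.refl ; odd = λ _ _ _ → ≡.refl ; periodic = λ _ _ _ → ≡.refl }

    Good-+ : ∀ {f g} → Good f → Good g → Good (λ c → f c + g c)
    Good-+ {f} {g} gf gg = record
      { ext      = λ c≗ → ≡.cong₂ _+_ (ext gf c≗) (ext gg c≗)
      ; odd      = λ r<R c x → ≡.trans (≡.cong₂ _+_ (odd gf r<R c x) (odd gg r<R c x)) (≡.sym (ℤ.neg-distrib-+ (f _) (g _)))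
      ; periodic = λ r<R c x → ≡.cong₂ _+_ (periodic gf r<R c x) (periodic gg r<R c x)
      }

    Good-neg : ∀ {f} → Good f → Good (λ c → - f c)
    Good-neg gf = record
      { ext      = λ c≗ → ≡.cong -_ (ext gf c≗)
      ; odd      = λ r<R c x → ≡.cong -_ (odd gf r<R c x)
      ; periodic = λ r<R c x → ≡.cong -_ (periodic gf r<R c x)
      }

    Good-ΣFin : ∀ {n} {φ : Fin n → Coordinates → ℤ} → (∀ i → Good (φ i)) → Good (λ c → ΣFin λ i → φ i c)
    Good-ΣFin {zero}  _ = Good-0
    Good-ΣFin {suc n} g = Good-+ (g Fin.zero) (Good-ΣFin (g ∘ Fin.suc))

    Good-product : Good (product R)
    Good-product = record
      { ext      = λ c≗ → product-cong R λ q _ → c≗ q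
      ; odd      = λ {r} r<R c x → ≡.trans (product-scale R r<R (- (+ 1)) (≡.trans (wavelet-odd r x) (≡.sym (ℤ.-1*i≡-i _))) c)
                     (ℤ.-1*i≡-i _)
      ; periodic = λ {r} r<R c x → ≡.trans (product-scale R r<R (+ 1) (≡.trans (wavelet-periodic r x) (≡.sym (ℤ.*-identityˡ _))) c)
                     (ℤ.*-identityˡ _)
      }

    translates : ℕ → (Coordinates → ℤ) → Coordinates → ℤ
    translates r f c = f (set r (c r - + 1) c) + f (set r (c r + + 1) c)

    translates-cong : ∀ r {f g} → f ≗ g → translates r f ≗ translates r g
    translates-cong r f≗g c = ≡.cong₂ _+_ (f≗g _) (f≗g _)

    module _ {f : Coordinates → ℤ} (gf : Good f) where
      translates-same : ∀ r x c → translates r f (set r x c) ≡ f (set r (x - + 1) c) + f (set r (x + + 1) c)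
      translates-same r x c = ≡.trans
        (≡.cong (λ y → f (set r (y - + 1) (set r x c)) + f (set r (y + + 1) (set r x c))) (set-same r x c))
        (≡.cong₂ _+_ (ext gf (set-set r x _ c)) (ext gf (set-set r x _ c)))

      translates-other : ∀ {r q} x c → r ≢ q → translates r f (set q x c) ≡
                         f (set q x (set r (c r - + 1) c)) + f (set q x (set r (c r + + 1) c))
      translates-other {r} {q} x c r≢q = ≡.trans
        (≡.cong (λ y → f (set r (y - + 1) (set q x c)) + f (set r (y + + 1) (set q x c))) (set-other x c r≢q))
        (≡.cong₂ _+_ (ext gf (set-comm _ x c (r≢q ∘ ≡.sym))) (ext gf (set-comm _ x c (r≢q ∘ ≡.sym))))

      -- Translation in the coordinate r commutes with changes of the other coordinates; in the
      -- coordinate r itself oddness exchanges the two translates.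
      Good-translates : ∀ r → Good (translates r f)
      Good-translates r = record { ext = ext′ ; odd = odd′ ; periodic = periodic′ }
        where
        ext′ : ∀ {c c′} → c ≗ c′ → translates r f c ≡ translates r f c′
        ext′ {c} {c′} c≗ = ≡.trans
          (≡.cong (λ y → f (set r (y - + 1) c) + f (set r (y + + 1) c)) (c≗ r))
          (≡.cong₂ _+_ (ext gf (set-cong r _ c≗)) (ext gf (set-cong r _ c≗)))

        odd′ : ∀ {q} → q < R → ∀ c → Odd (λ x → translates r f (set q x c))
        odd′ {q} q<R c x with r ℕ.≟ q
        ... | no r≢q = ≡.trans (translates-other (- x) c r≢q)
              (≡.trans (≡.cong₂ _+_ (odd gf q<R _ x) (odd gf q<R _ x))
              (≡.trans (≡.sym (ℤ.neg-distrib-+ (f _) (f _))) (≡.cong -_ (≡.sym (translates-other x c r≢q)))))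
        ... | yes ≡.refl = begin
              translates r f (set r (- x) c)                          ≡⟨ translates-same r (- x) c ⟩
              u (- x - + 1) + u (- x + + 1)                           ≡⟨ ≡.cong₂ (λ a b → u a + u b)
                (solve 1 (λ x → :- x :- con (+ 1) := :- (x :+ con (+ 1))) ≡.refl x)
                (solve 1 (λ x → :- x :+ con (+ 1) := :- (x :- con (+ 1))) ≡.refl x) ⟩
              u (- (x + + 1)) + u (- (x - + 1))                       ≡⟨ ≡.cong₂ _+_ (odd gf q<R c (x + + 1)) (odd gf q<R c (x - + 1)) ⟩
              - u (x + + 1) + - u (x - + 1)                           ≡⟨ solve 2 (λ a b → :- a :+ :- b := :- (b :+ a)) ≡.refl (u (x + + 1)) (u (x - + 1)) ⟩
              - (u (x - + 1) + u (x + + 1))                           ≡⟨ ≡.cong -_ (translates-same r x c) ⟨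
              - translates r f (set r x c)                            ∎
          where
          open ≡-Reasoning
          u : ℤ → ℤ
          u y = f (set r y c)

        periodic′ : ∀ {q} → q < R → ∀ c → Periodic (modulus q) (λ x → translates r f (set q x c))
        periodic′ {q} q<R c x with r ℕ.≟ q
        ... | no r≢q = ≡.trans (translates-other (x + modulus q) c r≢q)
              (≡.trans (≡.cong₂ _+_ (periodic gf q<R _ x) (periodic gf q<R _ x)) (≡.sym (translates-other x c r≢q)))
        ... | yes ≡.refl = begin
              translates r f (set r (x + p) c)     ≡⟨ translates-same r (x + p) c ⟩
              u (x + p - + 1) + u (x + p + + 1)    ≡⟨ ≡.cong₂ (λ a b → u a + u b)
                (solve 2 (λ x p → x :+ p :- con (+ 1) := x :- con (+ 1) :+ p) ≡.refl x p)
                (solve 2 (λ x p → x :+ p :+ con (+ 1) := x :+ con (+ 1) :+ p) ≡.refl x p) ⟩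
              u (x - + 1 + p) + u (x + + 1 + p)    ≡⟨ ≡.cong₂ _+_ (periodic gf q<R c (x - + 1)) (periodic gf q<R c (x + + 1)) ⟩
              u (x - + 1) + u (x + + 1)            ≡⟨ translates-same r x c ⟨
              translates r f (set r x c)           ∎
          where
          open ≡-Reasoning
          p = modulus r
          u : ℤ → ℤ
          u y = f (set r y c)

  -- The integral reflection representation and its relations.

  module DistinctGenerators {n : ℕ} (M : CoxeterMatrix n) where
    open CoxeterMatrix M
    open Presentation M

    private
      bound : ∃[ b ] ∀ k → proj₁ (bounded n (m k)) ℕ.≤ b
      bound = bounded n (λ k → proj₁ (bounded n (m k)))

      R : ℕ
      R = suc (proj₁ bound)

      m<R : ∀ k l → m k l < R
      m<R k l = s≤s (ℕ.≤-trans (proj₂ (bounded n (m k)) l) (proj₂ bound k))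

    open Waves R

    State : Set
    State = Fin n → Coordinates → ℤ

    infix 4 _≋_
    _≋_ : State → State → Set
    v ≋ v′ = ∀ l → v l ≗ v′ l

    bond : Fin n → Fin n → (Coordinates → ℤ) → Coordinates → ℤ
    bond k r f c = if does (k Fin.≟ r) then + 0 else translates (m k r) f c

    bond-other : ∀ {k r} → k ≢ r → ∀ f c → bond k r f c ≡ translates (m k r) f c
    bond-other {k} {r} k≢r f c rewrite dec-false (k Fin.≟ r) k≢r = ≡.refl

    bond-cong : ∀ k r {f g} → (k ≢ r → f ≗ g) → bond k r f ≗ bond k r g
    bond-cong k r f≗g c with k Fin.≟ r
    ... | yes _  = ≡.refl
    ... | no k≢r = translates-cong (m k r) (f≗g k≢r) c

    Good-bond : ∀ k r {f} → Good f → Good (bond k r f)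
    Good-bond k r gf with does (k Fin.≟ r)
    ... | true  = Good-0
    ... | false = Good-translates gf (m k r)

    force : Fin n → State → Coordinates → ℤ
    force k v c = ΣFin λ r → bond k r (v r) c

    -- The simple reflection k of the geometric representation in coordinates with respect to the
    -- simple roots, with `translates (m k r)` in place of 2cos(π/m(k,r)).
    act : Fin n → State → State
    act k v l c = if does (l Fin.≟ k) then - v k c + force k v c else v l c

    act-same : ∀ k v c → act k v k c ≡ - v k c + force k v c
    act-same k v c rewrite dec-true (k Fin.≟ k) ≡.refl = ≡.refl

    act-other : ∀ {k l} v c → l ≢ k → act k v l c ≡ v l c
    act-other {k} {l} v c l≢k rewrite dec-false (l Fin.≟ k) l≢k = ≡.refl

    force-cong : ∀ k {v v′} → (∀ r → k ≢ r → v r ≗ v′ r) → force k v ≗ force k v′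
    force-cong k v≋ c = ΣFin-cong λ r → bond-cong k r (v≋ r) c

    act-cong : ∀ k {v v′} → v ≋ v′ → act k v ≋ act k v′
    act-cong k v≋ l c with does (l Fin.≟ k)
    ... | true  = ≡.cong₂ (λ x y → - x + y) (v≋ k c) (force-cong k (λ r _ → v≋ r) c)
    ... | false = v≋ l c

    act-involutive : ∀ k v → act k (act k v) ≋ v
    act-involutive k v l c = go (l Fin.≟ k)
      where
      go : ∀ {l} → Dec (l ≡ k) → act k (act k v) l c ≡ v l c
      go (no l≢k)     = ≡.trans (act-other (act k v) c l≢k) (act-other v c l≢k)
      go (yes ≡.refl) = ≡.trans (act-same k (act k v) c)
        (≡.trans (≡.cong₂ (λ x y → - x + y) (act-same k v c) (force-cong k (λ r k≢r c → act-other v c (k≢r ∘ ≡.sym)) c))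
                 (solve 2 (λ x y → :- (:- x :+ y) :+ y := x) ≡.refl (v k c) (force k v c)))

    GoodState : State → Set
    GoodState v = ∀ l → Good (v l)

    Good-force : ∀ k {v} → GoodState v → Good (force k v)
    Good-force k gv = Good-ΣFin λ r → Good-bond k r (gv r)

    Good-act : ∀ k {v} → GoodState v → GoodState (act k v)
    Good-act k gv l with does (l Fin.≟ k)
    ... | true  = Good-+ (Good-neg (gv k)) (Good-force k gv)
    ... | false = gv l

    run : Word → State → State
    run a v = foldr act v a

    run-cong : ∀ a {v v′} → v ≋ v′ → run a v ≋ run a v′
    run-cong []      v≋ = v≋
    run-cong (k ∷ a) v≋ = act-cong k (run-cong a v≋)

    Good-run : ∀ a {v} → GoodState v → GoodState (run a v)
    Good-run []      gv = gv
    Good-run (k ∷ a) gv = Good-act k (Good-run a gv)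

    module Dihedral {k l : Fin n} (k≢l : k ≢ l) {v : State} (gv : GoodState v) where
      alternating : ℕ → Word
      alternating a = concat (replicate a (k ∷ l ∷ []))

      w : ℕ → State
      w a = run (alternating a) v

      gw : ∀ a → GoodState (w a)
      gw a = Good-run (alternating a) gv

      w-other : ∀ a r → r ≢ k → r ≢ l → w a r ≗ v r
      w-other zero    r _   _   c = ≡.refl
      w-other (suc a) r r≢k r≢l c = ≡.trans (act-other (act l (w a)) c r≢k) (≡.trans (act-other (w a) c r≢l) (w-other a r r≢k r≢l c))

      -- Separates the bond to l. The remainder depends only on letters that the powers of k l leave
      -- fixed, and becomes the forcing term of the wave equation.
      force-split : ∀ {k l} {v v′ : State} → (∀ r → k ≢ r → r ≢ l → v r ≗ v′ r) →
                    ∀ c → force k v c ≡ bond k l (v l) c + (force k v′ c - bond k l (v′ l) c)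
      force-split {k} {l} {v} {v′} v≋ c = ≡.trans
        (solve 2 (λ x y → x := y :+ (x :- y)) ≡.refl (force k v c) (bond k l (v l) c))
        (≡.cong (λ y → bond k l (v l) c + y) (ΣFin-update l λ r r≢l → bond-cong k r (λ k≢r → v≋ r k≢r r≢l) c))

      -- All coordinates other than `m k l` are frozen at c, which leaves a wave equation in one
      -- variable.
      module Slice (c : Coordinates) where
        ρ : ℕ
        ρ = m k l

        at : ℤ → Coordinates
        at x = set ρ x c

        slice : ∀ {f} → Good f → f c ≡ f (at (c ρ))
        slice gf = ext gf λ q → ≡.sym (set-self ρ c q)

        periodic-at : ∀ {f} → Good f → Periodic (double ρ) (f ∘ at)
        periodic-at {f} gf = ≡.subst (λ p → Periodic p (f ∘ at)) (modulus≡double (off-diag k l k≢l)) (periodic gf (m<R k l) c)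

        rest : ∀ k l → Good (λ c → force k v c - bond k l (v l) c)
        rest k l = Good-+ (Good-force k gv) (Good-neg (Good-bond k l (gv l)))

        bond-kl : ∀ {f} → Good f → ∀ x → bond k l f (at x) ≡ f (at (x - + 1)) + f (at (x + + 1))
        bond-kl {f} gf x = ≡.trans (bond-other k≢l f (at x)) (translates-same gf ρ x c)

        bond-lk : ∀ {f} → Good f → ∀ x → bond l k f (at x) ≡ f (at (x - + 1)) + f (at (x + + 1))
        bond-lk {f} gf x = ≡.trans (bond-other (k≢l ∘ ≡.sym) f (at x))
          (≡.trans (≡.cong (λ r → translates r f (at x)) (symmetric l k)) (translates-same gf ρ x c))

        -- In each pair k l the letter l acts first: the new Y is computed from the old X, and the
        -- new X from the new Y.
        Y-step : ∀ a x → w (suc a) l (at x) ≡ - w a l (at x) +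
                 (w a k (at (x - + 1)) + w a k (at (x + + 1)) + (force l v (at x) - bond l k (v k) (at x)))
        Y-step a x = ≡.trans (act-other (act l (w a)) (at x) (k≢l ∘ ≡.sym)) (≡.trans (act-same l (w a) (at x))
          (≡.cong (λ y → - w a l (at x) + y) (≡.trans
            (force-split {l} {k} {w a} {v} (λ r l≢r r≢k → w-other a r r≢k (l≢r ∘ ≡.sym)) (at x))
            (≡.cong (λ y → y + (force l v (at x) - bond l k (v k) (at x))) (bond-lk (gw a k) x)))))

        X-step : ∀ a x → w (suc a) k (at x) ≡ - w a k (at x) +
                 (w (suc a) l (at (x - + 1)) + w (suc a) l (at (x + + 1)) + (force k v (at x) - bond k l (v l) (at x)))
        X-step a x = ≡.trans (act-same k (act l (w a)) (at x)) (≡.cong₂ (λ y z → - y + z) (act-other (w a) (at x) k≢l) (≡.trans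
          (force-split {k} {l} {act l (w a)} {v} (λ r k≢r r≢l c → ≡.trans (act-other (w a) c r≢l) (w-other a r (k≢r ∘ ≡.sym) r≢l c)) (at x))
          (≡.cong (λ y → y + (force k v (at x) - bond k l (v l) (at x)))
            (≡.trans (bond-cong k l (λ _ c → ≡.sym (act-other (act l (w a)) c (k≢l ∘ ≡.sym))) (at x)) (bond-kl (gw (suc a) l) x)))))

        open WaveEquation {ρ} (λ a x → w a k (at x)) (λ a x → w a l (at x))
          (λ x → force k v (at x) - bond k l (v l) (at x)) (λ x → force l v (at x) - bond l k (v k) (at x))
          (λ a → odd (gw a k) (m<R k l) c) (λ a → odd (gw a l) (m<R k l) c)
          (odd (rest k l) (m<R k l) c) (odd (rest l k) (m<R k l) c)
          (periodic-at (gv k)) (periodic-at (gv l)) (periodic-at (rest k l)) (periodic-at (rest l k))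
          Y-step X-step public

      returns : w (m k l) ≋ v
      returns r c = go (r Fin.≟ k) (r Fin.≟ l)
        where
        open Slice c
        go : ∀ {r} → Dec (r ≡ k) → Dec (r ≡ l) → w (m k l) r c ≡ v r c
        go {r} (no r≢k) (no r≢l) = w-other (m k l) r r≢k r≢l c
        go (yes ≡.refl) _        = ≡.trans (slice (gw (m k l) k)) (≡.trans (X-returns (c ρ)) (≡.sym (slice (gv k))))
        go (no _) (yes ≡.refl)   = ≡.trans (slice (gw (m k l) l)) (≡.trans (Y-returns (c ρ)) (≡.sym (slice (gv l))))

    run-relator : ∀ {r} → Relator r → ∀ {v} → GoodState v → run r v ≋ v
    run-relator (square k)  gv = act-involutive k _
    run-relator (power k l) gv with k Fin.≟ l
    ... | yes ≡.refl = ≡.subst (λ a → run (concat (replicate a (k ∷ k ∷ []))) _ ≋ _) (≡.sym (diagonal k)) (act-involutive k _)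
    ... | no k≢l     = Dihedral.returns k≢l gv

    run-∼ : ∀ {a b} → a ∼ b → ∀ {v} → GoodState v → run a v ≋ run b v
    run-∼ p = EqClosure.fold {S = λ a b → ∀ {v} → GoodState v → run a v ≋ run b v}
      (record
        { refl  = λ _ _ _ → ≡.refl
        ; sym   = λ p gv l c → ≡.sym (p gv l c)
        ; trans = λ p q gv l c → ≡.trans (p gv l c) (q gv l c)
        }) deletes p
      where
      deletes : ∀ {a b} → Deletes a b → ∀ {v} → GoodState v → run a v ≋ run b v
      deletes (delete u {r} w R) {v} gv l c
        rewrite foldr-++ act v u (r ++ w) | foldr-++ act v r w | foldr-++ act v u w =
        run-cong u (run-relator R (Good-run w gv)) l c

    -- Tested on the state supported on i: `act i` negates its component i, while the letters of a
    -- never change that component. Where all coordinates are 1 the two values are - 1 and 1.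
    essential : ∀ {i a} → All (_≢ i) a → ¬ (i ∷ []) ∼ a
    essential {i} {a} i∉a p = contradiction (≡.trans (≡.sym lhs) (≡.trans (run-∼ p gv₀ i one) rhs)) λ ()
      where
      one : Coordinates
      one _ = + 1

      v₀ : State
      v₀ l c = if does (l Fin.≟ i) then product R c else + 0

      v₀-i : ∀ c → v₀ i c ≡ product R c
      v₀-i c rewrite dec-true (i Fin.≟ i) ≡.refl = ≡.refl

      v₀-other : ∀ {l} → l ≢ i → ∀ c → v₀ l c ≡ + 0
      v₀-other {l} l≢i c rewrite dec-false (l Fin.≟ i) l≢i = ≡.refl

      gv₀ : GoodState v₀
      gv₀ l with does (l Fin.≟ i)
      ... | true  = Good-product
      ... | false = Good-0

      no-force : ∀ r → bond i r (v₀ r) one ≡ + 0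
      no-force r with i Fin.≟ r
      ... | yes _  = ≡.refl
      ... | no i≢r = ≡.cong₂ _+_ (v₀-other (i≢r ∘ ≡.sym) (set (m i r) (+ 0) one)) (v₀-other (i≢r ∘ ≡.sym) (set (m i r) (+ 2) one))

      lhs : act i v₀ i one ≡ - (+ 1)
      lhs = ≡.trans (act-same i v₀ one) (≡.cong₂ (λ x y → - x + y) (≡.trans (v₀-i one) (product-1 R)) (ΣFin-0 no-force))

      run-other : ∀ {a} → All (_≢ i) a → run a v₀ i one ≡ v₀ i one
      run-other []                = ≡.refl
      run-other {k ∷ a} (k≢i ∷ i∉a) = ≡.trans (act-other (run a v₀) one (k≢i ∘ ≡.sym)) (run-other i∉a)

      rhs : run a v₀ i one ≡ + 1
      rhs = ≡.trans (run-other i∉a) (≡.trans (v₀-i one) (product-1 R))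

-- Axioms for the weak order.

-- In the weak order, x ∁ is x w₀, the atoms are the simple reflections, and σ i is left
-- multiplication by sᵢ.
record CambrianLattice (n : ℕ) (c ℓ₁ ℓ₂ : Level) : Set (lsuc (c ⊔ ℓ₁ ⊔ ℓ₂)) where
  field
    lattice : Lattice c ℓ₁ ℓ₂
  open Lattice lattice public
  field
    ⊥            : Carrier
    ⊥-minimum    : ∀ x → ⊥ ≤ x
    _∁           : Carrier → Carrier
    ∁-antitone   : ∀ {x y} → x ≤ y → y ∁ ≤ x ∁
    ∁-involutive : ∀ x → x ∁ ∁ ≈ x
    atom         : Fin n → Carrier
    _atom≤?_     : ∀ i x → Dec (atom i ≤ x)
    atom-∁       : ∀ {i x} → atom i ≤ x → ¬ x ≤ atom i ∁
    ≰⇒≤∁         : ∀ {i x} → ¬ atom i ≤ x → x ≤ atom i ∁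
    atom-minimal : ∀ {i x} → x ≤ atom i → ¬ atom i ≤ x → x ≤ ⊥
    atom-injective : ∀ {i j} → atom i ≤ atom j → i ≡ j
    atomic       : ∀ {x} → (∀ i → ¬ atom i ≤ x) → x ≤ ⊥
    σ            : Fin n → Carrier → Carrier
    σ-involutive : ∀ i x → σ i (σ i x) ≈ x
    σ-∁          : ∀ i x → σ i (x ∁) ≈ σ i x ∁
    σ-mono       : ∀ {i x y} → (atom i ≤ y → atom i ≤ x) → x ≤ y → σ i x ≤ σ i y
    σ-descends   : ∀ {i x} → atom i ≤ x → ¬ atom i ≤ σ i x
    σ-ascends    : ∀ {i x} → ¬ atom i ≤ x → atom i ≤ σ i x
    cover        : ∀ {i x} → ¬ atom i ≤ x → σ i (atom i ∨ x) ≈ (atom i ∨ x) ∧ atom i ∁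
    -- Moves a generator of the congruence from the polygon at the bottom of the lattice to the one
    -- below its top; see `gen-∁`.
    polygon      : ∀ i j → atom i ∁ ≤ σ i (atom i ∨ atom j) ∨ (atom i ∁ ∧ atom j ∁)
    -- The longest element of the parabolic subgroup generated by S ∖ {s}.
    e            : Fin n → Carrier
    e-upper      : ∀ {s j} → j ≢ s → atom j ≤ e s
    atom≰e       : ∀ s → ¬ atom s ≤ e s
    e-∨          : ∀ s x y → (x ∨ y) ∧ e s ≤ (x ∧ e s) ∨ (y ∧ e s)
    e-section    : ∀ s x → x ≤ (x ∧ e s) ∨ e s ∁
    σ-≤e         : ∀ {s j x} → j ≢ s → x ≤ e s → σ j x ≤ e s
    rk           : Carrier → ℕ
    rk-cong      : ∀ {x y} → x ≈ y → rk x ≡ rk y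
    rk-descends  : ∀ {i x} → atom i ≤ x → rk (σ i x) < rk x

-- The Cambrian congruence and the minimal elements of its classes.

module Congruence {n : ℕ} {c ℓ₁ ℓ₂ : Level} (L : CambrianLattice n c ℓ₁ ℓ₂) where
  open CambrianLattice L
  open JoinProperties joinSemilattice using (∨-monotonic; ∨-cong; ∨-comm; x≤y⇒x∨y≈y)
  open MeetProperties meetSemilattice using (∧-monotonic; ∧-cong; ∧-comm; y≤x⇒x∧y≈y)
  private
    ≈≤ : ∀ {x y} → x ≈ y → x ≤ y
    ≈≤ = reflexive
    ≈≥ : ∀ {x y} → x ≈ y → y ≤ x
    ≈≥ = reflexive ∘ Eq.sym

  ∁-cong : ∀ {x y} → x ≈ y → x ∁ ≈ y ∁
  ∁-cong p = antisym (∁-antitone (≈≥ p)) (∁-antitone (≈≤ p))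

  ∁-swap : ∀ {x y} → x ≤ y ∁ → y ≤ x ∁
  ∁-swap x≤ = trans (≈≥ (∁-involutive _)) (∁-antitone x≤)

  ∁-swap′ : ∀ {x y} → x ∁ ≤ y → y ∁ ≤ x
  ∁-swap′ x≤ = trans (∁-antitone x≤) (≈≤ (∁-involutive _))

  ∨-∁ : ∀ x y → (x ∨ y) ∁ ≈ x ∁ ∧ y ∁
  ∨-∁ x y = antisym (∧-greatest (∁-antitone (x≤x∨y x y)) (∁-antitone (y≤x∨y x y)))
                    (∁-swap (∨-least (∁-swap (x∧y≤x _ _)) (∁-swap (x∧y≤y _ _))))

  ∧-∁ : ∀ x y → (x ∧ y) ∁ ≈ x ∁ ∨ y ∁
  ∧-∁ x y = antisym (∁-swap′ (∧-greatest (∁-swap′ (x≤x∨y _ _)) (∁-swap′ (y≤x∨y _ _))))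
                    (∨-least (∁-antitone (x∧y≤x _ _)) (∁-antitone (x∧y≤y _ _)))

  σ-cong : ∀ {i x y} → x ≈ y → σ i x ≈ σ i y
  σ-cong p = antisym (σ-mono (λ q → trans q (≈≥ p)) (≈≤ p)) (σ-mono (λ q → trans q (≈≤ p)) (≈≥ p))

  -- The elements not above `atom i` are those below `atom i ∁`, hence closed under joins.
  atom-prime : ∀ {i x y} → atom i ≤ x ∨ y → ¬ atom i ≤ x → atom i ≤ y
  atom-prime {i} {x} {y} i≤ i≰x with i atom≤? y
  ... | yes i≤y = i≤y
  ... | no  i≰y = contradiction (∨-least (≰⇒≤∁ i≰x) (≰⇒≤∁ i≰y)) (atom-∁ i≤)

  atom≤∁ : ∀ {i x} → ¬ atom i ≤ x → atom i ≤ x ∁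
  atom≤∁ i≰x = ∁-swap (≰⇒≤∁ i≰x)

  atom≰∁ : ∀ {i x} → atom i ≤ x → ¬ atom i ≤ x ∁
  atom≰∁ i≤x i≤∁ = atom-∁ i≤x (∁-swap i≤∁)

  atom≢ : ∀ {i j} → i ≢ j → ¬ atom i ≤ atom j
  atom≢ i≢j = i≢j ∘ atom-injective

  σ≤ : ∀ {i x} → ¬ atom i ≤ x → σ i (atom i ∨ x) ≤ atom i ∨ x
  σ≤ i≰x = trans (≈≤ (cover i≰x)) (x∧y≤x _ _)

  ≤σ : ∀ {i x} → ¬ atom i ≤ x → x ≤ σ i (atom i ∨ x)
  ≤σ i≰x = trans (∧-greatest (y≤x∨y _ _) (≰⇒≤∁ i≰x)) (≈≥ (cover i≰x))

  -- `σ i` is an order isomorphism from the elements above `atom i` onto the others, and the others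
  -- are closed under joins by `atom-prime`.
  σ-∨ : ∀ {i x y} → atom i ≤ x → atom i ≤ y → σ i (x ∨ y) ≈ σ i x ∨ σ i y
  σ-∨ {i} {x} {y} i≤x i≤y = antisym
    (trans (σ-mono (λ _ → trans i≤x (x≤x∨y x y)) (∨-least (up i≤x (x≤x∨y _ _)) (up i≤y (y≤x∨y _ _))))
           (≈≤ (σ-involutive i _)))
    (∨-least (σ-mono (λ _ → i≤x) (x≤x∨y x y)) (σ-mono (λ _ → i≤y) (y≤x∨y x y)))
    where
    up : ∀ {z} → atom i ≤ z → σ i z ≤ σ i x ∨ σ i y → z ≤ σ i (σ i x ∨ σ i y)
    up i≤z σz≤ = trans (≈≥ (σ-involutive i _))
      (σ-mono (λ i≤ → contradiction (atom-prime i≤ (σ-descends i≤x)) (σ-descends i≤y)) σz≤)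

  σ-∧ : ∀ {i x y} → atom i ≤ x → atom i ≤ y → σ i (x ∧ y) ≈ σ i x ∧ σ i y
  σ-∧ {i} {x} {y} i≤x i≤y = antisym
    (∧-greatest (σ-mono (λ _ → ∧-greatest i≤x i≤y) (x∧y≤x x y)) (σ-mono (λ _ → ∧-greatest i≤x i≤y) (x∧y≤y x y)))
    (trans (≈≥ (σ-involutive i _))
      (σ-mono (λ _ → σ-ascends λ i≤ → σ-descends i≤x (trans i≤ (x∧y≤x _ _)))
        (∧-greatest (down i≤x (x∧y≤x _ _)) (down i≤y (x∧y≤y _ _)))))
    where
    down : ∀ {z} → atom i ≤ z → σ i x ∧ σ i y ≤ σ i z → σ i (σ i x ∧ σ i y) ≤ z
    down i≤z ≤σz = trans (σ-mono (λ i≤ → contradiction i≤ (σ-descends i≤z)) ≤σz) (≈≤ (σ-involutive i _))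

  -- The Cambrian congruence, generated by contracting one side of each polygon [⊥ , atom i ∨ atom j].
  data Θ (G : Rel (Fin n) 0ℓ) : Rel Carrier (c ⊔ ℓ₁) where
    ≈⇒Θ : ∀ {x y} → x ≈ y → Θ G x y
    symΘ : ∀ {x y} → Θ G x y → Θ G y x
    _▷_ : ∀ {x y z} → Θ G x y → Θ G y z → Θ G x z
    ∨Θ : ∀ {x y} z → Θ G x y → Θ G (x ∨ z) (y ∨ z)
    ∧Θ : ∀ {x y} z → Θ G x y → Θ G (x ∧ z) (y ∧ z)
    gen : ∀ {i j} → G i j → i ≢ j → Θ G (atom j) (σ i (atom i ∨ atom j))

  infixr 5 _▷_

  Θ-mono : ∀ {G H : Rel (Fin n) 0ℓ} → (∀ {i j} → i ≢ j → G i j → H i j) → ∀ {x y} → Θ G x y → Θ H x y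
  Θ-mono f (≈⇒Θ p) = ≈⇒Θ p
  Θ-mono f (symΘ p) = symΘ (Θ-mono f p)
  Θ-mono f (p ▷ q) = Θ-mono f p ▷ Θ-mono f q
  Θ-mono f (∨Θ z p) = ∨Θ z (Θ-mono f p)
  Θ-mono f (∧Θ z p) = ∧Θ z (Θ-mono f p)
  Θ-mono f (gen g i≢j) = gen (f i≢j g) i≢j

  -- Joining a generator with `atom i ∁ ∧ atom j ∁` gives `atom i ∁` on one side, by `polygon`, and
  -- the complement of `σ j (atom j ∨ atom i)` on the other, by `cover`.
  gen-∁ : ∀ {G : Rel (Fin n) 0ℓ} {i j} → G i j → i ≢ j → Θ G (atom i ∁) (σ j (atom i ∁ ∧ atom j ∁))
  gen-∁ {G} {i} {j} g i≢j =
    ≈⇒Θ (antisym (polygon i j) (∨-least (≰⇒≤∁ (σ-descends (x≤x∨y _ _))) (x∧y≤x _ _)))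
    ▷ ∨Θ (atom i ∁ ∧ atom j ∁) (symΘ (gen g i≢j))
    ▷ ≈⇒Θ (Eq.trans (∨-cong (Eq.sym (∁-involutive _)) ij∁)
        (Eq.trans (∨-comm _ _) (Eq.trans (Eq.sym (∧-∁ _ _))
        (Eq.trans (∁-cong (Eq.sym (cover (atom≢ (i≢j ∘ ≡.sym)))))
        (Eq.trans (Eq.sym (σ-∁ j _)) (σ-cong (Eq.sym ij∁)))))))
    where
    ij∁ : atom i ∁ ∧ atom j ∁ ≈ (atom j ∨ atom i) ∁
    ij∁ = Eq.trans (∧-comm _ _) (Eq.sym (∨-∁ _ _))

  -- Complementation exchanges joins and meets; a complemented generator is an instance of `gen-∁`
  -- for the reversed order of letters.
  Θ-∁ : ∀ {G : Rel (Fin n) 0ℓ} {x y} → Θ G x y → Θ (flip G) (x ∁) (y ∁)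
  Θ-∁ (≈⇒Θ p) = ≈⇒Θ (∁-cong p)
  Θ-∁ (symΘ p) = symΘ (Θ-∁ p)
  Θ-∁ (p ▷ q) = Θ-∁ p ▷ Θ-∁ q
  Θ-∁ (∨Θ z p) = ≈⇒Θ (∨-∁ _ z) ▷ ∧Θ (z ∁) (Θ-∁ p) ▷ ≈⇒Θ (Eq.sym (∨-∁ _ z))
  Θ-∁ (∧Θ z p) = ≈⇒Θ (∧-∁ _ z) ▷ ∨Θ (z ∁) (Θ-∁ p) ▷ ≈⇒Θ (Eq.sym (∧-∁ _ z))
  Θ-∁ (gen {i} {j} g i≢j) = gen-∁ g (i≢j ∘ ≡.sym)
    ▷ ≈⇒Θ (Eq.trans (σ-cong (Eq.trans (∧-comm _ _) (Eq.sym (∨-∁ _ _)))) (σ-∁ i _))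

  -- Both ends of a generator lie above `atom j` and above no other atom; primality of atoms carries
  -- this through joins.
  Θ-atom : ∀ {G : Rel (Fin n) 0ℓ} {x y} k → Θ G x y → (atom k ≤ x → atom k ≤ y) × (atom k ≤ y → atom k ≤ x)
  Θ-atom k (≈⇒Θ p) = (λ k≤ → trans k≤ (≈≤ p)) , (λ k≤ → trans k≤ (≈≥ p))
  Θ-atom k (symΘ p) = let f , g = Θ-atom k p in g , f
  Θ-atom k (p ▷ q) = let f , g = Θ-atom k p ; f′ , g′ = Θ-atom k q in f′ ∘ f , g ∘ g′
  Θ-atom k (∨Θ {x} {y} z p) = let f , g = Θ-atom k p in join f , join g
    where
    join : ∀ {u v} → (atom k ≤ u → atom k ≤ v) → atom k ≤ u ∨ z → atom k ≤ v ∨ z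
    join {u} f k≤ with k atom≤? u
    ... | yes k≤u = trans (f k≤u) (x≤x∨y _ _)
    ... | no  k≰u = trans (atom-prime k≤ k≰u) (y≤x∨y _ _)
  Θ-atom k (∧Θ {x} {y} z p) = let f , g = Θ-atom k p in meet f , meet g
    where
    meet : ∀ {u v} → (atom k ≤ u → atom k ≤ v) → atom k ≤ u ∧ z → atom k ≤ v ∧ z
    meet f k≤ = ∧-greatest (f (trans k≤ (x∧y≤x _ _))) (trans k≤ (x∧y≤y _ _))
  Θ-atom k (gen {i} {j} g i≢j) = (λ k≤ → trans k≤ (≤σ (atom≢ i≢j))) , back
    where
    back : atom k ≤ σ i (atom i ∨ atom j) → atom k ≤ atom j
    back k≤ = atom-prime (trans k≤ (σ≤ (atom≢ i≢j)))
      λ k≤i → σ-descends (x≤x∨y _ _) (≡.subst (λ h → atom h ≤ _) (atom-injective k≤i) k≤)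

  -- The letter s is put before, respectively after, all others. The pair (s, s) is excluded by the
  -- condition i ≢ j in `gen`.
  first last : Fin n → Rel (Fin n) 0ℓ → Rel (Fin n) 0ℓ
  first s B i j = i ≡ s ⊎ B i j
  last  s B i j = j ≡ s ⊎ B i j

  -- Minimality within the class. As v ∧ w is congruent to w for every v in the class, w is then its
  -- least element.
  Bottom : Rel (Fin n) 0ℓ → Carrier → Set (c ⊔ ℓ₁ ⊔ ℓ₂)
  Bottom G w = ∀ v → v ≤ w → Θ G v w → w ≤ v

  Bottom-resp : ∀ {G : Rel (Fin n) 0ℓ} {w w′} → w ≈ w′ → Bottom G w → Bottom G w′
  Bottom-resp p b v v≤ θ = trans (≈≥ p) (b v (trans v≤ (≈≥ p)) (θ ▷ ≈⇒Θ (Eq.sym p)))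

  Bottom-mono : ∀ {G H : Rel (Fin n) 0ℓ} → (∀ {i j} → i ≢ j → H i j → G i j) → ∀ {w} → Bottom G w → Bottom H w
  Bottom-mono f b v v≤ θ = b v v≤ (Θ-mono f θ)

  -- Meeting v with x gives an element congruent to (x ∨ y) ∧ x = x, so x ≤ v; likewise y ≤ v.
  Bottom-∨ : ∀ {G : Rel (Fin n) 0ℓ} {x y} → Bottom G x → Bottom G y → Bottom G (x ∨ y)
  Bottom-∨ {G} {x} {y} bx by v v≤ θ = ∨-least (below bx (x≤x∨y x y)) (below by (y≤x∨y x y))
    where
    below : ∀ {z} → Bottom G z → z ≤ x ∨ y → z ≤ v
    below bz z≤ = trans (bz _ (x∧y≤y _ _) (∧Θ _ θ ▷ ≈⇒Θ (y≤x⇒x∧y≈y z≤))) (x∧y≤x _ _)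

  Bottom-⊥ : ∀ {G : Rel (Fin n) 0ℓ} → Bottom G ⊥
  Bottom-⊥ v _ _ = ⊥-minimum v

  -- Restriction to the parabolic subgroup without s, and rotation of the word.

  module _ (s : Fin n) where
    -- In the weak order, the factor of x in the parabolic subgroup generated by S ∖ {s}.
    p : Carrier → Carrier
    p x = x ∧ e s

    p-∨ : ∀ x y → p (x ∨ y) ≈ p x ∨ p y
    p-∨ x y = antisym (e-∨ s x y) (∨-least (∧-monotonic (x≤x∨y x y) refl) (∧-monotonic (y≤x∨y x y) refl))

    p-fix : ∀ {x} → x ≤ e s → p x ≈ x
    p-fix x≤e = antisym (x∧y≤x _ _) (∧-greatest refl x≤e)

    p-atom : p (atom s) ≤ ⊥
    p-atom = atom-minimal (x∧y≤x _ _) λ s≤ → atom≰e s (trans s≤ (x∧y≤y _ _))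

    atom≰ : ∀ {x} → x ≤ e s → ¬ atom s ≤ x
    atom≰ x≤e s≤x = atom≰e s (trans s≤x x≤e)

    p-e∁ : p (e s ∁) ≤ ⊥
    p-e∁ = atomic λ i i≤ → atom≰∁ (trans i≤ (x∧y≤y _ _)) (trans i≤ (x∧y≤x _ _))

    p-∨-e∁ : ∀ {v} → v ≤ e s → p (v ∨ e s ∁) ≤ v
    p-∨-e∁ v≤e = trans (e-∨ s _ _) (∨-least (x∧y≤x _ _) (trans p-e∁ (⊥-minimum _)))

    -- Passing from the restriction of w to w itself: the largest element below w whose
    -- restriction lies below v is congruent to w.
    Bottom-p : ∀ {G : Rel (Fin n) 0ℓ} {w} → Bottom G w → Bottom G (p w)
    Bottom-p {G} {w} b v v≤ θ = trans (∧-greatest (trans (x∧y≤x _ _) w≤) (x∧y≤y _ _)) (p-∨-e∁ (trans v≤ (x∧y≤y _ _)))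
      where
      w≤ : w ≤ v ∨ e s ∁
      w≤ = trans (b ((v ∨ e s ∁) ∧ w) (x∧y≤y _ _)
        (∧Θ w (∨Θ (e s ∁) θ) ▷ ≈⇒Θ (y≤x⇒x∧y≈y (e-section s w)))) (x∧y≤x _ _)

    -- As `p` preserves joins and meets, only the generators need to be examined.
    Θ-p : ∀ {G B : Rel (Fin n) 0ℓ} →
          (∀ {i j} → G i j → i ≢ j → Θ B (p (atom j)) (p (σ i (atom i ∨ atom j)))) →
          ∀ {x y} → Θ G x y → Θ B (p x) (p y)
    Θ-p f (≈⇒Θ q)   = ≈⇒Θ (∧-cong q Eq.refl)
    Θ-p f (symΘ q)  = symΘ (Θ-p f q)
    Θ-p f (q ▷ r)   = Θ-p f q ▷ Θ-p f r
    Θ-p f (∨Θ z q)  = ≈⇒Θ (p-∨ _ z) ▷ ∨Θ (p z) (Θ-p f q) ▷ ≈⇒Θ (Eq.sym (p-∨ _ z))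
    Θ-p f (∧Θ z q)  = ≈⇒Θ p-∧ ▷ ∧Θ z (Θ-p f q) ▷ ≈⇒Θ (Eq.sym p-∧)
      where
      p-∧ : ∀ {x} → p (x ∧ z) ≈ p x ∧ z
      p-∧ = antisym (∧-greatest (∧-monotonic (x∧y≤x _ _) refl) (trans (x∧y≤x _ _) (x∧y≤y _ _)))
                    (∧-greatest (∧-monotonic (x∧y≤x _ _) refl) (trans (x∧y≤x _ _) (x∧y≤y _ _)))
    Θ-p f (gen g i≢j) = f g i≢j

    module _ (B : Rel (Fin n) 0ℓ) (avoids : ∀ {i j} → B i j → i ≢ s × j ≢ s) where
      private
        polygon-p : ∀ {i j} → B i j → i ≢ j → Θ B (p (atom j)) (p (σ i (atom i ∨ atom j)))
        polygon-p b i≢j = let i≢s , j≢s = avoids b in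
          ≈⇒Θ (p-fix (e-upper j≢s)) ▷ gen b i≢j
          ▷ ≈⇒Θ (Eq.sym (p-fix (trans (σ≤ (atom≢ i≢j)) (∨-least (e-upper i≢s) (e-upper j≢s)))))

      -- For a generator with i = s, both ends restrict to the restriction of `atom j`; the other
      -- generators lie below `e s` and are kept.
      first-p : ∀ {x y} → Θ (first s B) x y → Θ B (p x) (p y)
      first-p = Θ-p λ where
        (inj₁ ≡.refl) i≢j → ≈⇒Θ (antisym
          (∧-monotonic (≤σ (atom≢ i≢j)) refl)
          (trans (∧-monotonic (σ≤ (atom≢ i≢j)) refl)
                 (trans (≈≤ (p-∨ _ _)) (∨-least (trans p-atom (⊥-minimum _)) refl))))
        (inj₂ b) i≢j → polygon-p b i≢j

      -- For a generator with j = s, both ends restrict to `⊥`: the far end restricts below `atom i`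
      -- but is not above it.
      last-p : ∀ {x y} → Θ (last s B) x y → Θ B (p x) (p y)
      last-p = Θ-p λ where
        (inj₁ ≡.refl) i≢j → ≈⇒Θ (antisym
          (trans p-atom (⊥-minimum _))
          (trans (atom-minimal
                   (trans (∧-monotonic (σ≤ (atom≢ i≢j)) refl)
                          (trans (≈≤ (p-∨ _ _)) (∨-least (x∧y≤x _ _) (trans p-atom (⊥-minimum _)))))
                   (λ i≤ → σ-descends (x≤x∨y _ _) (trans i≤ (x∧y≤x _ _))))
                 (⊥-minimum _)))
        (inj₂ b) i≢j → polygon-p b i≢j

    -- The join of e s with the elements σ s (atom s ∨ atom j) is atom s ∁, because
    -- σ s of this join lies above all atoms.
    first-e : ∀ {B} → Θ (first s B) (e s) (atom s ∁)
    first-e {B} = symΘ (fold-Θ (allFin n)) ▷ ≈⇒Θ (antisym (fold≤ (allFin n)) ≤fold)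
      where
      fold : List (Fin n) → Carrier
      fold [] = e s
      fold (j ∷ js) with j Fin.≟ s
      ... | yes _ = fold js
      ... | no  _ = fold js ∨ σ s (atom s ∨ atom j)

      fold-Θ : ∀ js → Θ (first s B) (fold js) (e s)
      fold-Θ [] = ≈⇒Θ Eq.refl
      fold-Θ (j ∷ js) with j Fin.≟ s
      ... | yes _   = fold-Θ js
      ... | no  j≢s = ∨Θ _ (fold-Θ js) ▷ ≈⇒Θ (∨-comm _ _) ▷ ∨Θ (e s) (symΘ (gen (inj₁ ≡.refl) (j≢s ∘ ≡.sym)))
                      ▷ ≈⇒Θ (x≤y⇒x∨y≈y (e-upper j≢s))

      fold≤ : ∀ js → fold js ≤ atom s ∁
      fold≤ [] = ≰⇒≤∁ (atom≰e s)
      fold≤ (j ∷ js) with j Fin.≟ s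
      ... | yes _ = fold≤ js
      ... | no  _ = ∨-least (fold≤ js) (≰⇒≤∁ (σ-descends (x≤x∨y _ _)))

      ≤fold-at : ∀ {j js} → j ≢ s → j ∈ js → σ s (atom s ∨ atom j) ≤ fold js
      ≤fold-at {j} {j′ ∷ js} j≢s j∈ with j′ Fin.≟ s | j∈
      ... | yes j′≡s | here ≡.refl = contradiction j′≡s j≢s
      ... | yes _    | there j∈js  = ≤fold-at j≢s j∈js
      ... | no  _    | here ≡.refl = y≤x∨y _ _
      ... | no  _    | there j∈js  = trans (≤fold-at j≢s j∈js) (x≤x∨y _ _)

      D : Carrier
      D = fold (allFin n)

      D≱ : ¬ atom s ≤ D
      D≱ s≤ = atom-∁ s≤ (fold≤ (allFin n))

      σD≥ : ∀ j → atom j ≤ σ s D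
      σD≥ j with j Fin.≟ s
      ... | yes ≡.refl = σ-ascends D≱
      ... | no j≢s = trans (y≤x∨y _ _) (trans (≈≥ (σ-involutive s _))
              (σ-mono (λ s≤D → contradiction s≤D D≱) (≤fold-at j≢s (∈-allFin j))))

      top : ∀ x → x ≤ σ s D
      top x = trans (≈≥ (∁-involutive x)) (∁-swap′ (trans (atomic λ j → atom≰∁ (σD≥ j)) (⊥-minimum _)))

      ≤fold : atom s ∁ ≤ D
      ≤fold = trans (≈≥ (σ-involutive s _))
        (trans (σ-mono (λ _ → σ-ascends (atom≰∁ refl)) (top _)) (≈≤ (σ-involutive s _)))

    -- The complement of `first-e`: reversing `first s (flip B)` gives `last s B`.
    last-e : ∀ {B} → Θ (last s B) (atom s) (e s ∁)
    last-e {B} = symΘ (Θ-∁ (first-e {flip B}) ▷ ≈⇒Θ (∁-involutive _))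

    module _ (B : Rel (Fin n) 0ℓ) (avoids : ∀ {i j} → B i j → i ≢ s × j ≢ s) where
      -- By `cover` the elements compared are (atom s ∨ x) ∧ atom s ∁ and its analogue for y. By
      -- `last-e`, `atom s` may be replaced by `e s ∁`, whose join with z depends only on the
      -- restriction of z; the restrictions are congruent by `first-p`.
      first-σ-∨ : ∀ {x y} → ¬ atom s ≤ x → ¬ atom s ≤ y → Θ (first s B) x y →
                  Θ (last s B) (σ s (atom s ∨ x)) (σ s (atom s ∨ y))
      first-σ-∨ {x} {y} s≰x s≰y θ =
        ≈⇒Θ (cover s≰x)
        ▷ ∧Θ (atom s ∁) (up x ▷ ∨Θ (e s ∁) (Θ-mono (λ _ → inj₂) (first-p B avoids θ)) ▷ symΘ (up y))
        ▷ ≈⇒Θ (Eq.sym (cover s≰y))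
        where
        up : ∀ z → Θ (last s B) (atom s ∨ z) (p z ∨ e s ∁)
        up z = ∨Θ z last-e ▷ ≈⇒Θ (antisym (∨-least (y≤x∨y _ _) (e-section s z))
                 (∨-least (trans (x∧y≤x _ _) (y≤x∨y _ _)) (x≤x∨y _ _)))

      -- Induction on the derivation, as `σ s` preserves joins and meets of elements above `atom s`.
      -- In a join, a member not above `atom s` is first replaced by its join with `atom s`; this is
      -- where `first-σ-∨` enters.
      first⇒last : ∀ {x y} → Θ (first s B) x y → atom s ≤ x → Θ (last s B) (σ s x) (σ s y)
      first⇒last (≈⇒Θ q) _ = ≈⇒Θ (σ-cong q)
      first⇒last (symΘ q) s≤ = symΘ (first⇒last q (proj₂ (Θ-atom s q) s≤))
      first⇒last (q ▷ r) s≤ = first⇒last q s≤ ▷ first⇒last r (proj₁ (Θ-atom s q) s≤)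
      first⇒last (∨Θ {x} {y} z q) s≤ with s atom≤? x
      ... | yes s≤x = ≈⇒Θ (lem s≤x) ▷ ∨Θ _ (first⇒last q s≤x) ▷ ≈⇒Θ (Eq.sym (lem (proj₁ (Θ-atom s q) s≤x)))
        where
        lem : ∀ {u} → atom s ≤ u → σ s (u ∨ z) ≈ σ s u ∨ σ s (atom s ∨ z)
        lem s≤u = Eq.trans (σ-cong (antisym (∨-monotonic refl (y≤x∨y _ _))
                    (∨-least (x≤x∨y _ _) (∨-least (trans s≤u (x≤x∨y _ _)) (y≤x∨y _ _)))))
                  (σ-∨ s≤u (x≤x∨y _ _))
      ... | no s≰x = ≈⇒Θ lem ▷ ∨Θ (σ s z) (first-σ-∨ s≰x (s≰x ∘ proj₂ (Θ-atom s q)) q) ▷ ≈⇒Θ (Eq.sym lem)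
        where
        s≤z : atom s ≤ z
        s≤z = atom-prime s≤ s≰x
        lem : ∀ {u} → σ s (u ∨ z) ≈ σ s (atom s ∨ u) ∨ σ s z
        lem = Eq.trans (σ-cong (antisym (∨-monotonic (y≤x∨y _ _) refl)
                (∨-least (∨-least (trans s≤z (y≤x∨y _ _)) (x≤x∨y _ _)) (y≤x∨y _ _))))
              (σ-∨ (x≤x∨y _ _) s≤z)
      first⇒last (∧Θ z q) s≤ = ≈⇒Θ (σ-∧ s≤x s≤z) ▷ ∧Θ (σ s z) (first⇒last q s≤x)
        ▷ ≈⇒Θ (Eq.sym (σ-∧ (proj₁ (Θ-atom s q) s≤x) s≤z))
        where
        s≤x = trans s≤ (x∧y≤x _ _)
        s≤z = trans s≤ (x∧y≤y _ _)
      first⇒last (gen (inj₁ i≡s) i≢j) s≤ = contradiction (≡.trans i≡s (atom-injective s≤)) i≢j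
      first⇒last (gen (inj₂ b) i≢j) s≤ = contradiction (≡.sym (atom-injective s≤)) (proj₂ (avoids b))

    module _ (B : Rel (Fin n) 0ℓ) (avoids : ∀ {i j} → B i j → i ≢ s × j ≢ s) where
      -- `first⇒last` for the reversed relation, conjugated by complementation.
      last⇒first : ∀ {x y} → Θ (last s B) x y → ¬ atom s ≤ x → Θ (first s B) (σ s x) (σ s y)
      last⇒first {x} {y} θ s≰x =
        ≈⇒Θ (lem x) ▷ Θ-∁ (first⇒last (flip B) (λ b → let q , r = avoids b in r , q) (Θ-∁ θ) (atom≤∁ s≰x))
        ▷ ≈⇒Θ (Eq.sym (lem y))
        where
        lem : ∀ z → σ s z ≈ σ s (z ∁) ∁
        lem z = Eq.trans (σ-cong (Eq.sym (∁-involutive z))) (σ-∁ s _)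

      -- Meeting `first-e` with w shows that `e s ∧ w` is congruent to `atom s ∁ ∧ w`, which is w.
      Bottom-first⇒≤e : ∀ {w} → ¬ atom s ≤ w → Bottom (first s B) w → w ≤ e s
      Bottom-first⇒≤e {w} s≰w b = trans (b _ (x∧y≤y _ _)
        (∧Θ w first-e ▷ ≈⇒Θ (y≤x⇒x∧y≈y (≰⇒≤∁ s≰w)))) (x∧y≤x _ _)

      Bottom-first⇒last-σ : ∀ {w} → atom s ≤ w → Bottom (first s B) w → Bottom (last s B) (σ s w)
      Bottom-first⇒last-σ s≤w b v v≤ θ = trans
        (σ-mono (λ _ → s≤w) (b _
          (trans (σ-mono (λ s≤ → contradiction s≤ (σ-descends s≤w)) v≤) (≈≤ (σ-involutive s _)))
          (last⇒first θ s≰v ▷ ≈⇒Θ (σ-involutive s _))))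
        (≈≤ (σ-involutive s _))
        where
        s≰v = λ s≤v → σ-descends s≤w (trans s≤v v≤)

      Bottom-last-σ⇒first : ∀ {w} → atom s ≤ w → Bottom (last s B) (σ s w) → Bottom (first s B) w
      Bottom-last-σ⇒first s≤w b v v≤ θ = trans (≈≥ (σ-involutive s _))
        (trans (σ-mono (λ s≤ → contradiction s≤ (σ-descends s≤v)) (b _ (σ-mono (λ _ → s≤v) v≤) (first⇒last B avoids θ s≤v)))
               (≈≤ (σ-involutive s _)))
        where
        s≤v = proj₂ (Θ-atom s θ) s≤w

      private
        -- Below `e s` the map `p` is the identity, so there `first s B` and `last s B` both induce
        -- the congruence of B.
        unproject : ∀ {H : Rel (Fin n) 0ℓ} {v w} → v ≤ w → w ≤ e s →
                    (∀ {i j} → i ≢ j → B i j → H i j) → Θ B (p v) (p w) → Θ H v w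
        unproject v≤w w≤e B⊆H θ = ≈⇒Θ (Eq.sym (p-fix (trans v≤w w≤e))) ▷ Θ-mono B⊆H θ ▷ ≈⇒Θ (p-fix w≤e)

      Bottom-first⇒last : ∀ {w} → w ≤ e s → Bottom (first s B) w → Bottom (last s B) w
      Bottom-first⇒last w≤e b v v≤ θ = b v v≤ (unproject v≤ w≤e (λ _ → inj₂) (last-p B avoids θ))

      Bottom-last⇒first : ∀ {w} → w ≤ e s → Bottom (last s B) w → Bottom (first s B) w
      Bottom-last⇒first w≤e b v v≤ θ = b v v≤ (unproject v≤ w≤e (λ _ → inj₂) (first-p B avoids θ))

-- The order of letters in a word and its rotations.

module _ {n : ℕ} where
  Before : List (Fin n) → Rel (Fin n) 0ℓ
  Before []      i j = Empty
  Before (s ∷ a) i j = (i ≡ s × j ∈ a) ⊎ Before a i j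

  Before⇒∈ : ∀ a {i j} → Before a i j → i ∈ a × j ∈ a
  Before⇒∈ (s ∷ a) (inj₁ (≡.refl , j∈a)) = here ≡.refl , there j∈a
  Before⇒∈ (s ∷ a) (inj₂ b) = let i∈a , j∈a = Before⇒∈ a b in there i∈a , there j∈a

  Before-∷ʳ⁻ : ∀ a {s i j} → Before (a ∷ʳ s) i j → j ≡ s ⊎ Before a i j
  Before-∷ʳ⁻ []      (inj₁ (_ , ()))
  Before-∷ʳ⁻ (r ∷ a) (inj₁ (i≡r , j∈)) with ∈-++⁻ a j∈
  ... | inj₁ j∈a         = inj₂ (inj₁ (i≡r , j∈a))
  ... | inj₂ (here j≡s)  = inj₁ j≡s
  Before-∷ʳ⁻ (r ∷ a) (inj₂ b) with Before-∷ʳ⁻ a b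
  ... | inj₁ j≡s = inj₁ j≡s
  ... | inj₂ b′  = inj₂ (inj₂ b′)

  Before-∷ʳ⁺ˡ : ∀ a {s i j} → Before a i j → Before (a ∷ʳ s) i j
  Before-∷ʳ⁺ˡ (r ∷ a) (inj₁ (i≡r , j∈a)) = inj₁ (i≡r , ∈-++⁺ˡ j∈a)
  Before-∷ʳ⁺ˡ (r ∷ a) (inj₂ b)           = inj₂ (Before-∷ʳ⁺ˡ a b)

  Before-∷ʳ⁺ʳ : ∀ {a s i} → i ∈ a → Before (a ∷ʳ s) i s
  Before-∷ʳ⁺ʳ {r ∷ a} (here ≡.refl) = inj₁ (≡.refl , ∈-++⁺ʳ a (here ≡.refl))
  Before-∷ʳ⁺ʳ {r ∷ a} (there i∈a)   = inj₂ (Before-∷ʳ⁺ʳ i∈a)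

  Enumerates : List (Fin n) → Set
  Enumerates a = a ↭ allFin n

  rotate : ∀ {s a} → Enumerates (s ∷ a) → Enumerates (a ∷ʳ s)
  rotate {s} {a} en = ↭-trans (↭-sym (∷↭∷ʳ s a)) en

  Enumerates⇒∈ : ∀ {a} → Enumerates a → ∀ i → i ∈ a
  Enumerates⇒∈ en i = ∈-resp-↭ (↭-sym en) (∈-allFin i)

  Enumerates⇒∉ : ∀ {s a} → Enumerates (s ∷ a) → s ∉ a
  Enumerates⇒∉ en s∈a with Permutation.Unique-resp-↭ (≡.setoid (Fin n)) (↭⇒↭ₛ (↭-sym en)) (allFin⁺ n)
  ... | s≢ ∷ _ = lookup s≢ s∈a ≡.refl

-- Minimal elements of classes, their meets, and sorting passes.

module SortableElements {n : ℕ} {c ℓ₁ ℓ₂ : Level} (L : CambrianLattice n c ℓ₁ ℓ₂) where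
  open CambrianLattice L
  open Congruence L
  open MeetProperties meetSemilattice using (∧-monotonic)
  open DecMembership (Fin._≟_ {n}) using (_∈?_)

  Bot : List (Fin n) → Carrier → Set (c ⊔ ℓ₁ ⊔ ℓ₂)
  Bot a = Bottom (Before a)

  module _ {s : Fin n} {a : List (Fin n)} (en : Enumerates (s ∷ a)) where
    private
      avoids : ∀ {i j} → Before a i j → i ≢ s × j ≢ s
      avoids b = let i∈a , j∈a = Before⇒∈ a b in
        (λ { ≡.refl → Enumerates⇒∉ en i∈a }) , (λ { ≡.refl → Enumerates⇒∉ en j∈a })

      ∈a : ∀ {i} → i ≢ s → i ∈ a
      ∈a {i} i≢s with Enumerates⇒∈ en i
      ... | here i≡s  = contradiction i≡s i≢s
      ... | there i∈a = i∈a

      toFirst : ∀ {i j} → i ≢ j → Before (s ∷ a) i j → first s (Before a) i j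
      toFirst _ = [ inj₁ ∘ proj₁ , inj₂ ]′

      fromFirst : ∀ {i j} → i ≢ j → first s (Before a) i j → Before (s ∷ a) i j
      fromFirst i≢j (inj₁ ≡.refl) = inj₁ (≡.refl , ∈a (i≢j ∘ ≡.sym))
      fromFirst _   (inj₂ b)      = inj₂ b

      toLast : ∀ {i j} → i ≢ j → Before (a ∷ʳ s) i j → last s (Before a) i j
      toLast _ = Before-∷ʳ⁻ a

      fromLast : ∀ {i j} → i ≢ j → last s (Before a) i j → Before (a ∷ʳ s) i j
      fromLast i≢j (inj₁ ≡.refl) = Before-∷ʳ⁺ʳ (∈a i≢j)
      fromLast _   (inj₂ b)      = Before-∷ʳ⁺ˡ a b

    Bot-σ⁺ : ∀ {w} → atom s ≤ w → Bot (s ∷ a) w → Bot (a ∷ʳ s) (σ s w)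
    Bot-σ⁺ s≤w = Bottom-mono toLast ∘ Bottom-first⇒last-σ s (Before a) avoids s≤w ∘ Bottom-mono fromFirst

    Bot-σ⁻ : ∀ {w} → atom s ≤ w → Bot (a ∷ʳ s) (σ s w) → Bot (s ∷ a) w
    Bot-σ⁻ s≤w = Bottom-mono toFirst ∘ Bottom-last-σ⇒first s (Before a) avoids s≤w ∘ Bottom-mono fromLast

    Bot⇒≤e : ∀ {w} → ¬ atom s ≤ w → Bot (s ∷ a) w → w ≤ e s
    Bot⇒≤e s≰w = Bottom-first⇒≤e s (Before a) avoids s≰w ∘ Bottom-mono fromFirst

    Bot-rotate⁺ : ∀ {w} → w ≤ e s → Bot (s ∷ a) w → Bot (a ∷ʳ s) w
    Bot-rotate⁺ w≤e = Bottom-mono toLast ∘ Bottom-first⇒last s (Before a) avoids w≤e ∘ Bottom-mono fromFirst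

    Bot-rotate⁻ : ∀ {w} → w ≤ e s → Bot (a ∷ʳ s) w → Bot (s ∷ a) w
    Bot-rotate⁻ w≤e = Bottom-mono toFirst ∘ Bottom-last⇒first s (Before a) avoids w≤e ∘ Bottom-mono fromLast

  private
    shift : ∀ {ℓ} (P : List (Fin n) → Set ℓ) a {d s} → P ((a ++ d) ∷ʳ s) → P (a ++ (d ∷ʳ s))
    shift P a {d} {s} = ≡.subst P (++-assoc a d (s ∷ []))

    shift⁻ : ∀ {ℓ} (P : List (Fin n) → Set ℓ) a {d s} → P (a ++ (d ∷ʳ s)) → P ((a ++ d) ∷ʳ s)
    shift⁻ P a {d} {s} = ≡.subst P (≡.sym (++-assoc a d (s ∷ [])))

  private
    -- The induction hypothesis ranges over all words, because dividing by the first letter rotates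
    -- the word.
    Bot-∧-below : ℕ → Set (c ⊔ ℓ₁ ⊔ ℓ₂)
    Bot-∧-below k = ∀ {a x y} → Enumerates a → Bot a x → Bot a y → rk (x ∧ y) < k → Bot a (x ∧ y)

    -- A full rotation of the word without division by a letter leaves no atom below x ∧ y.
    Bot-∧-step : ∀ {k} → Bot-∧-below k → ∀ a d {x y} → Enumerates (a ++ d) → Bot (a ++ d) x → Bot (a ++ d) y →
                 rk (x ∧ y) ℕ.≤ k → (∀ i → i ∈ d → ¬ atom i ≤ x ∧ y) → Bot (a ++ d) (x ∧ y)
    Bot-∧-step below [] d en bx by _ none =
      Bottom-resp (antisym (⊥-minimum _) (atomic λ i → none i (Enumerates⇒∈ en i))) Bottom-⊥
    Bot-∧-step {k} below (s ∷ a) d {x} {y} en bx by rk≤k none with s atom≤? (x ∧ y)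
    ... | yes s≤ = Bot-σ⁻ en s≤ (Bottom-resp (Eq.sym (σ-∧ s≤x s≤y))
        (below (rotate en) (Bot-σ⁺ en s≤x bx) (Bot-σ⁺ en s≤y by) (ℕ.<-≤-trans rk< rk≤k)))
      where
      s≤x = trans s≤ (x∧y≤x _ _)
      s≤y = trans s≤ (x∧y≤y _ _)
      rk< : rk (σ s x ∧ σ s y) < rk (x ∧ y)
      rk< = ≡.subst (_< rk (x ∧ y)) (rk-cong (σ-∧ s≤x s≤y)) (rk-descends s≤)
    ... | no s≰ = Bot-rotate⁻ en x∧y≤e (Bottom-resp p≈ (shift⁻ (λ b → Bot b _) a
        (Bot-∧-step below a (d ∷ʳ s) (shift Enumerates a (rotate en))
        (shift (λ b → Bot b (p s x)) a (Bot-rotate⁺ en (x∧y≤y _ _) (Bottom-p s bx)))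
        (shift (λ b → Bot b (p s y)) a (Bot-rotate⁺ en (x∧y≤y _ _) (Bottom-p s by)))
        (ℕ.≤-trans (ℕ.≤-reflexive (rk-cong p≈)) rk≤k) none′)))
      where
      x∧y≤e : x ∧ y ≤ e s
      x∧y≤e with s atom≤? x | s atom≤? y
      ... | no s≰x | _      = trans (x∧y≤x _ _) (Bot⇒≤e en s≰x bx)
      ... | yes _  | no s≰y = trans (x∧y≤y _ _) (Bot⇒≤e en s≰y by)
      ... | yes s≤x | yes s≤y = contradiction (∧-greatest s≤x s≤y) s≰
      p≈ : p s x ∧ p s y ≈ x ∧ y
      p≈ = antisym (∧-monotonic (x∧y≤x _ _) (x∧y≤x _ _))
        (∧-greatest (∧-greatest (x∧y≤x _ _) x∧y≤e) (∧-greatest (x∧y≤y _ _) x∧y≤e))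
      none′ : ∀ i → i ∈ d ∷ʳ s → ¬ atom i ≤ p s x ∧ p s y
      none′ i i∈ i≤ with ∈-++⁻ d i∈
      ... | inj₁ i∈d           = none i i∈d (trans i≤ (reflexive p≈))
      ... | inj₂ (here ≡.refl) = s≰ (trans i≤ (reflexive p≈))

    Bot-∧-bounded : ∀ k → Bot-∧-below k
    Bot-∧-bounded (suc k) {a} en bx by (s≤s rk≤k) = ≡.subst (λ b → Bot b _) (++-identityʳ a)
      (Bot-∧-step (Bot-∧-bounded k) a [] (pad Enumerates en) (pad (λ b → Bot b _) bx) (pad (λ b → Bot b _) by) rk≤k λ _ ())
      where
      pad : ∀ {ℓ} (P : List (Fin n) → Set ℓ) → P a → P (a ++ [])
      pad P = ≡.subst P (≡.sym (++-identityʳ a))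

  Bot-∧ : ∀ {a x y} → Enumerates a → Bot a x → Bot a y → Bot a (x ∧ y)
  Bot-∧ en bx by = Bot-∧-bounded _ en bx by ℕ.≤-refl

  -- `pass` as a relation, with the comparison of lengths replaced by a test for the atom, so that
  -- each test matches a case of the recursion for `Bot`.
  data Pass : List (Fin n) → Carrier → List (Fin n) → Carrier → Set (c ⊔ ℓ₂) where
    []   : ∀ {w} → Pass [] w [] w
    take : ∀ {i a w b w′} → atom i ≤ w → Pass a (σ i w) b w′ → Pass (i ∷ a) w (i ∷ b) w′
    skip : ∀ {i a w b w′} → ¬ atom i ≤ w → Pass a w b w′ → Pass (i ∷ a) w b w′

  -- Taking i would require `atom i` below `e i`; division by the other letters stays in the
  -- parabolic subgroup without i.
  Pass-≤e : ∀ {a w b w′ i} → Pass a w b w′ → w ≤ e i → i ∉ b × w′ ≤ e i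
  Pass-≤e [] w≤e = (λ ()) , w≤e
  Pass-≤e {i = i} (take {j} j≤w ps) w≤e = (λ { (here i≡j) → j≢i (≡.sym i≡j) ; (there i∈) → proj₁ rest i∈ }) , proj₂ rest
    where
    j≢i : j ≢ i
    j≢i ≡.refl = atom≰ i w≤e j≤w
    rest = Pass-≤e ps (σ-≤e j≢i w≤e)
  Pass-≤e (skip _ ps) w≤e = Pass-≤e ps w≤e

  Pass-≤e⁻ : ∀ {a w b w′ i} → Pass a w b w′ → i ∉ b → w′ ≤ e i → w ≤ e i
  Pass-≤e⁻ [] _ w≤e = w≤e
  Pass-≤e⁻ (take {j} j≤w ps) i∉ w′≤e = trans (reflexive (Eq.sym (σ-involutive j _)))
    (σ-≤e (λ { ≡.refl → i∉ (here ≡.refl) }) (Pass-≤e⁻ ps (i∉ ∘ there) w′≤e))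
  Pass-≤e⁻ (skip _ ps) i∉ w′≤e = Pass-≤e⁻ ps i∉ w′≤e

  -- The letters already tested are kept in d, so the word rotates during the pass. A skipped letter
  -- i puts the current element below `e i`, where the pass then stays.
  Pass-Bot⁺ : ∀ {a w b w′ d} → Pass a w b w′ → Enumerates (a ++ d) → Bot (a ++ d) w →
              Bot (d ++ a) w′ × (∀ {i} → i ∈ a → i ∉ b → w′ ≤ e i)
  Pass-Bot⁺ {d = d} [] en bot = ≡.subst (λ c → Bot c _) (≡.sym (++-identityʳ d)) bot , λ ()
  Pass-Bot⁺ {i ∷ a} {d = d} (take i≤w ps) en bot =
    ≡.subst (λ c → Bot c _) (++-assoc d (i ∷ []) a) (proj₁ rest) ,
    λ { (here ≡.refl) i∉ → contradiction (here ≡.refl) i∉ ; (there j∈) j∉ → proj₂ rest j∈ (j∉ ∘ there) }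
    where
    rest = Pass-Bot⁺ {d = d ∷ʳ i} ps (shift Enumerates a (rotate en))
             (shift (λ c → Bot c _) a (Bot-σ⁺ en i≤w bot))
  Pass-Bot⁺ {i ∷ a} {d = d} (skip i≰w ps) en bot =
    ≡.subst (λ c → Bot c _) (++-assoc d (i ∷ []) a) (proj₁ rest) ,
    λ { (here ≡.refl) _ → proj₂ (Pass-≤e ps w≤e) ; (there j∈) j∉ → proj₂ rest j∈ j∉ }
    where
    w≤e = Bot⇒≤e en i≰w bot
    rest = Pass-Bot⁺ {d = d ∷ʳ i} ps (shift Enumerates a (rotate en))
             (shift (λ c → Bot c _) a (Bot-rotate⁺ en w≤e bot))

  Pass-⊆ : ∀ {a w b w′} → Pass a w b w′ → b ⊆ a
  Pass-⊆ (take _ ps) (here ≡.refl) = here ≡.refl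
  Pass-⊆ (take _ ps) (there i∈b)   = there (Pass-⊆ ps i∈b)
  Pass-⊆ (skip _ ps) i∈b           = there (Pass-⊆ ps i∈b)

  -- At a skipped letter the bound on w′ is pulled back to w by `Pass-≤e⁻`. That i does not recur
  -- later in the pass rests on the letters being distinct.
  Pass-Bot⁻ : ∀ {a w b w′ d} → Pass a w b w′ → Enumerates (a ++ d) → Bot (d ++ a) w′ →
              (∀ {i} → i ∈ a → i ∉ b → w′ ≤ e i) → Bot (a ++ d) w
  Pass-Bot⁻ {d = d} [] en bot _ = ≡.subst (λ c → Bot c _) (++-identityʳ d) bot
  Pass-Bot⁻ {i ∷ a} {d = d} (take i≤w ps) en bot skipped = Bot-σ⁻ en i≤w (shift⁻ (λ c → Bot c _) a
    (Pass-Bot⁻ {d = d ∷ʳ i} ps (shift Enumerates a (rotate en)) (≡.subst (λ c → Bot c _) (≡.sym (++-assoc d (i ∷ []) a)) bot)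
      λ j∈ j∉ → skipped (there j∈) λ { (here ≡.refl) → Enumerates⇒∉ en (∈-++⁺ˡ j∈) ; (there j∈b) → j∉ j∈b }))
  Pass-Bot⁻ {i ∷ a} {d = d} (skip i≰w ps) en bot skipped = Bot-rotate⁻ en
    (Pass-≤e⁻ ps i∉b (skipped (here ≡.refl) i∉b))
    (shift⁻ (λ c → Bot c _) a
      (Pass-Bot⁻ {d = d ∷ʳ i} ps (shift Enumerates a (rotate en)) (≡.subst (λ c → Bot c _) (≡.sym (++-assoc d (i ∷ []) a)) bot)
        (skipped ∘ there)))
    where
    i∉b = λ i∈b → Enumerates⇒∉ en (∈-++⁺ˡ (Pass-⊆ ps i∈b))

  -- The measure for induction over passes: a pass over all letters that keeps the rank finds no
  -- atom below w, so w is `⊥`.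
  Pass-rk : ∀ {a w b w′} → Pass a w b w′ → rk w′ < rk w ⊎ (rk w′ ≡ rk w × (∀ {i} → i ∈ a → ¬ atom i ≤ w))
  Pass-rk [] = inj₂ (≡.refl , λ ())
  Pass-rk (take i≤w ps) with Pass-rk ps
  ... | inj₁ rk< = inj₁ (ℕ.<-trans rk< (rk-descends i≤w))
  ... | inj₂ (rk≡ , _) = inj₁ (ℕ.≤-<-trans (ℕ.≤-reflexive rk≡) (rk-descends i≤w))
  Pass-rk (skip i≰w ps) with Pass-rk ps
  ... | inj₁ rk< = inj₁ rk<
  ... | inj₂ (rk≡ , none) = inj₂ (rk≡ , λ { (here ≡.refl) → i≰w ; (there j∈) → none j∈ })

  module _ {a : List (Fin n)} (en : Enumerates a) where
    private
      en[] : Enumerates (a ++ [])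
      en[] = ≡.subst Enumerates (≡.sym (++-identityʳ a)) en

    module _ (w : ℕ → Carrier) (b : ℕ → List (Fin n)) (passes : ∀ k → Pass a (w k) (b k) (w (suc k))) where
      -- A letter i skipped in pass k leaves an element below `e i`, from which the next pass cannot
      -- take i.
      Bot⇒decreasing : Bot a (w 0) → ∀ k → b (suc k) ⊆ b k
      Bot⇒decreasing bot k {i} i∈ with i ∈? b k
      ... | yes i∈b = i∈b
      ... | no  i∉b = contradiction i∈ (proj₁ (Pass-≤e (passes (suc k))
                        (proj₂ (step (bots k)) (Enumerates⇒∈ en i) i∉b)))
        where
        step : ∀ {k} → Bot a (w k) → Bot a (w (suc k)) × (∀ {i} → i ∈ a → i ∉ b k → w (suc k) ≤ e i)
        step bot = Pass-Bot⁺ {d = []} (passes _) en[] (≡.subst (λ c → Bot c _) (≡.sym (++-identityʳ a)) bot)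
        bots : ∀ k → Bot a (w k)
        bots zero    = bot
        bots (suc k) = proj₁ (step (bots k))

    decreasing⇒Bot : (w : ℕ → Carrier) (b : ℕ → List (Fin n)) → (∀ k → Pass a (w k) (b k) (w (suc k))) →
                     (∀ k → b (suc k) ⊆ b k) → Bot a (w 0)
    decreasing⇒Bot w b passes decr = proj₁ (go w b passes decr (<-wellFounded _))
      where
      -- The second component strengthens the induction: a letter absent from the first pass is
      -- absent from all later ones. It supplies the hypothesis of `Pass-Bot⁻` one pass earlier.
      go : (w : ℕ → Carrier) (b : ℕ → List (Fin n)) → (∀ k → Pass a (w k) (b k) (w (suc k))) →
           (∀ k → b (suc k) ⊆ b k) → Acc _<_ (rk (w 0)) → Bot a (w 0) × (∀ i → i ∉ b 0 → w 0 ≤ e i)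
      go w b passes decr (acc rs) with Pass-rk (passes 0)
      ... | inj₂ (_ , none) = Bottom-resp (antisym (⊥-minimum _) w≤⊥) Bottom-⊥ , λ i _ → trans w≤⊥ (⊥-minimum _)
        where
        w≤⊥ : w 0 ≤ ⊥
        w≤⊥ = atomic λ i → none (Enumerates⇒∈ en i)
      ... | inj₁ rk< = ≡.subst (λ c → Bot c _) (++-identityʳ a)
                         (Pass-Bot⁻ {d = []} (passes 0) en[] (proj₁ rest) λ {i} _ → skipped i) ,
                       λ i i∉ → Pass-≤e⁻ (passes 0) i∉ (skipped i i∉)
        where
        rest = go (w ∘ suc) (b ∘ suc) (passes ∘ suc) (decr ∘ suc) (rs rk<)
        skipped : ∀ i → i ∉ b 0 → w 1 ≤ e i
        skipped i i∉ = proj₂ rest i (i∉ ∘ decr 0)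

-- Parity of reflections and inversion sets.

open ReflectionRepresentation using (module DistinctGenerators)
open import Data.Nat.Base using (_+_; _*_; _∸_; _≤_)

parity : (ℕ → Bool) → ℕ → Bool
parity f zero    = false
parity f (suc n) = f 0 xor parity (f ∘ suc) n

parity-cong : ∀ {f g} → (∀ k → f k ≡ g k) → ∀ n → parity f n ≡ parity g n
parity-cong f≡g zero    = ≡.refl
parity-cong f≡g (suc n) = ≡.cong₂ _xor_ (f≡g 0) (parity-cong (f≡g ∘ suc) n)

parity-+ : ∀ f m n → parity f (m + n) ≡ parity f m xor parity (λ k → f (m + k)) n
parity-+ f zero    n = ≡.refl
parity-+ f (suc m) n = ≡.trans (≡.cong (f 0 xor_) (parity-+ (f ∘ suc) m n)) (≡.sym (xor-assoc (f 0) _ _))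

-- The two halves of the range contribute equally.
parity-periodic : ∀ f m → (∀ k → f (m + k) ≡ f k) → parity f (m * 2) ≡ false
parity-periodic f m periodic = begin
  parity f (m * 2)                                ≡⟨ ≡.cong (parity f) (ℕ.*-comm m 2) ⟩
  parity f (m + (m + 0))                          ≡⟨ parity-+ f m (m + 0) ⟩
  parity f m xor parity (λ k → f (m + k)) (m + 0) ≡⟨ ≡.cong (parity f m xor_) (parity-cong periodic (m + 0)) ⟩
  parity f m xor parity f (m + 0)                 ≡⟨ ≡.cong (λ k → parity f m xor parity f k) (ℕ.+-identityʳ m) ⟩
  parity f m xor parity f m                       ≡⟨ xor-same (parity f m) ⟩
  false                                           ∎
  where open ≡-Reasoning

does-true : ∀ {a} {A : Set a} (a? : Dec A) → does a? ≡ true → A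
does-true (yes a) _ = a

xor-false : ∀ {x y} → x xor y ≡ false → x ≡ y
xor-false {false} {false} _ = ≡.refl
xor-false {true}  {true}  _ = ≡.refl

xor-not : ∀ x → x xor not x ≡ true
xor-not false = ≡.refl
xor-not true  = ≡.refl

xor-cancelʳ : ∀ {x} y → x xor y ≡ y → x ≡ false
xor-cancelʳ {false} _     _ = ≡.refl
xor-cancelʳ {true}  false ()
xor-cancelʳ {true}  true  ()

module Inversions {g e : Level} (W : Group g e) (C : CoxeterSystem W) (finite : Finite W) where
  open Group W
  open CoxeterSystem C
  open Coxeter C
  open Sorting finite
  open GroupProperties W using (⁻¹-involutive; ⁻¹-anti-homo-∙; inverseʳ-unique; ε⁻¹≈ε)
  private module ≈-Reasoning = SetoidReasoning setoid

  cancelˡ : ∀ u x → u ⁻¹ ∙ (u ∙ x) ≈ x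
  cancelˡ u x = trans (sym (assoc _ _ _)) (trans (∙-congʳ (inverseˡ u)) (identityˡ x))

  cancelʳ : ∀ u x → u ∙ (u ⁻¹ ∙ x) ≈ x
  cancelʳ u x = trans (sym (assoc _ _ _)) (trans (∙-congʳ (inverseʳ u)) (identityˡ x))

  infixl 8 _^_
  _^_ : Carrier → Carrier → Carrier
  t ^ u = u ⁻¹ ∙ (t ∙ u)

  ^-cong : ∀ {t t′ u u′} → t ≈ t′ → u ≈ u′ → t ^ u ≈ t′ ^ u′
  ^-cong p q = ∙-cong (⁻¹-cong q) (∙-cong p q)

  ^-ε : ∀ t → t ^ ε ≈ t
  ^-ε t = trans (∙-cong ε⁻¹≈ε (identityʳ t)) (identityˡ t)

  ^-∙ : ∀ t u v → t ^ (u ∙ v) ≈ t ^ u ^ v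
  ^-∙ t u v = begin
    (u ∙ v) ⁻¹ ∙ (t ∙ (u ∙ v))    ≈⟨ ∙-cong (⁻¹-anti-homo-∙ u v) (sym (assoc t u v)) ⟩
    v ⁻¹ ∙ u ⁻¹ ∙ (t ∙ u ∙ v)     ≈⟨ assoc _ _ _ ⟩
    v ⁻¹ ∙ (u ⁻¹ ∙ (t ∙ u ∙ v))   ≈⟨ ∙-congˡ (sym (assoc _ _ _)) ⟩
    v ⁻¹ ∙ (u ⁻¹ ∙ (t ∙ u) ∙ v)   ∎
    where open ≈-Reasoning

  ^-^⁻¹ : ∀ t u → t ^ u ^ (u ⁻¹) ≈ t
  ^-^⁻¹ t u = trans (sym (^-∙ t u (u ⁻¹))) (trans (^-cong refl (inverseʳ u)) (^-ε t))

  ^⁻¹-^ : ∀ t u → t ^ (u ⁻¹) ^ u ≈ t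
  ^⁻¹-^ t u = trans (sym (^-∙ t (u ⁻¹) u)) (trans (^-cong refl (inverseˡ u)) (^-ε t))

  ^-self : ∀ t → t ^ t ≈ t
  ^-self t = cancelˡ t t

  infix 5 _≐_
  _≐_ : Carrier → Carrier → Bool
  x ≐ y = does (x ≈? y)

  ≐-⇔ : ∀ {x y x′ y′} → (x ≈ y → x′ ≈ y′) → (x′ ≈ y′ → x ≈ y) → (x ≐ y) ≡ (x′ ≐ y′)
  ≐-⇔ {x} {y} {x′} {y′} f f⁻¹ = does-⇔ (mk⇔ f f⁻¹) (x ≈? y) (x′ ≈? y′)

  ≐-true : ∀ {x y} → x ≈ y → (x ≐ y) ≡ true
  ≐-true {x} {y} = dec-true (x ≈? y)

  ≐-true⁻ : ∀ {x y} → (x ≐ y) ≡ true → x ≈ y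
  ≐-true⁻ {x} {y} = does-true (x ≈? y)

  ≐-^ : ∀ t u x → (t ^ u ≐ x) ≡ (t ≐ x ^ (u ⁻¹))
  ≐-^ t u x = ≐-⇔ (λ p → trans (sym (^-^⁻¹ t u)) (^-cong p refl)) (λ p → trans (^-cong p refl) (^⁻¹-^ x u))

  relator-ε : ∀ {r} → Relator r → ⟦ r ⟧ ≈ ε
  relator-ε {r} R = ≡.subst (λ a → ⟦ a ⟧ ≈ ε) (++-identityʳ r)
    (Equivalence.from (presents (r ++ []) []) (EqClosure.return (delete [] [] R)))

  s-involutive : ∀ i → s i ∙ s i ≈ ε
  s-involutive i = trans (∙-congˡ (sym (identityʳ _))) (relator-ε (square i))

  s⁻¹ : ∀ i → s i ⁻¹ ≈ s i
  s⁻¹ i = sym (inverseʳ-unique (s i) (s i) (s-involutive i))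

  s-cancel : ∀ i x → s i ∙ (s i ∙ x) ≈ x
  s-cancel i x = trans (sym (assoc _ _ _)) (trans (∙-congʳ (s-involutive i)) (identityˡ x))

  ⟦++⟧ : ∀ a b → ⟦ a ++ b ⟧ ≈ ⟦ a ⟧ ∙ ⟦ b ⟧
  ⟦++⟧ []      b = sym (identityˡ _)
  ⟦++⟧ (i ∷ a) b = trans (∙-congˡ (⟦++⟧ a b)) (sym (assoc _ _ _))

  -- The parity of the number of occurrences of t among the reflections of a word.
  inv : Word → Carrier → Bool
  inv []      t = false
  inv (i ∷ a) t = (t ≐ s i) xor inv a (t ^ s i)

  inv-cong : ∀ a {t t′} → t ≈ t′ → inv a t ≡ inv a t′
  inv-cong []      p = ≡.refl
  inv-cong (i ∷ a) p = ≡.cong₂ _xor_ (≐-⇔ (trans (sym p)) (trans p)) (inv-cong a (^-cong p refl))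

  -- The cocycle rule: inside a ++ b the reflections of b appear conjugated by the element of a.
  inv-++ : ∀ a b t → inv (a ++ b) t ≡ inv a t xor inv b (t ^ ⟦ a ⟧)
  inv-++ []      b t = inv-cong b (sym (^-ε t))
  inv-++ (i ∷ a) b t = ≡.trans
    (≡.cong ((t ≐ s i) xor_) (≡.trans (inv-++ a b (t ^ s i))
      (≡.cong (inv a (t ^ s i) xor_) (inv-cong b (sym (^-∙ t (s i) ⟦ a ⟧))))))
    (≡.sym (xor-assoc (t ≐ s i) _ _))

  module _ (i j : Fin rank) where
    private
      alternating : ℕ → Word
      alternating k = concat (replicate k (i ∷ j ∷ []))

      pow : ℕ → Carrier
      pow k = ⟦ alternating k ⟧

      pow-+ : ∀ k l → pow (k + l) ≈ pow k ∙ pow l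
      pow-+ zero    l = sym (identityˡ _)
      pow-+ (suc k) l = trans (∙-congˡ (trans (∙-congˡ (pow-+ k l)) (sym (assoc _ _ _)))) (sym (assoc _ _ _))

      step : ∀ k → s i ∙ (s j ∙ (pow k ∙ s i)) ≈ pow (suc k) ∙ s i
      step k = sym (trans (assoc _ _ _) (∙-congˡ (assoc _ _ _)))

      pow-comm : ∀ k → pow k ∙ (s i ∙ s j) ≈ s i ∙ s j ∙ pow k
      pow-comm zero    = trans (identityˡ _) (sym (identityʳ _))
      pow-comm (suc k) = begin
        s i ∙ (s j ∙ pow k) ∙ (s i ∙ s j)   ≈⟨ ∙-congʳ (sym (assoc _ _ _)) ⟩
        s i ∙ s j ∙ pow k ∙ (s i ∙ s j)     ≈⟨ assoc _ _ _ ⟩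
        s i ∙ s j ∙ (pow k ∙ (s i ∙ s j))   ≈⟨ ∙-congˡ (pow-comm k) ⟩
        s i ∙ s j ∙ (s i ∙ s j ∙ pow k)     ≈⟨ ∙-congˡ (assoc _ _ _) ⟩
        s i ∙ s j ∙ pow (suc k)             ∎
        where open ≈-Reasoning

      -- Conjugating (s i s j)^k s i back through s j and s i raises the exponent by 2.
      shift : ∀ k t → (t ^ s i ^ s j ≐ pow k ∙ s i) ≡ (t ≐ pow (2 + k) ∙ s i)
      shift k t = ≡.trans (≐-^ (t ^ s i) (s j) _) (≡.trans (≐-^ t (s i) _)
        (≐-⇔ (λ p → trans p conj) (λ p → trans p (sym conj))))
        where
        open ≈-Reasoning
        conj : (pow k ∙ s i) ^ (s j ⁻¹) ^ (s i ⁻¹) ≈ pow (2 + k) ∙ s i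
        conj = begin
          s i ⁻¹ ⁻¹ ∙ (s j ⁻¹ ⁻¹ ∙ (pow k ∙ s i ∙ s j ⁻¹) ∙ s i ⁻¹)
            ≈⟨ ∙-cong (⁻¹-involutive _) (∙-cong (∙-cong (⁻¹-involutive _) (∙-congˡ (s⁻¹ j))) (s⁻¹ i)) ⟩
          s i ∙ (s j ∙ (pow k ∙ s i ∙ s j) ∙ s i)
            ≈⟨ ∙-congˡ (∙-congʳ (∙-congˡ (trans (assoc _ _ _) (trans (pow-comm k) (assoc _ _ _))))) ⟩
          s i ∙ (s j ∙ pow (suc k) ∙ s i)
            ≈⟨ sym (assoc _ _ _) ⟩
          pow (2 + k) ∙ s i ∎

      inv-alternating : ∀ k t → inv (alternating k) t ≡ parity (λ l → t ≐ pow l ∙ s i) (k * 2)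
      inv-alternating zero    t = ≡.refl
      inv-alternating (suc k) t = ≡.cong₂ _xor_
        (≐-⇔ (λ p → trans p (sym (identityˡ _))) (λ p → trans p (identityˡ _)))
        (≡.cong₂ _xor_
          (≡.trans (≐-^ t (s i) (s j)) (≐-⇔ (λ p → trans p conj) (λ p → trans p (sym conj))))
          (≡.trans (inv-alternating k (t ^ s i ^ s j)) (parity-cong (λ l → shift l t) (k * 2))))
        where
        conj : s j ^ (s i ⁻¹) ≈ pow 1 ∙ s i
        conj = trans (∙-cong (⁻¹-involutive _) (∙-congˡ (s⁻¹ i)))
          (trans (sym (assoc _ _ _)) (∙-congʳ (∙-congˡ (sym (identityʳ _)))))

    -- The reflections of the word (i j)^m are (s i s j)^l s i for l < 2m, each of which occurs twice.
    inv-power : ∀ t → inv (alternating (m i j)) t ≡ false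
    inv-power t = ≡.trans (inv-alternating (m i j) t) (parity-periodic _ (m i j) λ k →
      ≐-⇔ (λ p → trans p (per k)) (λ p → trans p (sym (per k))))
      where
      per : ∀ k → pow (m i j + k) ∙ s i ≈ pow k ∙ s i
      per k = ∙-congʳ (trans (pow-+ (m i j) k) (trans (∙-congʳ (relator-ε (power i j))) (identityˡ _)))

  s^s : ∀ i → s i ^ (s i ⁻¹) ≈ s i
  s^s i = trans (^-cong refl (s⁻¹ i)) (^-self (s i))

  inv-relator : ∀ {r} → Relator r → ∀ t → inv r t ≡ false
  inv-relator (square i) t = ≡.trans
    (≡.cong ((t ≐ s i) xor_) (≡.trans (xor-identityʳ _)
      (≡.trans (≐-^ t (s i) (s i)) (≐-⇔ (λ p → trans p (s^s i)) (λ p → trans p (sym (s^s i)))))))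
    (xor-same (t ≐ s i))
  inv-relator (power i j) t = inv-power i j t

  -- A relator has no reflection of odd parity and represents `ε`, so in `inv-++` it neither
  -- contributes nor conjugates what follows.
  inv-deletes : ∀ {a b} → Deletes a b → ∀ t → inv a t ≡ inv b t
  inv-deletes (delete u {r} v R) t = begin
    inv (u ++ r ++ v) t                              ≡⟨ inv-++ u (r ++ v) t ⟩
    inv u t xor inv (r ++ v) t′                      ≡⟨ ≡.cong (inv u t xor_) (inv-++ r v t′) ⟩
    inv u t xor (inv r t′ xor inv v (t′ ^ ⟦ r ⟧))    ≡⟨ ≡.cong₂ (λ x y → inv u t xor (x xor y)) (inv-relator R t′)
                                                          (inv-cong v (trans (^-cong refl (relator-ε R)) (^-ε t′))) ⟩
    inv u t xor inv v t′                             ≡⟨ inv-++ u v t ⟨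
    inv (u ++ v) t                                   ∎
    where
    open ≡-Reasoning
    t′ = t ^ ⟦ u ⟧

  inv-∼ : ∀ a b → ⟦ a ⟧ ≈ ⟦ b ⟧ → ∀ t → inv a t ≡ inv b t
  inv-∼ a b p = EqClosure.fold
    {S = λ a b → ∀ t → inv a t ≡ inv b t}
    (record { refl = λ _ → ≡.refl ; sym = λ p t → ≡.sym (p t) ; trans = λ p q t → ≡.trans (p t) (q t) })
    inv-deletes (Equivalence.to (presents a b) p)

  abstract
    -- The characteristic function of the inversion set; by `inv-∼` any word for w computes it.
    N : Carrier → Carrier → Bool
    N w = inv (proj₁ (generates w))

    N-word : ∀ a {w} → ⟦ a ⟧ ≈ w → ∀ t → N w t ≡ inv a t
    N-word a {w} p t = inv-∼ (proj₁ (generates w)) a (trans (proj₂ (generates w)) (sym p)) t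

    N-cong : ∀ {u w t t′} → u ≈ w → t ≈ t′ → N u t ≡ N w t′
    N-cong {u} {w} {t} {t′} p q = ≡.trans (inv-cong (proj₁ (generates u)) q) (≡.sym (N-word (proj₁ (generates u)) (trans (proj₂ (generates u)) p) t′))

  N-ε : ∀ t → N ε t ≡ false
  N-ε t = N-word [] refl t

  N-s : ∀ i t → N (s i) t ≡ (t ≐ s i)
  N-s i t = ≡.trans (N-word (i ∷ []) (identityʳ _) t) (xor-identityʳ _)

  N-∙ : ∀ u w t → N (u ∙ w) t ≡ N u t xor N w (t ^ u)
  N-∙ u w t = ≡.trans (N-word (a ++ b) (trans (⟦++⟧ a b) (∙-cong ⟦a⟧ ⟦b⟧)) t)
    (≡.trans (inv-++ a b t) (≡.cong₂ _xor_ (≡.sym (N-word a ⟦a⟧ t))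
      (≡.trans (inv-cong b (^-cong refl ⟦a⟧)) (≡.sym (N-word b ⟦b⟧ (t ^ u))))))
    where
    a = proj₁ (generates u)
    b = proj₁ (generates w)
    ⟦a⟧ = proj₂ (generates u)
    ⟦b⟧ = proj₂ (generates w)

  N-⁻¹ : ∀ u t → N (u ⁻¹) t ≡ N u (t ^ (u ⁻¹))
  N-⁻¹ u t = xor-false (≡.trans (≡.sym (N-∙ (u ⁻¹) u t)) (≡.trans (N-cong (inverseˡ u) refl) (N-ε t)))

  N-\\ : ∀ x y t → N (x ⁻¹ ∙ y) t ≡ N x (t ^ (x ⁻¹)) xor N y (t ^ (x ⁻¹))
  N-\\ x y t = ≡.trans (N-∙ (x ⁻¹) y t) (≡.cong (_xor N y (t ^ (x ⁻¹))) (N-⁻¹ x t))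

  -- Parabolic subgroups, their reflections, and the exchange condition.

  record Reflection (J : Fin rank → Set) (t : Carrier) : Set e where
    constructor reflection
    field
      {word}  : Word
      {index} : Fin rank
      word∈J  : All J word
      index∈J : J index
      conj    : t ≈ s index ^ ⟦ word ⟧

  record Parabolic (J : Fin rank → Set) (u : Carrier) : Set e where
    constructor parabolic
    field
      {word} : Word
      word∈J : All J word
      value  : ⟦ word ⟧ ≈ u

  module _ {J : Fin rank → Set} where
    Parabolic-ε : Parabolic J ε
    Parabolic-ε = parabolic [] refl

    Parabolic-s : ∀ {i} → J i → Parabolic J (s i)
    Parabolic-s i∈J = parabolic (i∈J ∷ []) (identityʳ _)

    Parabolic-∙ : ∀ {u v} → Parabolic J u → Parabolic J v → Parabolic J (u ∙ v)
    Parabolic-∙ (parabolic {a} a∈J p) (parabolic {b} b∈J q) =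
      parabolic (++⁺ a∈J b∈J) (trans (⟦++⟧ a b) (∙-cong p q))

    Parabolic-resp : ∀ {u v} → u ≈ v → Parabolic J u → Parabolic J v
    Parabolic-resp p (parabolic a∈J q) = parabolic a∈J (trans q p)

    Parabolic-⁻¹ : ∀ {u} → Parabolic J u → Parabolic J (u ⁻¹)
    Parabolic-⁻¹ (parabolic a∈J p) = Parabolic-resp (⁻¹-cong p) (go a∈J)
      where
      go : ∀ {a} → All J a → Parabolic J (⟦ a ⟧ ⁻¹)
      go []                  = Parabolic-resp (sym ε⁻¹≈ε) Parabolic-ε
      go {i ∷ a} (i∈J ∷ a∈J) = Parabolic-resp (trans (∙-congˡ (sym (s⁻¹ i))) (sym (⁻¹-anti-homo-∙ _ _)))
        (Parabolic-∙ (go a∈J) (Parabolic-s i∈J))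

    Reflection-s : ∀ {i} → J i → Reflection J (s i)
    Reflection-s i∈J = reflection [] i∈J (sym (^-ε _))

    Reflection-resp : ∀ {t t′} → t ≈ t′ → Reflection J t → Reflection J t′
    Reflection-resp p (reflection a∈J i∈J q) = reflection a∈J i∈J (trans (sym p) q)

    Reflection-^ : ∀ {t u} → Parabolic J u → Reflection J t → Reflection J (t ^ u)
    Reflection-^ {t} {u} (parabolic {b} b∈J p) (reflection {a} {i} a∈J i∈J q) = reflection (++⁺ a∈J b∈J) i∈J
      (trans (^-cong q (sym p)) (trans (sym (^-∙ (s i) ⟦ a ⟧ ⟦ b ⟧)) (^-cong refl (sym (⟦++⟧ a b)))))

    Reflection-^⁻ : ∀ {t u} → Parabolic J u → Reflection J (t ^ u) → Reflection J t
    Reflection-^⁻ u∈J r = Reflection-resp (^-^⁻¹ _ _) (Reflection-^ (Parabolic-⁻¹ u∈J) r)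

    inv⇒Reflection : ∀ {a t} → All J a → inv a t ≡ true → Reflection J t
    inv⇒Reflection {i ∷ a} {t} (i∈J ∷ a∈J) p with t ≐ s i in eq | p
    ... | true  | _ = Reflection-resp (sym (≐-true⁻ eq)) (Reflection-s i∈J)
    ... | false | q = Reflection-^⁻ (Parabolic-s i∈J) (inv⇒Reflection a∈J q)

    N⇒Reflection : ∀ {u t} → Parabolic J u → N u t ≡ true → Reflection J t
    N⇒Reflection (parabolic {a} a∈J p) q = inv⇒Reflection a∈J (≡.trans (≡.sym (N-word a p _)) q)

    Reflection⇒Parabolic : ∀ {t} → Reflection J t → Parabolic J t
    Reflection⇒Parabolic (reflection a∈J i∈J p) = Parabolic-resp (sym p)
      (Parabolic-∙ (Parabolic-⁻¹ (parabolic a∈J refl)) (Parabolic-∙ (Parabolic-s i∈J) (parabolic a∈J refl)))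

    Reflection-involutive : ∀ {t} → Reflection J t → ∀ x → t ∙ (t ∙ x) ≈ x
    Reflection-involutive {t} (reflection {a} {i} _ _ p) x = begin
      t ∙ (t ∙ x)                     ≈⟨ ∙-cong p (∙-congʳ p) ⟩
      s i ^ u ∙ (s i ^ u ∙ x)         ≈⟨ trans (assoc _ _ _) (∙-congˡ (assoc _ _ _)) ⟩
      u ⁻¹ ∙ (s i ∙ (u ∙ (s i ^ u ∙ x))) ≈⟨ ∙-congˡ (∙-congˡ (∙-congˡ (trans (assoc _ _ _) (∙-congˡ (assoc _ _ _))))) ⟩
      u ⁻¹ ∙ (s i ∙ (u ∙ (u ⁻¹ ∙ (s i ∙ (u ∙ x))))) ≈⟨ ∙-congˡ (∙-congˡ (cancelʳ _ _)) ⟩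
      u ⁻¹ ∙ (s i ∙ (s i ∙ (u ∙ x)))  ≈⟨ ∙-congˡ (s-cancel i _) ⟩
      u ⁻¹ ∙ (u ∙ x)                  ≈⟨ cancelˡ _ _ ⟩
      x                               ∎
      where
      open ≈-Reasoning
      u = ⟦ a ⟧

    -- In the cocycle expansion of t = u ⁻¹ ∙ (s i ∙ u) the two contributions of u cancel, and the
    -- middle letter contributes its own reflection.
    N-Reflection : ∀ {t} → Reflection J t → N t t ≡ true
    N-Reflection {t} (reflection {a} {i} _ _ p) = begin
      N t t                                        ≡⟨ N-cong p refl ⟩
      N (s i ^ u) t                                ≡⟨ N-∙ (u ⁻¹) (s i ∙ u) t ⟩
      N (u ⁻¹) t xor N (s i ∙ u) (t ^ (u ⁻¹))      ≡⟨ ≡.cong₂ _xor_ (N-⁻¹ u t) (≡.trans (N-cong refl t′) (N-∙ (s i) u (s i))) ⟩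
      N u (t ^ (u ⁻¹)) xor (N (s i) (s i) xor N u (s i ^ s i))
        ≡⟨ ≡.cong₂ (λ x y → x xor (y xor N u (s i ^ s i))) (N-cong refl t′) (≡.trans (N-s i (s i)) (≐-true refl)) ⟩
      N u (s i) xor not (N u (s i ^ s i))          ≡⟨ ≡.cong (λ x → N u (s i) xor not x) (N-cong refl (^-self (s i))) ⟩
      N u (s i) xor not (N u (s i))                ≡⟨ xor-not (N u (s i)) ⟩
      true                                         ∎
      where
      open ≡-Reasoning
      u = ⟦ a ⟧
      t′ : t ^ (u ⁻¹) ≈ s i
      t′ = trans (^-cong p refl) (^-^⁻¹ _ u)

    N-reflect : ∀ {t} → Reflection J t → ∀ x → N (t ∙ x) t ≡ not (N x t)
    N-reflect {t} r x = ≡.trans (N-∙ t x t) (≡.cong₂ _xor_ (N-Reflection r) (N-cong refl (^-self t)))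

    -- The strong exchange condition: t occurs among the reflections of a, and omitting the letter
    -- of its first occurrence multiplies by t.
    delete-letter : ∀ {a} → All J a → ∀ {t} → inv a t ≡ true →
                    ∃[ b ] All J b × suc (length b) ≡ length a × ⟦ b ⟧ ≈ t ∙ ⟦ a ⟧
    delete-letter {i ∷ a} (i∈J ∷ a∈J) {t} p with t ≐ s i in eq | p
    ... | true  | _ = a , a∈J , ≡.refl , sym (trans (∙-congʳ (≐-true⁻ eq)) (s-cancel i _))
    ... | false | q = let b , b∈J , len , ⟦b⟧ = delete-letter a∈J q in
      i ∷ b , i∈J ∷ b∈J , ≡.cong suc len , trans (∙-congˡ ⟦b⟧) (conj ⟦ a ⟧)
      where
      conj : ∀ x → s i ∙ (t ^ s i ∙ x) ≈ t ∙ (s i ∙ x)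
      conj x = trans (∙-congˡ (trans (assoc _ _ _) (∙-congˡ (assoc _ _ _)))) (cancelʳ (s i) _)

  Ref : Carrier → Set e
  Ref = Reflection (λ _ → ⊤)

  All-⊤ : (a : Word) → All (λ _ → ⊤) a
  All-⊤ []      = []
  All-⊤ (i ∷ a) = tt ∷ All-⊤ a

  All-Parabolic : ∀ u → Parabolic (λ _ → ⊤) u
  All-Parabolic u = let a , p = generates u in parabolic (All-⊤ a) p

  Reflection⇒Ref : ∀ {J t} → Reflection J t → Ref t
  Reflection⇒Ref (reflection {a} _ _ p) = reflection (All-⊤ a) tt p

  N⇒Ref : ∀ {u t} → N u t ≡ true → Ref t
  N⇒Ref = N⇒Reflection (All-Parabolic _)

  ℓ-≤ : ∀ a {w} → ⟦ a ⟧ ≈ w → ℓ w ≤ length a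
  ℓ-≤ a {w} p = proj₂ (proj₂ (reducedWord w)) a p

  ℓ-cong : ∀ {u w} → u ≈ w → ℓ u ≡ ℓ w
  ℓ-cong {u} {w} p = ℕ.≤-antisym (ℓ-≤ (proj₁ (reducedWord w)) (trans (proj₁ (proj₂ (reducedWord w))) (sym p)))
                                 (ℓ-≤ (proj₁ (reducedWord u)) (trans (proj₁ (proj₂ (reducedWord u))) p))

  N⇒ℓ< : ∀ {w t} → N w t ≡ true → ℓ (t ∙ w) < ℓ w
  N⇒ℓ< {w} {t} p = let a , a≈w , _ = reducedWord w
                       b , _ , len , ⟦b⟧ = delete-letter (All-⊤ a) (≡.trans (≡.sym (N-word a a≈w t)) p)
                   in ℕ.≤-trans (s≤s (ℓ-≤ b (trans ⟦b⟧ (∙-congˡ a≈w)))) (ℕ.≤-reflexive len)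

  ¬N⇒ℓ< : ∀ {w t} → Ref t → N w t ≡ false → ℓ w < ℓ (t ∙ w)
  ¬N⇒ℓ< {w} {t} r p = ≡.subst (_< ℓ (t ∙ w)) (ℓ-cong (Reflection-involutive r w))
    (N⇒ℓ< (≡.trans (N-reflect r w) (≡.cong not p)))

  ℓ<⇒N : ∀ {w t} → Ref t → ℓ (t ∙ w) < ℓ w → N w t ≡ true
  ℓ<⇒N {w} {t} r lt with N w t in eq
  ... | true  = ≡.refl
  ... | false = contradiction lt (ℕ.<-asym (¬N⇒ℓ< r eq))

  module _ {J : Fin rank → Set} where
    -- If the first letter j of a word is no descent, then s j has odd parity in the rest, and
    -- exchange yields a word shorter by two.
    ascents⇒≈ε : ∀ {u} → Parabolic J u → (∀ i → J i → N u (s i) ≡ false) → u ≈ ε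
    ascents⇒≈ε (parabolic {a} a∈J p) asc = trans (sym p)
      (go a a∈J (<-wellFounded _) λ i i∈J → ≡.trans (≡.sym (N-word a p _)) (asc i i∈J))
      where
      go : ∀ a → All J a → Acc _<_ (length a) → (∀ i → J i → inv a (s i) ≡ false) → ⟦ a ⟧ ≈ ε
      go [] _ _ _ = refl
      go (j ∷ a) (j∈J ∷ a∈J) (acc rs) asc with inv a (s j ^ s j) in eq
      ... | false = contradiction (≡.trans (≡.sym (≡.cong₂ _xor_ (≐-true refl) eq)) (asc j j∈J)) λ ()
      ... | true with delete-letter a∈J (≡.trans (inv-cong a (sym (^-self (s j)))) eq)
      ...   | b , b∈J , len , ⟦b⟧ = trans (sym ⟦b⟧) (go b b∈J (rs (ℕ.m≤n⇒m≤1+n (ℕ.≤-reflexive len)))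
                λ i i∈J → ≡.trans (inv-∼ b (j ∷ a) ⟦b⟧ _) (asc i i∈J))

    -- In the coset of x, an element y of extremal length is constant on all reflections of J;
    -- then x = u y, where u has no descents in J.
    constant : (f : Carrier → ℕ) (b : Bool) → (∀ {t x} → Ref t → N x t ≡ not b → f (t ∙ x) < f x) →
               ∀ {x t} → (∀ i → J i → N x (s i) ≡ b) → Reflection J t → N x t ≡ b
    constant f b decreases {x} {t} const r = decidable-stable (N x t ≟ᵇ b) λ N≢b →
      extremal x Parabolic-ε (sym (identityˡ x)) (<-wellFounded _) λ y u∈J x≈uy all →
        N≢b (≡.trans (N-cong (x≈y u∈J x≈uy all) refl) (all r))
      where
      -- The double negation spares a search for a reflection where the value differs from b; the
      -- final claim is a decidable equality.
      extremal : ∀ y {u} → Parabolic J u → x ≈ u ∙ y → Acc _<_ (f y) →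
                 ¬ (∀ y {u} → Parabolic J u → x ≈ u ∙ y → ¬ (∀ {t} → Reflection J t → N y t ≡ b))
      extremal y {u} u∈J x≈uy (acc rs) none = none y u∈J x≈uy λ {t} r →
        decidable-stable (N y t ≟ᵇ b) λ N≢b → extremal (t ∙ y) (Parabolic-∙ u∈J (Reflection⇒Parabolic r))
          (trans x≈uy (trans (∙-congˡ (sym (Reflection-involutive r y))) (sym (assoc _ _ _))))
          (rs (decreases (Reflection⇒Ref r) (¬-not N≢b))) none
      x≈y : ∀ {y u} → Parabolic J u → x ≈ u ∙ y → (∀ {t} → Reflection J t → N y t ≡ b) → x ≈ y
      x≈y {y} {u} u∈J x≈uy all = trans x≈uy (trans (∙-congʳ (ascents⇒≈ε u∈J λ i i∈J →
        xor-cancelʳ b (≡.trans (≡.cong (N u (s i) xor_) (≡.sym (all (Reflection-^ u∈J (Reflection-s i∈J)))))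
          (≡.trans (≡.sym (N-∙ u y (s i))) (≡.trans (N-cong (sym x≈uy) refl) (const i i∈J)))))) (identityˡ y))

-- Inclusion of inversion sets is a lattice order.

module WeakOrder {g e : Level} (W : Group g e) (C : CoxeterSystem W) (finite : Finite W) where
  open Group W
  open CoxeterSystem C
  open Coxeter C
  open Sorting finite
  open GroupProperties W using (⁻¹-involutive; ⁻¹-anti-homo-∙)
  open Inversions W C finite

  infix 4 _⊑_
  _⊑_ : Carrier → Carrier → Set g
  u ⊑ w = ∀ t → N u t ≡ true → N w t ≡ true

  ⊑-reflexive : ∀ {u w} → u ≈ w → u ⊑ w
  ⊑-reflexive p t q = ≡.trans (N-cong (sym p) refl) q

  ⊑-trans : ∀ {u v w} → u ⊑ v → v ⊑ w → u ⊑ w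
  ⊑-trans p q t = q t ∘ p t

  ⊑-false : ∀ {u w} → u ⊑ w → ∀ {t} → N w t ≡ false → N u t ≡ false
  ⊑-false {u} u⊑w {t} q with N u t in eq
  ... | false = ≡.refl
  ... | true  = ≡.trans (≡.sym (u⊑w t eq)) q

  -- For equal inversion sets the cocycle rule leaves u ⁻¹ ∙ w without descents.
  ⊑-antisym : ∀ {u w} → u ⊑ w → w ⊑ u → u ≈ w
  ⊑-antisym {u} {w} p q = trans (sym (identityʳ u)) (trans (∙-congˡ (sym u⁻¹w≈ε)) (cancelʳ u w))
    where
    N≡ : ∀ t → N u t ≡ N w t
    N≡ t with N u t in eq
    ... | true  = ≡.sym (p t eq)
    ... | false = ≡.sym (⊑-false q eq)
    u⁻¹w≈ε : u ⁻¹ ∙ w ≈ ε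
    u⁻¹w≈ε = ascents⇒≈ε (All-Parabolic _) λ i _ →
      ≡.trans (N-\\ u w (s i)) (≡.trans (≡.cong (_xor N w _) (N≡ _)) (xor-same (N w (s i ^ (u ⁻¹)))))

  ε-minimum : ∀ w → ε ⊑ w
  ε-minimum w t p = contradiction (≡.trans (≡.sym p) (N-ε t)) λ ()

  ℓ-bounded : ∃[ b ] ∀ w → ℓ w ≤ b
  ℓ-bounded = proj₁ bound , λ w → ≡.subst (_≤ proj₁ bound) (ℓ-cong (Inverse.strictlyInverseʳ iso w)) (proj₂ bound (Inverse.to iso w))
    where
    iso = proj₂ finite
    bound = bounded _ (ℓ ∘ Inverse.from iso)

  -- The measure for inductions going up the order; the length is bounded as W is finite.
  coℓ : Carrier → ℕ
  coℓ w = proj₁ ℓ-bounded ∸ ℓ w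

  ℓ<⇒coℓ> : ∀ {u w} → ℓ u < ℓ w → coℓ w < coℓ u
  ℓ<⇒coℓ> {u} {w} u<w = ℕ.∸-monoʳ-< u<w (proj₂ ℓ-bounded w)

  module _ {J : Fin rank → Set} where
    no-descents : ∀ {x} → (∀ i → J i → N x (s i) ≡ false) → ∀ {t} → Reflection J t → N x t ≡ false
    no-descents none = constant ℓ false (λ _ → N⇒ℓ<) none

    all-descents : ∀ {x} → (∀ i → J i → N x (s i) ≡ true) → ∀ {t} → Reflection J t → N x t ≡ true
    all-descents all = constant coℓ true (λ r p → ℓ<⇒coℓ> (¬N⇒ℓ< r p)) all

  -- The longest element is characterised by having every reflection of J as an inversion, which
  -- also makes being such a reflection decidable.
  record Longest (J : Fin rank → Set) : Set (g ⊔ e) where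
    field
      element  : Carrier
      inJ      : Parabolic J element
      N-true   : ∀ {t} → Reflection J t → N element t ≡ true

    N⇒ : ∀ {t} → N element t ≡ true → Reflection J t
    N⇒ = N⇒Reflection inJ

    Reflection? : ∀ t → Dec (Reflection J t)
    Reflection? t = map′ N⇒ N-true (N element t ≟ᵇ true)

  module _ {J : Fin rank → Set} (J? : ∀ i → Dec (J i)) where
    longest : Longest J
    longest = go ε Parabolic-ε (<-wellFounded _)
      where
      go : ∀ u → Parabolic J u → Acc _<_ (coℓ u) → Longest J
      go u u∈J (acc rs) with Fin.any? (λ i → J? i ×-dec (N u (s i) ≟ᵇ false))
      ... | yes (i , i∈J , asc) = go (s i ∙ u) (Parabolic-∙ (Parabolic-s i∈J) u∈J)
              (rs (ℓ<⇒coℓ> (¬N⇒ℓ< (Reflection-s tt) asc)))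
      ... | no none = record
        { element = u
        ; inJ     = u∈J
        ; N-true  = all-descents λ i i∈J → ¬-not λ asc → none (i , i∈J , asc)
        }

    -- The parabolic factorisation: descents in J are stripped off on the left until none remains,
    -- and then `no-descents` applies to q.
    decompose : ∀ x → ∃₂ λ u q → Parabolic J u × x ≈ u ∙ q × (∀ {t} → Reflection J t → N q t ≡ false)
    decompose x = go x Parabolic-ε (sym (identityˡ x)) (<-wellFounded _)
      where
      go : ∀ q {u} → Parabolic J u → x ≈ u ∙ q → Acc _<_ (ℓ q) →
           ∃₂ λ u q → Parabolic J u × x ≈ u ∙ q × (∀ {t} → Reflection J t → N q t ≡ false)
      go q {u} u∈J x≈ (acc rs) with Fin.any? (λ i → J? i ×-dec (N q (s i) ≟ᵇ true))
      ... | yes (i , i∈J , desc) = go (s i ∙ q) (Parabolic-∙ u∈J (Parabolic-s i∈J))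
              (trans x≈ (trans (∙-congˡ (sym (s-cancel i q))) (sym (assoc _ _ _)))) (rs (N⇒ℓ< desc))
      ... | no none = u , q , u∈J , x≈ , no-descents λ i i∈J → ¬-not λ desc → none (i , i∈J , desc)

    abstract
      -- For x = u ∙ q as in `decompose`, conjugation by u preserves the reflections of J, and q has
      -- none of them as inversions.
      restriction : ∀ x → ∃[ u ] Parabolic J u × u ⊑ x × (∀ {t} → Reflection J t → N u t ≡ N x t)
      restriction x with decompose x
      ... | u , q , u∈J , x≈uq , q-none = u , u∈J ,
          (λ t p → ≡.trans (≡.sym (N≡ (N⇒Reflection u∈J p))) p) , N≡
        where
        N≡ : ∀ {t} → Reflection J t → N u t ≡ N x t
        N≡ {t} r = ≡.sym (≡.trans (N-cong x≈uq refl) (≡.trans (N-∙ u q t)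
          (≡.trans (≡.cong (N u t xor_) (q-none (Reflection-^ u∈J r))) (xor-identityʳ _))))

  open Longest

  abstract
    w₀ : Longest (λ _ → ⊤)
    w₀ = longest λ _ → yes tt

  infix 9 _∁
  _∁ : Carrier → Carrier
  x ∁ = x ∙ element w₀

  -- The conjugate t ^ x is a reflection, hence an inversion of the longest element, so the cocycle
  -- rule flips the value at t.
  N-∁ : ∀ {x t} → Ref t → N (x ∁) t ≡ not (N x t)
  N-∁ {x} {t} r = ≡.trans (N-∙ x (element w₀) t)
    (≡.trans (≡.cong (N x t xor_) (N-true w₀ (Reflection-^ (All-Parabolic x) r))) (xor-comm (N x t) true))

  N-∁⁺ : ∀ {x t} → Ref t → N x t ≡ false → N (x ∁) t ≡ true
  N-∁⁺ r p = ≡.trans (N-∁ r) (≡.cong not p)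

  N-∁⁻ : ∀ {x t} → N (x ∁) t ≡ true → N x t ≡ false
  N-∁⁻ {x} {t} p with N x t in eq
  ... | false = ≡.refl
  ... | true  = contradiction (≡.trans (≡.sym (≡.trans (N-∁ (N⇒Ref eq)) (≡.cong not eq))) p) λ ()

  ∁-antitone : ∀ {x y} → x ⊑ y → y ∁ ⊑ x ∁
  ∁-antitone x⊑y t p = N-∁⁺ (N⇒Ref p) (⊑-false x⊑y (N-∁⁻ p))

  ∁-involutive : ∀ x → x ∁ ∁ ≈ x
  ∁-involutive x = ⊑-antisym
    (λ t p → not-false (≡.trans (≡.sym (N-∁ (N⇒Ref p))) (N-∁⁻ p)))
    (λ t p → N-∁⁺ (N⇒Ref p) (≡.trans (N-∁ (N⇒Ref p)) (≡.cong not p)))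
    where
    not-false : ∀ {b} → not b ≡ false → b ≡ true
    not-false {true} _ = ≡.refl

  N-∙s : ∀ z i t → N (z ∙ s i) t ≡ N z t xor (t ^ z ≐ s i)
  N-∙s z i t = ≡.trans (N-∙ z (s i) t) (≡.cong (N z t xor_) (N-s i (t ^ z)))

  -- The cover of z by z ∙ s i; the conjugate of s i by z ⁻¹ is the one inversion that it adds.
  record Step (z : Carrier) (i : Fin rank) : Set where
    field ascent : N z (s i ^ (z ⁻¹)) ≡ false

    ⊑-step : z ⊑ z ∙ s i
    ⊑-step t p with t ^ z ≐ s i in eq
    ... | false = ≡.trans (N-∙s z i t) (≡.cong₂ _xor_ p eq)
    ... | true  = contradiction (≡.trans (≡.sym p) (≡.trans (N-cong refl (trans (sym (^-^⁻¹ t z)) (^-cong (≐-true⁻ eq) refl))) ascent)) λ ()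

    N-step : ∀ {t} → N (z ∙ s i) t ≡ true → N z t ≡ false → t ≈ s i ^ (z ⁻¹)
    N-step {t} p q = trans (sym (^-^⁻¹ t z)) (^-cong (≐-true⁻ (≡.trans (≡.cong (_xor (t ^ z ≐ s i)) (≡.sym q)) (≡.trans (≡.sym (N-∙s z i t)) p))) refl)

    N-new : N (z ∙ s i) (s i ^ (z ⁻¹)) ≡ true
    N-new = ≡.trans (N-∙s z i _) (≡.cong₂ _xor_ ascent (≐-true (^⁻¹-^ (s i) z)))

    ℓ-step : ℓ z < ℓ (z ∙ s i)
    ℓ-step = ≡.subst (_< ℓ (z ∙ s i)) (ℓ-cong eq) (N⇒ℓ< N-new)
      where
      eq : s i ^ (z ⁻¹) ∙ (z ∙ s i) ≈ z
      eq = trans (∙-congʳ (trans (∙-congʳ (⁻¹-involutive z)) (sym (assoc _ _ _))))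
        (trans (assoc _ _ _) (trans (∙-congˡ (cancelˡ z (s i)))
        (trans (assoc _ _ _) (trans (∙-congˡ (s-involutive i)) (identityʳ z)))))

  open Step

  -- Any descent i of z ⁻¹ ∙ x serves: its conjugate by z ⁻¹ is an inversion of exactly one of z and
  -- x, hence of x only.
  step : ∀ {z x} → z ⊑ x → z ≈ x ⊎ ∃[ i ] Step z i × z ∙ s i ⊑ x
  step {z} {x} z⊑x with Fin.any? (λ i → N (z ⁻¹ ∙ x) (s i) ≟ᵇ true)
  ... | no none = inj₁ (trans (sym (identityʳ z)) (trans
        (∙-congˡ (sym (ascents⇒≈ε (All-Parabolic _) λ i _ → ¬-not λ p → none (i , p)))) (cancelʳ z x)))
  ... | yes (i , p) = inj₂ (i , st , below)
    where
    t = s i ^ (z ⁻¹)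
    both : N z t ≡ false × N x t ≡ true
    both with N z t in eq | ≡.trans (≡.sym (N-\\ z x (s i))) p
    ... | false | q = ≡.refl , q
    ... | true  | q = contradiction (≡.trans (≡.sym (≡.cong not (z⊑x t eq))) q) λ ()
    st : Step z i
    st = record { ascent = proj₁ both }
    below : z ∙ s i ⊑ x
    below t′ q with N z t′ in eq
    ... | true  = z⊑x t′ eq
    ... | false = ≡.trans (N-cong refl (N-step st q eq)) (proj₂ both)

  Lub : Carrier → Carrier → Carrier → Set g
  Lub x y v = x ⊑ v × y ⊑ v × (∀ w → x ⊑ w → y ⊑ w → v ⊑ w)

  module Polygon (i j : Fin rank) where
    Pair : Fin rank → Set
    Pair k = k ≡ i ⊎ k ≡ j

    top : Longest Pair
    top = longest λ k → (k Fin.≟ i) ⊎-dec (k Fin.≟ j)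

    module _ {z : Carrier} (step-i : Step z i) (step-j : Step z j) where
      ascents : ∀ {t} → Reflection Pair (t ^ z) → N z t ≡ false
      ascents {t} r = ≡.trans (N-cong refl (sym (^-^⁻¹ t z)))
        (≡.trans (≡.sym (N-⁻¹ z (t ^ z))) (no-descents simple r))
        where
        simple : ∀ k → Pair k → N (z ⁻¹) (s k) ≡ false
        simple k (inj₁ ≡.refl) = ≡.trans (N-⁻¹ z (s i)) (ascent step-i)
        simple k (inj₂ ≡.refl) = ≡.trans (N-⁻¹ z (s j)) (ascent step-j)

      N-top : ∀ {t} → Reflection Pair (t ^ z) → N (z ∙ element top) t ≡ true
      N-top {t} r = ≡.trans (N-∙ z (element top) t) (≡.cong₂ _xor_ (ascents r) (N-true top r))

      ⊑-top : z ⊑ z ∙ element top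
      ⊑-top t p with N (element top) (t ^ z) in eq
      ... | false = ≡.trans (N-∙ z (element top) t) (≡.cong₂ _xor_ p eq)
      ... | true  = N-top (N⇒ top eq)

      step-⊑-top : ∀ {k} → Pair k → Step z k → z ∙ s k ⊑ z ∙ element top
      step-⊑-top k∈ st t p with N z t in eq
      ... | true  = ⊑-top t eq
      ... | false = N-top (Reflection-resp (trans (sym (^⁻¹-^ _ z)) (^-cong (sym (N-step st p eq)) refl)) (Reflection-s k∈))

      -- The new inversions t of z ∙ element top are those with t ^ z a reflection of the rank two
      -- subgroup. For an upper bound w both i and j are descents of z ⁻¹ ∙ w, so by `all-descents`
      -- every such t is an inversion of w.
      lub : Lub (z ∙ s i) (z ∙ s j) (z ∙ element top)
      lub = step-⊑-top (inj₁ ≡.refl) step-i , step-⊑-top (inj₂ ≡.refl) step-j , λ w i⊑w j⊑w t p → least-top w i⊑w j⊑w t p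
        where
        least-top : ∀ w → z ∙ s i ⊑ w → z ∙ s j ⊑ w → z ∙ element top ⊑ w
        least-top w i⊑w j⊑w t p with N z t in eq
        ... | true  = ⊑-trans (⊑-step step-i) i⊑w t eq
        ... | false = ≡.trans (N-cong refl (sym (^-^⁻¹ t z)))
              (≡.trans (≡.sym (≡.trans (N-\\ z w (t ^ z)) (≡.cong (_xor N w (t ^ z ^ (z ⁻¹))) (≡.trans (N-cong refl (^-^⁻¹ t z)) eq))))
                (all-descents simple (N⇒ top (≡.trans (≡.cong (_xor N (element top) (t ^ z)) (≡.sym eq)) (≡.trans (≡.sym (N-∙ z (element top) t)) p)))))
          where
          descent : ∀ {k} → Step z k → z ∙ s k ⊑ w → N (z ⁻¹ ∙ w) (s k) ≡ true
          descent st k⊑w = ≡.trans (N-\\ z w _) (≡.cong₂ _xor_ (ascent st) (k⊑w _ (N-new st)))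
          simple : ∀ k → Pair k → N (z ⁻¹ ∙ w) (s k) ≡ true
          simple k (inj₁ ≡.refl) = descent step-i i⊑w
          simple k (inj₂ ≡.refl) = descent step-j j⊑w

  -- Elements above z have a join: replace z by covers of z below the two elements, whose
  -- join exists by the polygon lemma.
  join-above : ∀ z {x y} → z ⊑ x → z ⊑ y → Acc _<_ (coℓ z) → ∃[ v ] Lub x y v
  join-above z {x} {y} z⊑x z⊑y (acc rs) with step z⊑x | step z⊑y
  ... | inj₁ z≈x | _ = y , ⊑-trans (⊑-reflexive (sym z≈x)) z⊑y , (λ _ p → p) , λ _ _ q → q
  ... | inj₂ _ | inj₁ z≈y = x , (λ _ p → p) , ⊑-trans (⊑-reflexive (sym z≈y)) z⊑x , λ _ q _ → q
  ... | inj₂ (i , step-i , i⊑x) | inj₂ (j , step-j , j⊑y) with Polygon.lub i j step-i step-j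
  ... | i⊑v , j⊑v , v-least with join-above (z ∙ s i) i⊑x i⊑v (rs (ℓ<⇒coℓ> (ℓ-step step-i)))
  ... | v₁ , x⊑v₁ , v⊑v₁ , v₁-least with join-above (z ∙ s j) (⊑-trans j⊑v v⊑v₁) j⊑y (rs (ℓ<⇒coℓ> (ℓ-step step-j)))
  ... | v₂ , v₁⊑v₂ , y⊑v₂ , v₂-least = v₂ , ⊑-trans x⊑v₁ v₁⊑v₂ , y⊑v₂ , λ w x⊑w y⊑w →
    v₂-least w (v₁-least w x⊑w (v-least w (⊑-trans i⊑x x⊑w) (⊑-trans j⊑y y⊑w))) y⊑w

  abstract
    join : ∀ x y → ∃[ v ] Lub x y v
    join x y = join-above ε (ε-minimum x) (ε-minimum y) (<-wellFounded _)

  infixr 6 _∨_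
  infixr 7 _∧_
  _∨_ _∧_ : Carrier → Carrier → Carrier
  x ∨ y = proj₁ (join x y)
  x ∧ y = (x ∁ ∨ y ∁) ∁

  ∁-swap : ∀ {x y} → x ∁ ⊑ y → y ∁ ⊑ x
  ∁-swap p = ⊑-trans (∁-antitone p) (⊑-reflexive (∁-involutive _))

  ∁-swap′ : ∀ {x y} → y ⊑ x ∁ → x ⊑ y ∁
  ∁-swap′ p = ⊑-trans (⊑-reflexive (sym (∁-involutive _))) (∁-antitone p)

  weakOrder : Lattice g e g
  weakOrder = record
    { Carrier   = Carrier
    ; _≈_       = _≈_
    ; _≤_       = _⊑_
    ; _∨_       = _∨_
    ; _∧_       = _∧_
    ; isLattice = record
      { isPartialOrder = record
        { isPreorder = record { isEquivalence = isEquivalence ; reflexive = ⊑-reflexive ; trans = ⊑-trans }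
        ; antisym    = ⊑-antisym
        }
      ; supremum = λ x y → proj₂ (join x y)
      ; infimum  = λ x y → let x⊑ , y⊑ , least = proj₂ (join (x ∁) (y ∁)) in
          ∁-swap x⊑ , ∁-swap y⊑ , λ w w⊑x w⊑y → ∁-swap′ (least (w ∁) (∁-antitone w⊑x) (∁-antitone w⊑y))
      }
    }

-- Verification of the axioms in the weak order.

module WeakOrderCambrian {g e : Level} (W : Group g e) (C : CoxeterSystem W) (finite : Finite W) where
  open Group W
  open CoxeterSystem C
  open Coxeter C
  open Sorting finite
  open GroupProperties W using (⁻¹-involutive)
  open Inversions W C finite
  open WeakOrder W C finite
  open Longest
  open Lattice weakOrder using (x≤x∨y; y≤x∨y; ∨-least; x∧y≤x; x∧y≤y; ∧-greatest)

  s⊑⁺ : ∀ {i x} → N x (s i) ≡ true → s i ⊑ x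
  s⊑⁺ {i} p t q = ≡.trans (N-cong refl (≐-true⁻ (≡.trans (≡.sym (N-s i t)) q))) p

  s⊑⁻ : ∀ {i x} → s i ⊑ x → N x (s i) ≡ true
  s⊑⁻ {i} p = p (s i) (≡.trans (N-s i (s i)) (≐-true refl))

  s⋢⁻ : ∀ {i x} → ¬ s i ⊑ x → N x (s i) ≡ false
  s⋢⁻ s⋢x = ¬-not (s⋢x ∘ s⊑⁺)

  true≢false : ∀ {b} → b ≡ true → ¬ b ≡ false
  true≢false ≡.refl ()

  N-s-other : ∀ {i x t} → N x (s i) ≡ false → N x t ≡ true → N (s i) t ≡ false
  N-s-other {i} {x} {t} p q = ¬-not λ r →
    true≢false q (≡.trans (N-cong refl (≐-true⁻ (≡.trans (≡.sym (N-s i t)) r))) p)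

  -- This is where the representation enters: `essential` forbids writing s i without the letter i.
  s∉Parabolic : ∀ {i} → ¬ Parabolic (_≢ i) (s i)
  s∉Parabolic {i} (parabolic {a} i∉a p) = DistinctGenerators.essential matrix i∉a
    (Equivalence.to (presents (i ∷ []) a) (trans (identityʳ _) (sym p)))

  s-injective : ∀ {i j} → s i ⊑ s j → i ≡ j
  s-injective {i} {j} p with i Fin.≟ j
  ... | yes i≡j = i≡j
  ... | no i≢j  = contradiction (Parabolic-resp (sym s≈s) (Parabolic-s (i≢j ∘ ≡.sym))) s∉Parabolic
    where
    s≈s : s i ≈ s j
    s≈s = ≐-true⁻ (≡.trans (≡.sym (N-s j (s i))) (s⊑⁻ {i} {s j} p))

  N-s∙ : ∀ i x t → N (s i ∙ x) t ≡ (t ≐ s i) xor N x (t ^ s i)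
  N-s∙ i x t = ≡.trans (N-∙ (s i) x t) (≡.cong (_xor N x (t ^ s i)) (N-s i t))

  N-s∙-s : ∀ i x → N (s i ∙ x) (s i) ≡ not (N x (s i))
  N-s∙-s i x = ≡.trans (N-s∙ i x (s i)) (≡.cong₂ _xor_ (≐-true refl) (N-cong refl (^-self (s i))))

  N-s∙-other : ∀ {i t} x → (t ≐ s i) ≡ false → N (s i ∙ x) t ≡ N x (t ^ s i)
  N-s∙-other {i} {t} x p = ≡.trans (N-s∙ i x t) (≡.cong (_xor N x (t ^ s i)) p)

  -- Inversions other than s i are conjugated by s i. At s i itself the value flips, hence the
  -- hypothesis from y to x.
  s∙-mono : ∀ {i x y} → (s i ⊑ y → s i ⊑ x) → x ⊑ y → s i ∙ x ⊑ s i ∙ y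
  s∙-mono {i} {x} {y} y⇒x x⊑y t p with t ≐ s i in eq
  ... | false = ≡.trans (N-s∙-other y eq) (x⊑y _ (≡.trans (≡.sym (N-s∙-other x eq)) p))
  ... | true  = ≡.trans (N-cong refl (≐-true⁻ eq)) (≡.trans (N-s∙-s i y)
                  (≡.cong not (s⋢⁻ λ s⊑y → true≢false (s⊑⁻ (y⇒x s⊑y)) N-x)))
    where
    N-x : N x (s i) ≡ false
    N-x = ¬-not λ q → true≢false (≡.trans (N-cong refl (sym (≐-true⁻ eq))) p) (≡.trans (N-s∙-s i x) (≡.cong not q))

  cover-above : ∀ {i x} → ¬ s i ⊑ x → ∃[ k ] Step ((s i ∨ x) ∁) k × (s i ∨ x) ∁ ∙ s k ⊑ x ∁
  cover-above {i} {x} s⋢x with step (∁-antitone (proj₁ (proj₂ (proj₂ (join (s i) x)))))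
  ... | inj₂ p  = p
  ... | inj₁ eq = contradiction (⊑-trans (proj₁ (proj₂ (join (s i) x)))
        (⊑-trans (⊑-reflexive (sym (∁-involutive _))) (⊑-trans (⊑-reflexive (∙-congʳ eq)) (⊑-reflexive (∁-involutive x))))) s⋢x

  -- A cover of z = s i ∨ x from below that lies above x cannot lie above s i, so it is s i z.
  module _ {i : Fin rank} {x : Carrier} (s⋢x : ¬ s i ⊑ x) where
    private
      z = s i ∨ x
      s⊑z = proj₁ (proj₂ (join (s i) x))
      x⊑z = proj₁ (proj₂ (proj₂ (join (s i) x)))
      z-least = proj₂ (proj₂ (proj₂ (join (s i) x)))

      k = proj₁ (cover-above s⋢x)
      st = proj₁ (proj₂ (cover-above s⋢x))
      y = z ∁ ∙ s k
      t = s k ^ (z ∁ ⁻¹)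

      y∁⊑z : y ∁ ⊑ z
      y∁⊑z = ∁-swap (Step.⊑-step st)

      s⋢y∁ : N (y ∁) (s i) ≡ false
      s⋢y∁ = ¬-not λ p → true≢false (z-least (y ∁) (s⊑⁺ p) (∁-swap′ (proj₂ (proj₂ (cover-above s⋢x)))) t N-z) N-y∁
        where
        N-z : N z t ≡ true
        N-z = ¬-not λ q → true≢false (N-∁⁺ (N⇒Ref (Step.N-new st)) q) (Step.ascent st)
        N-y∁ : N (y ∁) t ≡ false
        N-y∁ = ≡.trans (N-∁ (N⇒Ref (Step.N-new st))) (≡.cong not (Step.N-new st))

      s≈t : s i ≈ t
      s≈t = Step.N-step st (¬-not λ p → true≢false (N-∁⁺ (Reflection-s tt) p) s⋢y∁)
        (≡.trans (N-∁ (Reflection-s tt)) (≡.cong not (s⊑⁻ s⊑z)))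

      below : ∀ {u} → N z u ≡ true → ¬ u ≈ s i → N (y ∁) u ≡ true
      below p u≉s = N-∁⁺ (N⇒Ref p) (¬-not λ q → u≉s (trans (Step.N-step st q (≡.trans (N-∁ (N⇒Ref p)) (≡.cong not p))) (sym s≈t)))

      y∁≈sz : y ∁ ≈ s i ∙ z
      y∁≈sz = trans (∙-congʳ (trans (eq (z ∁)) (∙-congʳ (sym s≈t)))) (trans (assoc _ _ _) (∙-congˡ (∁-involutive z)))
        where
        eq : ∀ u → u ∙ s k ≈ s k ^ (u ⁻¹) ∙ u
        eq u = sym (trans (assoc _ _ _) (∙-cong (⁻¹-involutive u)
          (trans (assoc _ _ _) (trans (∙-congˡ (inverseˡ u)) (identityʳ _)))))

    join-cover : s i ∙ (s i ∨ x) ≈ (s i ∨ x) ∧ s i ∁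
    join-cover = trans (sym y∁≈sz) (⊑-antisym
      (∧-greatest y∁⊑z λ u p → N-∁⁺ (N⇒Ref p) (N-s-other s⋢y∁ p))
      (λ u p → below (x∧y≤x z (s i ∁) u p) λ u≈s →
        true≢false (x∧y≤y z (s i ∁) u p) (≡.trans (N-∁ (N⇒Ref p)) (≡.cong not (≡.trans (N-s i u) (≐-true u≈s))))))

  s∙-descends : ∀ {i x} → s i ⊑ x → ¬ s i ⊑ s i ∙ x
  s∙-descends {i} {x} s⊑x p = true≢false (s⊑⁻ p) (≡.trans (N-s∙-s i x) (≡.cong not (s⊑⁻ s⊑x)))

  s∙-ascends : ∀ {i x} → ¬ s i ⊑ x → s i ⊑ s i ∙ x
  s∙-ascends {i} {x} s⋢x = s⊑⁺ (≡.trans (N-s∙-s i x) (≡.cong not (s⋢⁻ s⋢x)))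

  s⊑⇒ℓ< : ∀ {i x} → s i ⊑ x → ℓ (s i ∙ x) < ℓ x
  s⊑⇒ℓ< = N⇒ℓ< ∘ s⊑⁻

  ℓ<⇒s⊑ : ∀ {i x} → ℓ (s i ∙ x) < ℓ x → s i ⊑ x
  ℓ<⇒s⊑ = s⊑⁺ ∘ ℓ<⇒N (Reflection-s tt)

  module MaximalParabolic (r : Fin rank) where
    J : Fin rank → Set
    J i = i ≢ r

    J? : ∀ i → Dec (J i)
    J? i = ¬? (i Fin.≟ r)

    abstract
      top : Longest J
      top = longest J?

    s-top : ∀ {j} → J j → s j ⊑ element top
    s-top j∈J = s⊑⁺ (N-true top (Reflection-s j∈J))

    -- The parabolic factor of x is a common lower bound that keeps all inversions of x in J.
    N-∧ : ∀ {x t} → N x t ≡ true → N (element top) t ≡ true → N (x ∧ element top) t ≡ true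
    N-∧ {x} {t} p q with restriction J? x
    ... | u , u∈J , u⊑x , N≡ = ∧-greatest u⊑x (λ _ → N-true top ∘ N⇒Reflection u∈J) t (≡.trans (N≡ (N⇒ top q)) p)

    ⊑top⇒Parabolic : ∀ {x} → x ⊑ element top → Parabolic J x
    ⊑top⇒Parabolic {x} x⊑ with restriction J? x
    ... | u , u∈J , u⊑x , N≡ = Parabolic-resp (⊑-antisym u⊑x λ t p → ≡.trans (N≡ (N⇒ top (x⊑ t p))) p) u∈J

    Parabolic⇒⊑top : ∀ {x} → Parabolic J x → x ⊑ element top
    Parabolic⇒⊑top x∈J t p = N-true top (N⇒Reflection x∈J p)

    s⋢top : ¬ s r ⊑ element top
    s⋢top = s∉Parabolic ∘ ⊑top⇒Parabolic

    N-top∁ : ∀ {t} → Ref t → ¬ Reflection J t → N (element top ∁) t ≡ true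
    N-top∁ r t∉J = N-∁⁺ r (¬-not (t∉J ∘ N⇒ top))

    -- Inversions in J survive in the restriction; all other reflections are inversions of the
    -- complement of `element top`.
    section : ∀ x → x ⊑ (x ∧ element top) ∨ element top ∁
    section x t p with N (element top) t in eq
    ... | true  = x≤x∨y (x ∧ element top) (element top ∁) t (N-∧ p eq)
    ... | false = y≤x∨y (x ∧ element top) (element top ∁) t (N-∁⁺ (N⇒Ref p) eq)

    -- The largest element whose restriction is v.
    module _ {v : Carrier} (v∈J : Parabolic J v) where
      private
        v̂ = v ∙ element top ∁

      N-v̂ : ∀ {t} → Reflection J t → N v̂ t ≡ N v t
      N-v̂ {t} r = ≡.trans (N-∙ v (element top ∁) t) (≡.trans (≡.cong (N v t xor_)
        (≡.trans (N-∁ (Reflection⇒Ref (Reflection-^ v∈J r))) (≡.cong not (N-true top (Reflection-^ v∈J r)))))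
        (xor-identityʳ _))

      ⊑v̂ : ∀ {x} → x ∧ element top ⊑ v → x ⊑ v̂
      ⊑v̂ {x} x∧⊑v t p with N (element top) t in eq
      ... | true  = ≡.trans (N-v̂ (N⇒ top eq)) (x∧⊑v t (N-∧ p eq))
      ... | false = ≡.trans (N-∙ v (element top ∁) t) (≡.cong₂ _xor_
            (¬-not λ q → true≢false (Parabolic⇒⊑top v∈J t q) eq)
            (N-top∁ (Reflection-^ (All-Parabolic v) (N⇒Ref p)) λ r → true≢false (N-true top (Reflection-^⁻ v∈J r)) eq))

    -- With v the join of the restrictions, x and y both lie below the largest element restricting
    -- to v, hence so does x ∨ y.
    ∧-distrib : ∀ x y → (x ∨ y) ∧ element top ⊑ (x ∧ element top) ∨ (y ∧ element top)
    ∧-distrib x y t p = ≡.trans (≡.sym (N-v̂ v∈J (N⇒ top (x∧y≤y (x ∨ y) (element top) t p))))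
      (∨-least (⊑v̂ v∈J (x≤x∨y (x ∧ element top) (y ∧ element top))) (⊑v̂ v∈J (y≤x∨y (x ∧ element top) (y ∧ element top)))
               t (x∧y≤x (x ∨ y) (element top) t p))
      where
      v∈J : Parabolic J ((x ∧ element top) ∨ (y ∧ element top))
      v∈J = ⊑top⇒Parabolic (∨-least (x∧y≤y x (element top)) (x∧y≤y y (element top)))

  -- Conjugation by s i preserves the reflections of the rank two subgroup, which are all inversions
  -- of s i ∨ s j. A reflection outside it is an inversion of the complement of
  -- `element (Polygon.top i j)`, which lies below both s i ∁ and s j ∁.
  polygon : ∀ i j → s i ∁ ⊑ s i ∙ (s i ∨ s j) ∨ (s i ∁ ∧ s j ∁)
  polygon i j t p with Reflection? (Polygon.top i j) t
  ... | yes r = x≤x∨y (s i ∙ (s i ∨ s j)) (s i ∁ ∧ s j ∁) t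
        (≡.trans (N-s∙-other (s i ∨ s j) (≡.trans (≡.sym (N-s i t)) (N-∁⁻ p)))
                 (all-descents both (Reflection-^ (Parabolic-s (inj₁ ≡.refl)) r)))
    where
    both : ∀ k → k ≡ i ⊎ k ≡ j → N (s i ∨ s j) (s k) ≡ true
    both k (inj₁ ≡.refl) = s⊑⁻ (x≤x∨y (s i) (s j))
    both k (inj₂ ≡.refl) = s⊑⁻ (y≤x∨y (s i) (s j))
  ... | no ¬r = y≤x∨y (s i ∙ (s i ∨ s j)) (s i ∁ ∧ s j ∁) t
        (∧-greatest (below (inj₁ ≡.refl)) (below (inj₂ ≡.refl)) t (N-∁⁺ (N⇒Ref p) (¬-not (¬r ∘ N⇒ (Polygon.top i j)))))
    where
    below : ∀ {k} → k ≡ i ⊎ k ≡ j → element (Polygon.top i j) ∁ ⊑ s k ∁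
    below k∈ = ∁-antitone (s⊑⁺ (N-true (Polygon.top i j) (Reflection-s k∈)))

  cambrianLattice : CambrianLattice rank g e g
  cambrianLattice = record
    { lattice        = weakOrder
    ; ⊥              = ε
    ; ⊥-minimum      = ε-minimum
    ; _∁             = _∁
    ; ∁-antitone     = ∁-antitone
    ; ∁-involutive   = ∁-involutive
    ; atom           = s
    ; _atom≤?_       = λ i x → map′ s⊑⁺ s⊑⁻ (N x (s i) ≟ᵇ true)
    ; atom-∁         = λ {i} s⊑x x⊑ → true≢false (s⊑⁻ (⊑-trans s⊑x x⊑))
                         (≡.trans (N-∁ (Reflection-s tt)) (≡.cong not (≡.trans (N-s i (s i)) (≐-true refl))))
    ; ≰⇒≤∁           = λ s⋢x t p → N-∁⁺ (N⇒Ref p) (N-s-other (s⋢⁻ s⋢x) p)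
    ; atom-minimal   = λ x⊑s s⋢x t p → contradiction (N-s-other (s⋢⁻ s⋢x) p) (true≢false (x⊑s t p))
    ; atom-injective = s-injective
    ; atomic         = λ none → ⊑-reflexive (ascents⇒≈ε (All-Parabolic _) λ i _ → s⋢⁻ (none i))
    ; σ              = λ i x → s i ∙ x
    ; σ-involutive   = s-cancel
    ; σ-∁            = λ i x → sym (assoc _ _ _)
    ; σ-mono         = s∙-mono
    ; σ-descends     = s∙-descends
    ; σ-ascends      = s∙-ascends
    ; cover          = join-cover
    ; polygon        = polygon
    ; e              = λ r → element (MaximalParabolic.top r)
    ; e-upper        = λ {r} → MaximalParabolic.s-top r
    ; atom≰e         = λ r → MaximalParabolic.s⋢top r
    ; e-∨            = λ r → MaximalParabolic.∧-distrib r
    ; e-section      = λ r → MaximalParabolic.section r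
    ; σ-≤e           = λ {r} j≢r x⊑ → MaximalParabolic.Parabolic⇒⊑top r
                         (Parabolic-∙ (Parabolic-s j≢r) (MaximalParabolic.⊑top⇒Parabolic r x⊑))
    ; rk             = ℓ
    ; rk-cong        = ℓ-cong
    ; rk-descends    = s⊑⇒ℓ<
    }

  -- Agreement with the prefix order and with sorting words.

  ≤ᵂ⇒⊑ : ∀ {u w} → u ≤ᵂ w → u ⊑ w
  ≤ᵂ⇒⊑ {u} {w} (a , b , (a≈u , _) , ab≈w , minimal) t p with inv (a ++ b) t in eq
  ... | true  = ≡.trans (N-word (a ++ b) ab≈w t) eq
  -- An inversion t of u missing from w has odd parity in a, and its conjugate has odd parity in b.
  ... | false = shorter (delete-letter (All-⊤ a) inv-a) (delete-letter (All-⊤ b) inv-b)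
    where
    t′ = t ^ ⟦ a ⟧
    inv-a : inv a t ≡ true
    inv-a = ≡.trans (≡.sym (N-word a a≈u t)) p
    inv-b : inv b t′ ≡ true
    inv-b = ≡.trans (≡.sym (xor-false (≡.trans (≡.sym (inv-++ a b t)) eq))) inv-a
    -- Deleting one letter from each of a and b does not change the product.
    shorter : ∃[ a′ ] All (λ _ → ⊤) a′ × suc (length a′) ≡ length a × ⟦ a′ ⟧ ≈ t ∙ ⟦ a ⟧ →
              ∃[ b′ ] All (λ _ → ⊤) b′ × suc (length b′) ≡ length b × ⟦ b′ ⟧ ≈ t′ ∙ ⟦ b ⟧ → N w t ≡ true
    shorter (a′ , _ , len-a , a′≈) (b′ , _ , len-b , b′≈) = contradiction (minimal (a′ ++ b′) value) (ℕ.<⇒≱ len)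
      where
      open SetoidReasoning setoid
      value : ⟦ a′ ++ b′ ⟧ ≈ w
      value = begin
        ⟦ a′ ++ b′ ⟧                       ≈⟨ ⟦++⟧ a′ b′ ⟩
        ⟦ a′ ⟧ ∙ ⟦ b′ ⟧                    ≈⟨ ∙-cong a′≈ b′≈ ⟩
        t ∙ ⟦ a ⟧ ∙ (t′ ∙ ⟦ b ⟧)           ≈⟨ trans (assoc _ _ _) (∙-congˡ (trans (∙-congˡ (assoc _ _ _)) (cancelʳ ⟦ a ⟧ _))) ⟩
        t ∙ (t ∙ ⟦ a ⟧ ∙ ⟦ b ⟧)            ≈⟨ ∙-congˡ (assoc _ _ _) ⟩
        t ∙ (t ∙ (⟦ a ⟧ ∙ ⟦ b ⟧))          ≈⟨ Reflection-involutive (N⇒Ref p) _ ⟩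
        ⟦ a ⟧ ∙ ⟦ b ⟧                      ≈⟨ ⟦++⟧ a b ⟨
        ⟦ a ++ b ⟧                         ≈⟨ ab≈w ⟩
        w                                  ∎
      len : length (a′ ++ b′) < length (a ++ b)
      len = ≡.subst₂ _<_ (≡.sym (length-++ a′)) (≡.sym (length-++ a))
        (ℕ.+-mono-<-≤ (ℕ.≤-reflexive len-a) (ℕ.≤-trans (ℕ.n≤1+n _) (ℕ.≤-reflexive len-b)))

  ⊑⇒≤ᵂ : ∀ {u w} → u ⊑ w → u ≤ᵂ w
  ⊑⇒≤ᵂ {u} u⊑w = let a , a-red = reducedWord u ; b , ab-red = extend a a-red u⊑w in a , b , a-red , ab-red
    where
    -- The first letter of a reduced word of u is a descent of u and of w, so it can be cancelled
    -- from both; at the end u is `ε` and any reduced word of w serves.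
    extend : ∀ a {u w} → a IsReducedWordOf u → u ⊑ w → ∃[ b ] (a ++ b) IsReducedWordOf w
    extend []      {w = w} _ _ = reducedWord w
    extend (i ∷ a) {u} {w} (ia≈u , minimal) u⊑w = b , trans (∙-congˡ ab≈) (s-cancel i w) , shortest
      where
      a≈su : ⟦ a ⟧ ≈ s i ∙ u
      a≈su = trans (sym (s-cancel i _)) (∙-congˡ ia≈u)
      s⊑u : s i ⊑ u
      s⊑u = ℓ<⇒s⊑ (ℕ.≤-trans (s≤s (ℓ-≤ a a≈su)) (minimal (proj₁ (reducedWord u)) (proj₁ (proj₂ (reducedWord u)))))
      rest = extend a {s i ∙ u} {s i ∙ w}
        (a≈su , λ d d≈su → ℕ.≤-pred (minimal (i ∷ d) (trans (∙-congˡ d≈su) (s-cancel i u))))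
        (s∙-mono (λ _ → s⊑u) u⊑w)
      b = proj₁ rest
      ab≈ = proj₁ (proj₂ rest)
      shortest : ∀ d → ⟦ d ⟧ ≈ w → suc (length (a ++ b)) ≤ length d
      shortest d d≈w = ℕ.≤-trans (s≤s (proj₂ (proj₂ rest) (proj₁ (reducedWord (s i ∙ w))) (proj₁ (proj₂ (reducedWord (s i ∙ w))))))
        (ℕ.≤-trans (s⊑⇒ℓ< (⊑-trans s⊑u u⊑w)) (ℓ-≤ d d≈w))

  ≤ᵂ-isLattice : IsLattice _≈_ _≤ᵂ_ _∨_ _∧_
  ≤ᵂ-isLattice = record
    { isPartialOrder = record
      { isPreorder = record
        { isEquivalence = isEquivalence
        ; reflexive     = λ p → ⊑⇒≤ᵂ (⊑-reflexive p)
        ; trans         = λ p q → ⊑⇒≤ᵂ (⊑-trans (≤ᵂ⇒⊑ p) (≤ᵂ⇒⊑ q))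
        }
      ; antisym = λ p q → ⊑-antisym (≤ᵂ⇒⊑ p) (≤ᵂ⇒⊑ q)
      }
    ; supremum = λ x y → ⊑⇒≤ᵂ (x≤x∨y x y) , ⊑⇒≤ᵂ (y≤x∨y x y) , λ z p q → ⊑⇒≤ᵂ (∨-least (≤ᵂ⇒⊑ p) (≤ᵂ⇒⊑ q))
    ; infimum  = λ x y → ⊑⇒≤ᵂ (x∧y≤x x y) , ⊑⇒≤ᵂ (x∧y≤y x y) , λ z p q → ⊑⇒≤ᵂ (∧-greatest (≤ᵂ⇒⊑ p) (≤ᵂ⇒⊑ q))
    }

  open SortableElements cambrianLattice

  pass-Pass : ∀ a w → Pass a w (proj₁ (pass a w)) (proj₂ (pass a w))
  pass-Pass []      w = []
  pass-Pass (i ∷ a) w with ℓ (s i ∙ w) ℕ.<? ℓ w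
  ... | yes lt = take (ℓ<⇒s⊑ lt) (pass-Pass a (s i ∙ w))
  ... | no ≮   = skip (≮ ∘ s⊑⇒ℓ<) (pass-Pass a w)

  module _ (c : CoxeterElement) where
    open CoxeterElement c

    Sortable⇒Bot : ∀ {w} → Sortable c w → Bot word w
    Sortable⇒Bot {w} = decreasing⇒Bot enumeratesS (λ k → remaining c k w) (λ k → passLetters c k w)
      (λ k → pass-Pass word (remaining c k w))

    Bot⇒Sortable : ∀ {w} → Bot word w → Sortable c w
    Bot⇒Sortable {w} = Bot⇒decreasing enumeratesS (λ k → remaining c k w) (λ k → passLetters c k w)
      (λ k → pass-Pass word (remaining c k w))

theorem4p3 : {g e : Level} (W : Group g e) (C : CoxeterSystem W) (finite : Finite W) →
    let open Group W
        open Coxeter C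
        open Sorting finite
    in (c : CoxeterElement) →
       ∃₂ λ (_∨_ _∧_ : Op₂ Carrier) →
         IsLattice _≈_ _≤ᵂ_ _∨_ _∧_ ×
         (∀ u v → Sortable c u → Sortable c v → Sortable c (u ∧ v) × Sortable c (u ∨ v))
theorem4p3 W C finite c = _∨_ , _∧_ , ≤ᵂ-isLattice , λ u v su sv →
    Bot⇒Sortable c (Bot-∧ enumeratesS (Sortable⇒Bot c su) (Sortable⇒Bot c sv)) ,
    Bot⇒Sortable c (Bottom-∨ (Sortable⇒Bot c su) (Sortable⇒Bot c sv))
  where
  open Coxeter C
  open CoxeterElement c using (enumeratesS)
  open Sorting finite
  open WeakOrder W C finite using (_∨_; _∧_)
  open WeakOrderCambrian W C finite
  open Congruence cambrianLattice using (Bottom-∨)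
  open SortableElements cambrianLattice using (Bot-∧)
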